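{- Observational equivalence $\simeq$ is a congruence: it is an equivalence relation on terms and, whenever $P\simeq Q$, we have $\alpha.P\simeq\alpha.Q$ for every action $\alpha$, $P|R\simeq Q|R$, $R|P\simeq R|Q$, $P\parallel R\simeq Q\parallel R$, $R\parallel P\simeq R\parallel Q$ for every term $R$, $\diamond P\simeq\diamond Q$, and $\nu x\,P\simeq\nu x\,Q$ for every name $x$.
   Context: Fix a commutative semiring $(\mathbb K,+,\cdot,0,1)$ and a countable set $\mathcal N$ of names. Polarities are $+,-$; $\neg$ exchanges them. An action is $u^\varepsilon(x)$ with $u,x\in\mathcal N$, $\varepsilon$ a polarity ($u$ is its subject; $x$ is bound in the continuation). Terms (finite, no recursion): $P,Q::=k\mid \alpha.P\mid \diamond P\mid P|Q\mid P\parallel Q\mid \nu x\,P$ with $k\in\mathbb K$ ($|$: parallel composition with interaction; $\parallel$: without interaction; $\nu x$: hiding). Terms are taken up to injective renaming of bound names and $\nu x\nu y P=\nu y\nu x P$, bound names distinct from all other names. Positions are finite sequences of integers ordered by prefix; independent means incomparable. Labels: visible $u^\varepsilon(x):\iota$ or internal $(\iota,\kappa)$; $\iota.a$ prefixes every position of $a$ with $\iota$. Transitions: $\alpha.P\xrightarrow{\alpha:\epsilon}\diamond P$ ($\epsilon$ the empty position); if $P\xrightarrow{a}P'$ then $\diamond P\xrightarrow{1.a}\diamond P'$, $P|Q\xrightarrow{1.a}P'|Q$, $Q|P\xrightarrow{2.a}Q|P'$, $P\parallel Q\xrightarrow{1.a}P'\parallel Q$, $Q\parallel P\xrightarrow{2.a}Q\parallel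 P'$, and $\nu xP\xrightarrow{a}\nu xP'$ if $x\notin a$; if $P\xrightarrow{u^\varepsilon(x):\iota}P'$ and $Q\xrightarrow{u^{\neg\varepsilon}(y):\kappa}Q'$ then $P|Q\xrightarrow{(1.\iota,2.\kappa)}\nu x(P'|Q'[x/y])$. A path is a finite sequence of internal labels; it is valid for $P$ if it labels a sequence of transitions from $P$, reaching $P/p$. Labels are independent if all their positions are pairwise independent; homotopy is the smallest congruence on label sequences with $ab\sim ba$ for independent $a,b$. A run of $P$ is a homotopy class of maximal valid paths of $P$ (valid paths that are not a proper prefix of a valid path); $\mathrm{Runs}(P)$ is the (finite) set of runs and $P/\rho$ is well defined. The state is $s(k)=k$, $s(\alpha.P)=1$, $s(\diamond P)=s(\nu xP)=s(P)$, $s(P|Q)=s(P\parallel Q)=s(P)s(Q)$. The outcome is $\langle P\rangle=\sum_{\rho\in\mathrm{Runs}(P)}s(P/\rho)$. Observational equivalence: $P\simeq Q$ iff $\langle P|R\rangle=\langle Q|R\rangle$ for all terms $R$. -}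

module Defs where

open import Algebra.Bundles using (CommutativeSemiring)
open import Data.Empty using (⊥-elim)
open import Data.Integer.Base using (ℤ; +_)
import Data.Integer.Properties as ℤ
open import Data.List.Base
  using (List; []; _∷_; _++_; [_]; map; concatMap; foldr; deduplicate)
open import Data.List.Membership.Propositional using (_∈_; lose)
open import Data.List.Membership.Propositional.Properties
  using (∈-map⁺; ∈-++⁺ˡ; ∈-++⁺ʳ; ∈-concatMap⁺)
import Data.List.Membership.Setoid.Properties as SetoidMembership
import Data.List.Properties as List
open import Data.List.Relation.Binary.Prefix.Heterogeneous
  using (Prefix; []; _∷_)
open import Data.List.Relation.Binary.Prefix.Heterogeneous.Properties
  using (prefix?)
open import Data.List.Relation.Unary.Any as Any using (Any; here; there)
import Data.List.Relation.Unary.Any.Properties as Any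
open import Data.List.Relation.Unary.Enumerates.Setoid using (IsEnumeration)
open import Data.List.Relation.Unary.Unique.DecSetoid.Properties
  using (deduplicate-!)
open import Data.List.Relation.Unary.Unique.Setoid using (Unique)
open import Data.Nat.Base using (ℕ; zero; suc; _+_; _<_)
open import Data.Nat.Induction using (Acc; acc; <-wellFounded)
import Data.Nat.Properties as ℕ
open import Data.Product.Base using (∃-syntax; _×_; _,_; proj₁; proj₂)
import Data.Product.Properties as Product
open import Data.Sign.Base using (Sign; opposite)
import Data.Sign.Properties as Sign
open import Level using (Level; 0ℓ; _⊔_)
open import Relation.Binary.Bundles using (DecSetoid; Setoid)
open import Relation.Binary.Definitions using (Decidable; DecidableEquality)
open import Relation.Binary.PropositionalEquality
  using (_≡_; refl; sym; trans; cong; cong₂; subst; ≡-≟-identity)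
open import Relation.Nullary.Decidable
  using (Dec; yes; no; ¬?; map′; _×-dec_)
open import Relation.Nullary.Negation using (¬_)

-- Terms are in de Bruijn form, so that injective renaming of bound names is
-- the identity: below n binders, the variables 0, …, n - 1 are bound and the
-- variable n + x is the free name x.

Name : Set
Name = ℕ

record Action : Set where
  constructor _^_⟨_⟩
  field
    subject  : Name
    polarity : Sign
    object   : Name

ext : (Name → Name) → (Name → Name)
ext ρ zero    = zero
ext ρ (suc y) = suc (ρ y)

swap : Name → Name
swap zero          = 1
swap (suc zero)    = 0
swap (suc (suc y)) = suc (suc y)

-- bind x sends x to the variable 0 and every other free name to itself, below
-- one new binder.

bind : Name → (Name → Name)
bind x y with x ℕ.≟ y
... | yes _ = zero
... | no  _ = suc y

Position : Set
Position = List ℤ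

Independent : Position → Position → Set
Independent ι κ = ¬ Prefix _≡_ ι κ × ¬ Prefix _≡_ κ ι

Label : Set
Label = Position × Position

infix 4 _#_

_#_ : Label → Label → Set
(ι , κ) # (ι′ , κ′) =
    Independent ι ι′ × Independent ι κ′
  × Independent κ ι′ × Independent κ κ′

Path : Set
Path = List Label

infix 4 _∼_

data _∼_ : Path → Path → Set where
  commute : ∀ {a b} → a # b → a ∷ b ∷ [] ∼ b ∷ a ∷ []
  ∼-refl  : ∀ {p} → p ∼ p
  ∼-sym   : ∀ {p q} → p ∼ q → q ∼ p
  ∼-trans : ∀ {p q r} → p ∼ q → q ∼ r → p ∼ r
  ∼-++    : ∀ {p p′ q q′} → p ∼ p′ → q ∼ q′ → p ++ q ∼ p′ ++ q′

-- An equivalent description of homotopy by cancellation: Pull a q q′ holds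
-- when an occurrence of a can be commuted to the front of q, leaving q′.

module Cancellation where

  data Pull (a : Label) : Path → Path → Set where
    here  : ∀ {q} → Pull a (a ∷ q) q
    there : ∀ {b q q′} → a # b → Pull a q q′ → Pull a (b ∷ q) (b ∷ q′)

  infix 4 _≅_

  data _≅_ : Path → Path → Set where
    []   : [] ≅ []
    pull : ∀ {a p q q′} → Pull a q q′ → p ≅ q′ → a ∷ p ≅ q

  #-sym : ∀ {a b} → a # b → b # a
  #-sym ((a , b) , (c , d) , (e , f) , (g , h)) =
    (b , a) , (f , e) , (d , c) , (h , g)

  prefix-refl : ∀ (ι : Position) → Prefix _≡_ ι ι
  prefix-refl []      = []
  prefix-refl (i ∷ ι) = refl ∷ prefix-refl ι

  #-irrefl : ∀ {a} → ¬ a # a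
  #-irrefl {ι , κ} ((ι≰ι , _) , _) = ι≰ι (prefix-refl ι)

  ≅-refl : ∀ {p} → p ≅ p
  ≅-refl {[]}    = []
  ≅-refl {a ∷ p} = pull here ≅-refl

  pull-pull : ∀ {a b r r₁ r₂} → a # b → Pull b r r₁ → Pull a r₁ r₂ →
              ∃[ r′ ] Pull a r r′ × Pull b r′ r₂
  pull-pull a#b here          y          = _ , there a#b y , here
  pull-pull a#b (there b#c x) here       = _ , here , x
  pull-pull a#b (there b#c x) (there a#c y) with pull-pull a#b x y
  ... | _ , y′ , x′ = _ , there a#c y′ , there b#c x′

  pull-≅ : ∀ {a q q′ r} → Pull a q q′ → q ≅ r →
           ∃[ r′ ] Pull a r r′ × q′ ≅ r′
  pull-≅ here          (pull x e) = _ , x , e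
  pull-≅ (there a#b y) (pull x e) with pull-≅ y e
  ... | _ , z , e′ with pull-pull a#b x z
  ...   | _ , z′ , x′ = _ , z′ , pull x′ e′

  ≅-trans : ∀ {p q r} → p ≅ q → q ≅ r → p ≅ r
  ≅-trans []         f = f
  ≅-trans (pull x e) f with pull-≅ x f
  ... | _ , y , f′ = pull y (≅-trans e f′)

  front : ∀ {a q q′} → Pull a q q′ → q ≅ a ∷ q′
  front here          = ≅-refl
  front (there a#b x) = pull (there (#-sym a#b) here) (front x)

  ≅-sym : ∀ {p q} → p ≅ q → q ≅ p
  ≅-sym []         = []
  ≅-sym (pull x e) = ≅-trans (front x) (pull here (≅-sym e))

  pull-++ : ∀ {a q q′} r → Pull a q q′ → Pull a (q ++ r) (q′ ++ r)
  pull-++ r here          = here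
  pull-++ r (there a#b x) = there a#b (pull-++ r x)

  ≅-++ : ∀ {p p′ q q′} → p ≅ p′ → q ≅ q′ → p ++ q ≅ p′ ++ q′
  ≅-++ []         f = f
  ≅-++ (pull x e) f = ≅-trans (pull here (≅-++ e f)) (≅-sym (front (pull-++ _ x)))

  ∼⇒≅ : ∀ {p q} → p ∼ q → p ≅ q
  ∼⇒≅ (commute a#b) = pull (there a#b here) ≅-refl
  ∼⇒≅ ∼-refl        = ≅-refl
  ∼⇒≅ (∼-sym e)     = ≅-sym (∼⇒≅ e)
  ∼⇒≅ (∼-trans e f) = ≅-trans (∼⇒≅ e) (∼⇒≅ f)
  ∼⇒≅ (∼-++ e f)    = ≅-++ (∼⇒≅ e) (∼⇒≅ f)

  pull⇒∼ : ∀ {a q q′} → Pull a q q′ → a ∷ q′ ∼ q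
  pull⇒∼ here = ∼-refl
  pull⇒∼ (there {b} a#b x) =
    ∼-trans (∼-++ (commute a#b) ∼-refl) (∼-++ (∼-refl {b ∷ []}) (pull⇒∼ x))

  ≅⇒∼ : ∀ {p q} → p ≅ q → p ∼ q
  ≅⇒∼ []               = ∼-refl
  ≅⇒∼ (pull {a} x e) = ∼-trans (∼-++ (∼-refl {a ∷ []}) (≅⇒∼ e)) (pull⇒∼ x)

  _≟_ : DecidableEquality Label
  _≟_ = Product.≡-dec (List.≡-dec ℤ._≟_) (List.≡-dec ℤ._≟_)

  independent? : Decidable Independent
  independent? ι κ = ¬? (prefix? ℤ._≟_ ι κ) ×-dec ¬? (prefix? ℤ._≟_ κ ι)

  _#?_ : Decidable _#_
  (ι , κ) #? (ι′ , κ′) =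
    independent? ι ι′ ×-dec independent? ι κ′ ×-dec
    independent? κ ι′ ×-dec independent? κ κ′

  pull? : ∀ a q → Dec (∃[ q′ ] Pull a q q′)
  pull? a []      = no λ ()
  pull? a (b ∷ q) with a ≟ b
  ... | yes refl = yes (q , here)
  ... | no a≢b   =
    map′ (λ (a#b , q′ , x) → b ∷ q′ , there a#b x)
         (λ { (_ , here) → ⊥-elim (a≢b refl) ; (_ , there a#b x) → a#b , _ , x })
         ((a #? b) ×-dec pull? a q)

  pull-unique : ∀ {a q q₁ q₂} → Pull a q q₁ → Pull a q q₂ → q₁ ≡ q₂
  pull-unique here          here          = refl
  pull-unique here          (there a#a _) = ⊥-elim (#-irrefl a#a)
  pull-unique (there a#a _) here          = ⊥-elim (#-irrefl a#a)
  pull-unique (there _ x)   (there _ y)   = cong (_ ∷_) (pull-unique x y)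

  _≅?_ : Decidable _≅_
  []      ≅? []      = yes []
  []      ≅? (_ ∷ _) = no λ ()
  (a ∷ p) ≅? q with pull? a q
  ... | no ¬x        = no λ { (pull x _) → ¬x (_ , x) }
  ... | yes (q′ , x) =
    map′ (pull x)
         (λ { (pull y e) → subst (p ≅_) (pull-unique y x) e })
         (p ≅? q′)

_∼?_ : Decidable _∼_
p ∼? q = map′ ≅⇒∼ ∼⇒≅ (p ≅? q) where open Cancellation

module Calculus {c ℓ : Level} (𝕂 : CommutativeSemiring c ℓ) where

  open CommutativeSemiring 𝕂 public
    using (_≈_; 0#; 1#)
    renaming (Carrier to K; _+_ to _+ᴷ_; _*_ to _*ᴷ_)

  infixr 8 _∙_
  infixr 8 ◇_
  infixl 7 _∣_
  infixl 7 _∥_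

  -- act and hide bind the variable 0 of their last argument.

  data Term : Set c where
    const : K → Term
    act   : Name → Sign → Term → Term
    ◇_    : Term → Term
    _∣_   : Term → Term → Term
    _∥_   : Term → Term → Term
    hide  : Term → Term

  rename : (Name → Name) → Term → Term
  rename ρ (const k)   = const k
  rename ρ (act u ε P) = act (ρ u) ε (rename (ext ρ) P)
  rename ρ (◇ P)       = ◇ rename ρ P
  rename ρ (P ∣ Q)     = rename ρ P ∣ rename ρ Q
  rename ρ (P ∥ Q)     = rename ρ P ∥ rename ρ Q
  rename ρ (hide P)    = hide (rename (ext ρ) P)

  ↑ : Term → Term
  ↑ = rename suc

  _∙_ : Action → Term → Term
  u ^ ε ⟨ x ⟩ ∙ P = act u ε (rename (bind x) P)

  ν : Name → Term → Term
  ν x P = hide (rename (bind x) P)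

  -- The rule hide-hide is νx νy P = νy νx P.

  infix 4 _≋_

  data _≋_ : Term → Term → Set (c ⊔ ℓ) where
    hide-hide  : ∀ {P} → hide (hide P) ≋ hide (hide (rename swap P))
    ≋-refl     : ∀ {P} → P ≋ P
    ≋-sym      : ∀ {P Q} → P ≋ Q → Q ≋ P
    ≋-trans    : ∀ {P Q R} → P ≋ Q → Q ≋ R → P ≋ R
    const-cong : ∀ {k l} → k ≈ l → const k ≋ const l
    act-cong   : ∀ {u ε P Q} → P ≋ Q → act u ε P ≋ act u ε Q
    ◇-cong     : ∀ {P Q} → P ≋ Q → ◇ P ≋ ◇ Q
    ∣-cong     : ∀ {P P′ Q Q′} → P ≋ P′ → Q ≋ Q′ → P ∣ Q ≋ P′ ∣ Q′
    ∥-cong     : ∀ {P P′ Q Q′} → P ≋ P′ → Q ≋ Q′ → P ∥ Q ≋ P′ ∥ Q′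
    hide-cong  : ∀ {P Q} → P ≋ Q → hide P ≋ hide Q

  -- P —[ u ^ ε ∶ ι ]→ P′ is the visible transition with label u^ε(x):ι,
  -- where x is the variable 0 of P′ and each free name y of P has become
  -- suc y. In the rule for hide, the side condition that the hidden name
  -- does not occur in the label is the shape suc u of the subject.

  infix 4 _—[_^_∶_]→_ _—⟨_⟩→_ _—⟪_⟫→_

  data _—[_^_∶_]→_ : Term → Name → Sign → Position → Term → Set c where
    act  : ∀ {u ε P} → act u ε P —[ u ^ ε ∶ [] ]→ ◇ P
    ◇_   : ∀ {u ε ι P P′} → P —[ u ^ ε ∶ ι ]→ P′ →
           ◇ P —[ u ^ ε ∶ + 1 ∷ ι ]→ ◇ P′
    ∣ˡ   : ∀ {u ε ι P P′ Q} → P —[ u ^ ε ∶ ι ]→ P′ →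
           P ∣ Q —[ u ^ ε ∶ + 1 ∷ ι ]→ P′ ∣ ↑ Q
    ∣ʳ   : ∀ {u ε ι P P′ Q} → P —[ u ^ ε ∶ ι ]→ P′ →
           Q ∣ P —[ u ^ ε ∶ + 2 ∷ ι ]→ ↑ Q ∣ P′
    ∥ˡ   : ∀ {u ε ι P P′ Q} → P —[ u ^ ε ∶ ι ]→ P′ →
           P ∥ Q —[ u ^ ε ∶ + 1 ∷ ι ]→ P′ ∥ ↑ Q
    ∥ʳ   : ∀ {u ε ι P P′ Q} → P —[ u ^ ε ∶ ι ]→ P′ →
           Q ∥ P —[ u ^ ε ∶ + 2 ∷ ι ]→ ↑ Q ∥ P′
    hide : ∀ {u ε ι P P′} → P —[ suc u ^ ε ∶ ι ]→ P′ →
           hide P —[ u ^ ε ∶ ι ]→ hide (rename swap P′)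

  data _—⟨_⟩→_ : Term → Label → Term → Set c where
    ◇_   : ∀ {ι κ P P′} → P —⟨ ι , κ ⟩→ P′ →
           ◇ P —⟨ + 1 ∷ ι , + 1 ∷ κ ⟩→ ◇ P′
    ∣ˡ   : ∀ {ι κ P P′ Q} → P —⟨ ι , κ ⟩→ P′ →
           P ∣ Q —⟨ + 1 ∷ ι , + 1 ∷ κ ⟩→ P′ ∣ Q
    ∣ʳ   : ∀ {ι κ P P′ Q} → P —⟨ ι , κ ⟩→ P′ →
           Q ∣ P —⟨ + 2 ∷ ι , + 2 ∷ κ ⟩→ Q ∣ P′
    ∥ˡ   : ∀ {ι κ P P′ Q} → P —⟨ ι , κ ⟩→ P′ →
           P ∥ Q —⟨ + 1 ∷ ι , + 1 ∷ κ ⟩→ P′ ∥ Q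
    ∥ʳ   : ∀ {ι κ P P′ Q} → P —⟨ ι , κ ⟩→ P′ →
           Q ∥ P —⟨ + 2 ∷ ι , + 2 ∷ κ ⟩→ Q ∥ P′
    hide : ∀ {ι κ P P′} → P —⟨ ι , κ ⟩→ P′ →
           hide P —⟨ ι , κ ⟩→ hide P′
    sync : ∀ {u ε ι κ P P′ Q Q′} →
           P —[ u ^ ε ∶ ι ]→ P′ → Q —[ u ^ opposite ε ∶ κ ]→ Q′ →
           P ∣ Q —⟨ + 1 ∷ ι , + 2 ∷ κ ⟩→ hide (P′ ∣ Q′)

  data _—⟪_⟫→_ : Term → Path → Term → Set c where
    []  : ∀ {P} → P —⟪ [] ⟫→ P
    _∷_ : ∀ {a p P P′ Q} → P —⟨ a ⟩→ P′ → P′ —⟪ p ⟫→ Q → P —⟪ a ∷ p ⟫→ Q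

  Valid : Term → Path → Set c
  Valid P p = ∃[ Q ] P —⟪ p ⟫→ Q

  record MaximalPath (P : Term) : Set c where
    field
      path    : Path
      target  : Term
      reaches : P —⟪ path ⟫→ target
      maximal : ∀ q → Valid P (path ++ q) → q ≡ []

  open MaximalPath public

  runsDecSetoid : Term → DecSetoid c 0ℓ
  runsDecSetoid P = record
    { Carrier          = MaximalPath P
    ; _≈_              = λ ρ σ → path ρ ∼ path σ
    ; isDecEquivalence = record
      { isEquivalence = record { refl = ∼-refl ; sym = ∼-sym ; trans = ∼-trans }
      ; _≟_           = λ ρ σ → path ρ ∼? path σ
      }
    }

  Runs : Term → Setoid c 0ℓ
  Runs P = DecSetoid.setoid (runsDecSetoid P)

  module Finiteness where

    visible-deterministic : ∀ {P u v ε δ ι P₁ P₂} →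
      P —[ u ^ ε ∶ ι ]→ P₁ → P —[ v ^ δ ∶ ι ]→ P₂ → u ≡ v × ε ≡ δ × P₁ ≡ P₂
    visible-deterministic act      act    = refl , refl , refl
    visible-deterministic (◇ s)    (◇ t)  with visible-deterministic s t
    ... | refl , refl , refl = refl , refl , refl
    visible-deterministic (∣ˡ s)   (∣ˡ t) with visible-deterministic s t
    ... | refl , refl , refl = refl , refl , refl
    visible-deterministic (∣ʳ s)   (∣ʳ t) with visible-deterministic s t
    ... | refl , refl , refl = refl , refl , refl
    visible-deterministic (∥ˡ s)   (∥ˡ t) with visible-deterministic s t
    ... | refl , refl , refl = refl , refl , refl
    visible-deterministic (∥ʳ s)   (∥ʳ t) with visible-deterministic s t
    ... | refl , refl , refl = refl , refl , refl
    visible-deterministic (hide s) (hide t) with visible-deterministic s t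
    ... | refl , refl , refl = refl , refl , refl

    deterministic : ∀ {P a P₁ P₂} → P —⟨ a ⟩→ P₁ → P —⟨ a ⟩→ P₂ → P₁ ≡ P₂
    deterministic (◇ s)    (◇ t)    = cong ◇_ (deterministic s t)
    deterministic (∣ˡ s)   (∣ˡ t)   = cong (_∣ _) (deterministic s t)
    deterministic (∣ʳ s)   (∣ʳ t)   = cong (_ ∣_) (deterministic s t)
    deterministic (∥ˡ s)   (∥ˡ t)   = cong (_∥ _) (deterministic s t)
    deterministic (∥ʳ s)   (∥ʳ t)   = cong (_ ∥_) (deterministic s t)
    deterministic (hide s) (hide t) = cong hide (deterministic s t)
    deterministic (sync s s′) (sync t t′) =
      cong₂ (λ P Q → hide (P ∣ Q))
        (proj₂ (proj₂ (visible-deterministic s t)))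
        (proj₂ (proj₂ (visible-deterministic s′ t′)))

    record Visible (P : Term) : Set c where
      constructor visible
      field
        {u} : Name
        {ε} : Sign
        {ι} : Position
        {P′} : Term
        step : P —[ u ^ ε ∶ ι ]→ P′

    record Internal (P : Term) : Set c where
      constructor internal
      field
        {a} : Label
        {P′} : Term
        step : P —⟨ a ⟩→ P′

    unhide : ∀ {P} → Visible P → List (Visible (hide P))
    unhide (visible {zero}  s) = []
    unhide (visible {suc u} s) = [ visible (hide s) ]

    visibles : ∀ P → List (Visible P)
    visibles (const k)   = []
    visibles (act u ε P) = [ visible act ]
    visibles (◇ P)       = map (λ (visible s) → visible (◇ s)) (visibles P)
    visibles (P ∣ Q)     = map (λ (visible s) → visible (∣ˡ s)) (visibles P)
                        ++ map (λ (visible s) → visible (∣ʳ s)) (visibles Q)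
    visibles (P ∥ Q)     = map (λ (visible s) → visible (∥ˡ s)) (visibles P)
                        ++ map (λ (visible s) → visible (∥ʳ s)) (visibles Q)
    visibles (hide P)    = concatMap unhide (visibles P)

    visibles-complete : ∀ {P u ε ι P′} (s : P —[ u ^ ε ∶ ι ]→ P′) →
                        visible s ∈ visibles P
    visibles-complete act      = here refl
    visibles-complete (◇ s)    = ∈-map⁺ _ (visibles-complete s)
    visibles-complete (∣ˡ s)   = ∈-++⁺ˡ (∈-map⁺ _ (visibles-complete s))
    visibles-complete (∣ʳ {Q = Q} s) =
      ∈-++⁺ʳ (map _ (visibles Q)) (∈-map⁺ _ (visibles-complete s))
    visibles-complete (∥ˡ s)   = ∈-++⁺ˡ (∈-map⁺ _ (visibles-complete s))
    visibles-complete (∥ʳ {Q = Q} s) =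
      ∈-++⁺ʳ (map _ (visibles Q)) (∈-map⁺ _ (visibles-complete s))
    visibles-complete (hide s) =
      ∈-concatMap⁺ _ (lose (visibles-complete s) (here refl))

    synchronise : ∀ {P Q} → Visible P → Visible Q → List (Internal (P ∣ Q))
    synchronise (visible {u} {ε} s) (visible {v} {δ} t)
      with u ℕ.≟ v | opposite ε Sign.≟ δ
    ... | yes refl | yes refl = [ internal (sync s t) ]
    ... | yes _    | no _     = []
    ... | no _     | _        = []

    synchronise-complete : ∀ {u ε ι κ P P′ Q Q′}
      (s : P —[ u ^ ε ∶ ι ]→ P′) (t : Q —[ u ^ opposite ε ∶ κ ]→ Q′) →
      internal (sync s t) ∈ synchronise (visible s) (visible t)
    synchronise-complete {u} {ε} s t
      rewrite ≡-≟-identity ℕ._≟_ (refl {x = u})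
            | ≡-≟-identity Sign._≟_ (refl {x = opposite ε}) = here refl

    internals : ∀ P → List (Internal P)
    internals (const k)   = []
    internals (act u ε P) = []
    internals (◇ P)       = map (λ (internal s) → internal (◇ s)) (internals P)
    internals (P ∣ Q)     =
         map (λ (internal s) → internal (∣ˡ s)) (internals P)
      ++ map (λ (internal s) → internal (∣ʳ s)) (internals Q)
      ++ concatMap (λ s → concatMap (synchronise s) (visibles Q)) (visibles P)
    internals (P ∥ Q)     =
         map (λ (internal s) → internal (∥ˡ s)) (internals P)
      ++ map (λ (internal s) → internal (∥ʳ s)) (internals Q)
    internals (hide P)    = map (λ (internal s) → internal (hide s)) (internals P)

    internals-complete : ∀ {P a P′} (s : P —⟨ a ⟩→ P′) →
                         internal s ∈ internals P
    internals-complete (◇ s)    = ∈-map⁺ _ (internals-complete s)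
    internals-complete (∣ˡ s)   = ∈-++⁺ˡ (∈-map⁺ _ (internals-complete s))
    internals-complete (∣ʳ {Q = Q} s) =
      ∈-++⁺ʳ (map _ (internals Q)) (∈-++⁺ˡ (∈-map⁺ _ (internals-complete s)))
    internals-complete (∥ˡ s)   = ∈-++⁺ˡ (∈-map⁺ _ (internals-complete s))
    internals-complete (∥ʳ {Q = Q} s) =
      ∈-++⁺ʳ (map _ (internals Q)) (∈-map⁺ _ (internals-complete s))
    internals-complete (hide s) = ∈-map⁺ _ (internals-complete s)
    internals-complete (sync {P = P} {Q = Q} s t) =
      ∈-++⁺ʳ (map _ (internals P)) (∈-++⁺ʳ (map _ (internals Q))
        (∈-concatMap⁺ _ (lose (visibles-complete s)
          (∈-concatMap⁺ _ (lose (visibles-complete t) (synchronise-complete s t))))))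

    size : Term → ℕ
    size (const k)   = 0
    size (act u ε P) = suc (size P)
    size (◇ P)       = size P
    size (P ∣ Q)     = size P + size Q
    size (P ∥ Q)     = size P + size Q
    size (hide P)    = size P

    size-rename : ∀ ρ P → size (rename ρ P) ≡ size P
    size-rename ρ (const k)   = refl
    size-rename ρ (act u ε P) = cong suc (size-rename (ext ρ) P)
    size-rename ρ (◇ P)       = size-rename ρ P
    size-rename ρ (P ∣ Q)     = cong₂ _+_ (size-rename ρ P) (size-rename ρ Q)
    size-rename ρ (P ∥ Q)     = cong₂ _+_ (size-rename ρ P) (size-rename ρ Q)
    size-rename ρ (hide P)    = size-rename (ext ρ) P

    visible-size : ∀ {P u ε ι P′} → P —[ u ^ ε ∶ ι ]→ P′ → size P′ < size P
    visible-size act   = ℕ.≤-refl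
    visible-size (◇ s) = visible-size s
    visible-size (∣ˡ {Q = Q} s) rewrite size-rename suc Q =
      ℕ.+-monoˡ-< (size Q) (visible-size s)
    visible-size (∣ʳ {Q = Q} s) rewrite size-rename suc Q =
      ℕ.+-monoʳ-< (size Q) (visible-size s)
    visible-size (∥ˡ {Q = Q} s) rewrite size-rename suc Q =
      ℕ.+-monoˡ-< (size Q) (visible-size s)
    visible-size (∥ʳ {Q = Q} s) rewrite size-rename suc Q =
      ℕ.+-monoʳ-< (size Q) (visible-size s)
    visible-size (hide {P′ = P′} s) rewrite size-rename swap P′ = visible-size s

    internal-size : ∀ {P a P′} → P —⟨ a ⟩→ P′ → size P′ < size P
    internal-size (◇ s) = internal-size s
    internal-size (∣ˡ {Q = Q} s) = ℕ.+-monoˡ-< (size Q) (internal-size s)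
    internal-size (∣ʳ {Q = Q} s) = ℕ.+-monoʳ-< (size Q) (internal-size s)
    internal-size (∥ˡ {Q = Q} s) = ℕ.+-monoˡ-< (size Q) (internal-size s)
    internal-size (∥ʳ {Q = Q} s) = ℕ.+-monoʳ-< (size Q) (internal-size s)
    internal-size (hide s) = internal-size s
    internal-size (sync s t) = ℕ.+-mono-< (visible-size s) (visible-size t)

    stop : ∀ {P} (ss : List (Internal P)) →
           (∀ {a P′} (s : P —⟨ a ⟩→ P′) → internal s ∈ ss) → List (MaximalPath P)
    stop []      complete = [ record
      { path    = []
      ; target  = _
      ; reaches = []
      ; maximal = λ { []      _              → refl
                    ; (_ ∷ _) (_ , (s ∷ _)) → case-∈[] (complete s) }
      } ]
      where
      case-∈[] : ∀ {a} {A : Set a} {B : Set} {x : A} → x ∈ [] → B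
      case-∈[] ()
    stop (_ ∷ _) complete = []

    cons : ∀ {P a P′} → P —⟨ a ⟩→ P′ → MaximalPath P′ → MaximalPath P
    cons {a = a} s ρ = record
      { path    = a ∷ path ρ
      ; target  = target ρ
      ; reaches = s ∷ reaches ρ
      ; maximal = λ { q (_ , (t ∷ ts)) →
          maximal ρ q (_ , subst (_—⟪ path ρ ++ q ⟫→ _) (deterministic t s) ts) }
      }

    maximalPaths : ∀ P → Acc _<_ (size P) → List (MaximalPath P)
    maximalPaths P (acc rs) =
      stop (internals P) internals-complete ++
      concatMap (λ (internal s) → map (cons s) (maximalPaths _ (rs (internal-size s))))
        (internals P)

    stop-complete : ∀ {P} (ss : List (Internal P))
      (complete : ∀ {a P′} (s : P —⟨ a ⟩→ P′) → internal s ∈ ss) →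
      (∀ {a P′} → ¬ P —⟨ a ⟩→ P′) →
      Any (λ σ → [] ≡ path σ) (stop ss complete)
    stop-complete []               complete stuck = here refl
    stop-complete (internal s ∷ _) complete stuck = ⊥-elim (stuck s)

    continue : ∀ {P a p P′ Q} → P —⟨ a ⟩→ P′ → P′ —⟪ p ⟫→ Q →
               (∀ q → Valid P (a ∷ p ++ q) → q ≡ []) → MaximalPath P′
    continue s ss m = record
      { path    = _
      ; target  = _
      ; reaches = ss
      ; maximal = λ q (R , ts) → m q (R , s ∷ ts)
      }

    maximalPaths-complete : ∀ P (rec : Acc _<_ (size P)) (ρ : MaximalPath P) →
               Any (λ σ → path ρ ≡ path σ) (maximalPaths P rec)
    maximalPaths-complete P (acc rs) record { path = [] ; maximal = m } =
      Any.++⁺ˡ (stop-complete (internals P) internals-complete stuck)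
      where
      stuck : ∀ {a P′} → ¬ P —⟨ a ⟩→ P′
      stuck s with m _ (_ , s ∷ [])
      ... | ()
    maximalPaths-complete P (acc rs) record { path = _ ∷ _ ; reaches = s ∷ ss ; maximal = m } =
      Any.++⁺ʳ (stop (internals P) internals-complete)
        (Any.concatMap⁺ _ (lose (internals-complete s)
          (Any.map⁺ (Any.map (cong (_ ∷_))
            (maximalPaths-complete _ (rs (internal-size s)) (continue s ss m))))))

  finite : ∀ P → ∃[ ρs ] Unique (Runs P) ρs × IsEnumeration (Runs P) ρs
  finite P =
      deduplicate (DecSetoid._≟_ (runsDecSetoid P)) ρs
    , deduplicate-! (runsDecSetoid P) ρs
    , λ ρ → SetoidMembership.∈-deduplicate⁺ (Runs P)
              (DecSetoid._≟_ (runsDecSetoid P))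
              (λ e f → ∼-trans f (∼-sym e)) {xs = ρs} {z = ρ}
              (Any.map ≡⇒∼ (maximalPaths-complete P (<-wellFounded (size P)) ρ))
    where
    open Finiteness
    ρs : List (MaximalPath P)
    ρs = maximalPaths P (<-wellFounded (size P))
    ≡⇒∼ : ∀ {p q} → p ≡ q → p ∼ q
    ≡⇒∼ refl = ∼-refl

  runs : ∀ P → List (MaximalPath P)
  runs P = proj₁ (finite P)

  state : Term → K
  state (const k)   = k
  state (act u ε P) = 1#
  state (◇ P)       = state P
  state (P ∣ Q)     = state P *ᴷ state Q
  state (P ∥ Q)     = state P *ᴷ state Q
  state (hide P)    = state P

  -- The target of a path depends on the chosen representative of the run only
  -- up to _≋_, which state does not see.

  outcome : Term → K
  outcome P = foldr (λ ρ k → state (target ρ) +ᴷ k) 0# (runs P)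

  infix 4 _≃_

  _≃_ : Term → Term → Set (c ⊔ ℓ)
  P ≃ Q = ∀ R → outcome (P ∣ R) ≈ outcome (Q ∣ R)

{-# OPTIONS --safe #-}

-- Positions address the actions of the initial term, so a run is determined up
-- to homotopy by its set of labels, and contexts are compared by matching sets
-- of labels of equal weight.
--
-- The contexts ∣, ◇ and ν can be moved into the test. The runs of α.P ∣ R that
-- fire α are sorted by the causal past of α, which does not involve P: what
-- remains is P ∣ R′ for a term R′ given by that past. The runs of (P ∥ R) ∣ S
-- are sorted by the synchronisations of R and by the actions of S that react
-- with P or within S. For each such pattern a test T is built such that the
-- outcome of P ∣ T is the sum over the runs with that pattern: the
-- synchronisations of R get channels of their own, and an action of S that the
-- pattern fires for P or within S has to claim a token, without which the run
-- weighs 0.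

module Submission where

open import Defs
open import Algebra.Bundles using (CommutativeSemiring)
open import Data.Bool.Base using (if_then_else_; true; false)
open import Data.Empty using (⊥; ⊥-elim)
open import Data.Integer.Base using (ℤ; +_)
import Data.Integer.Properties as ℤ
open import Data.List.Base
  using (List; []; _∷_; [_]; _++_; _ʳ++_; concatMap; filter; foldr; length; map)
import Data.List.Membership.DecPropositional as DecMembership
open import Data.List.Membership.Propositional using (_∈_; _∉_; find; lose)
open import Data.List.Membership.Propositional.Properties
  using (∈-++⁺ˡ; ∈-++⁺ʳ; ∈-++⁻; ∈-∃++; ∈-concatMap⁺; ∈-concatMap⁻; ∈-filter⁺; ∈-filter⁻;
         ∈-map⁺; ∈-map⁻)
import Data.List.Properties as List
open import Data.List.Relation.Binary.Prefix.Heterogeneous using (Prefix; []; _∷_)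
open import Data.List.Relation.Unary.All as All using (All; []; _∷_)
open import Data.List.Relation.Unary.AllPairs using (AllPairs; []; _∷_)
import Data.List.Relation.Unary.AllPairs.Properties as AllPairs
open import Data.List.Relation.Unary.Any using (here; there)
import Data.List.Relation.Unary.Any.Properties as Any
open import Data.Maybe.Base using (Maybe; just; maybe′; nothing)
open import Data.Maybe.Relation.Binary.Pointwise as Maybe using (Pointwise; just; nothing)
open import Data.Nat.Base using (ℕ; zero; suc; _+_; _<_; s≤s; z≤n)
import Data.Nat.Properties as ℕ
open import Data.Product.Base using (∃-syntax; _×_; _,_; proj₁; proj₂)
open import Data.Sign.Base using (Sign; opposite)
import Data.Sign.Properties as Sign
open import Data.Sum.Base using (_⊎_; inj₁; inj₂; [_,_]′)
import Data.Sum.Properties as Sum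
open import Data.Unit.Base using (⊤; tt)
open import Function.Base using (_∘_; id)
open import Level using (0ℓ; _⊔_)
import Level
open import Relation.Binary.Definitions using (Decidable; DecidableEquality)
open import Relation.Binary.PropositionalEquality
  using (_≡_; _≢_; _≗_; refl; sym; trans; cong; cong₂; subst; subst₂)
open import Relation.Binary.Structures using (IsEquivalence)
open import Relation.Nullary.Decidable
  using (Dec; yes; no; ¬?; dec-false; dec-true; does; map′; _×-dec_)
open import Relation.Nullary.Negation using (¬_)

-- Transitions rename bound variables and pile up hides, so the terms reached from two contexts are
-- awkward to compare. What can happen after a history is therefore read off the initial term
-- (`Vis`, `Conn`, `st`), given the name that each fired action has received; two terms are compared
-- under names chosen so that these readings agree.
--
-- The hard case is `∥`. A copy of R placed in the test could react with P, and an action of S may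
-- serve either P or R. Channels hidden in the test keep R out of reach of P. Moreover the test has
-- to count each run of one pattern exactly once, and in a semiring unwanted runs cannot be
-- subtracted: they have to be multiplied by 0. An action that should not fire is punished by a `0#`
-- behind it. An action that should fire but does not would leave no trace, since an unfired prefix
-- has state 1; the tokens turn its absence into an event. In a maximal run the positive token must
-- react, and if its action has not fired, the only partner is the negative token, behind which
-- there is a `0#`.

infixr 5 _▸_

_▸_ : {A : Set} → A → (Name → A) → (Name → A)
(x ▸ e) zero    = x
(x ▸ e) (suc y) = e y

_≟ᵖ_ : DecidableEquality Position
_≟ᵖ_ = List.≡-dec ℤ._≟_

-- Histories, homotopy and sets of labels.

Touches : Position → Label → Set
Touches α (ι , κ) = α ≡ ι ⊎ α ≡ κ

touches? : ∀ α l → Dec (Touches α l)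
touches? α (ι , κ) with α ≟ᵖ ι | α ≟ᵖ κ
... | yes e | _     = yes (inj₁ e)
... | no _  | yes e = yes (inj₂ e)
... | no ¬e | no ¬f = no [ ¬e , ¬f ]′

-- The name given to the action at address α by a history, the list of the
-- labels fired so far (latest first).

mu : {A : Set} → (Label → A) → Path → Position → Maybe A
mu n []      α = nothing
mu n (l ∷ h) α = if does (touches? α l) then just (n l) else mu n h α

Fired : {A : Set} → Maybe A → Set
Fired {A} m = ∃[ x ] m ≡ just {A = A} x

module _ {A : Set} {n : Label → A} where

  mu-hit : ∀ {α l} h → Touches α l → mu n (l ∷ h) α ≡ just (n l)
  mu-hit {α} {l} h t rewrite dec-true (touches? α l) t = refl

  mu-miss : ∀ {α l} h → ¬ Touches α l → mu n (l ∷ h) α ≡ mu n h α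
  mu-miss {α} {l} h t rewrite dec-false (touches? α l) t = refl

  mu-fired : ∀ {α l} h → Touches α l → l ∈ h → Fired (mu n h α)
  mu-fired {α} (m ∷ h) t i with touches? α m
  ... | yes _ = _ , refl
  mu-fired (m ∷ h) t (here refl) | no ¬t = ⊥-elim (¬t t)
  mu-fired (m ∷ h) t (there i)   | no ¬t = mu-fired h t i

  mu-label : ∀ {α x} h → mu n h α ≡ just x → ∃[ l ] l ∈ h × Touches α l × x ≡ n l
  mu-label {α} (m ∷ h) e with touches? α m
  mu-label (m ∷ h) refl | yes t = m , here refl , t , refl
  ... | no ¬t with mu-label h e
  ...   | l , i , t , q = l , there i , t , q

  mu-nothing : ∀ {α l} h → mu n h α ≡ nothing → l ∈ h → ¬ Touches α l
  mu-nothing h e i t with mu-fired h t i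
  ... | _ , e′ with trans (sym e) e′
  ...   | ()

  mu-cong : ∀ {h h′} l → mu n h ≗ mu n h′ → mu n (l ∷ h) ≗ mu n (l ∷ h′)
  mu-cong l e α with does (touches? α l)
  ... | true  = refl
  ... | false = e α

  mu-cong-ʳ++ : ∀ {h h′} p → mu n h ≗ mu n h′ → mu n (p ʳ++ h) ≗ mu n (p ʳ++ h′)
  mu-cong-ʳ++ []      e = e
  mu-cong-ʳ++ {h} {h′} (l ∷ p) e = mu-cong-ʳ++ p (mu-cong {h} {h′} l e)

independent-≢ : ∀ {ι κ} → Independent ι κ → ι ≢ κ
independent-≢ (a , _) refl = a (Cancellation.prefix-refl _)

#-disjoint : ∀ {a b α} → a # b → Touches α a → ¬ Touches α b
#-disjoint (p , q , r , s) (inj₁ refl) (inj₁ e) = independent-≢ p e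
#-disjoint (p , q , r , s) (inj₁ refl) (inj₂ e) = independent-≢ q e
#-disjoint (p , q , r , s) (inj₂ refl) (inj₁ e) = independent-≢ r e
#-disjoint (p , q , r , s) (inj₂ refl) (inj₂ e) = independent-≢ s e

mu-swap : ∀ {A : Set} {n : Label → A} {a b} h → a # b →
          mu n (a ∷ b ∷ h) ≗ mu n (b ∷ a ∷ h)
mu-swap {a = a} {b} h i α with touches? α a | touches? α b
... | yes s | yes t = ⊥-elim (#-disjoint i s t)
... | yes _ | no _  = refl
... | no _  | yes _ = refl
... | no _  | no _  = refl

-- Independent labels touch no common address, so commuting them leaves each address with the same
-- name. Enabledness and weight see a history only through `mu`, hence both are invariants of a run.
∼⇒mu : ∀ {A : Set} {n : Label → A} {p q} → p ∼ q → ∀ h → mu n (p ʳ++ h) ≗ mu n (q ʳ++ h)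
∼⇒mu (commute i)  h α = sym (mu-swap h i α)
∼⇒mu ∼-refl       h α = refl
∼⇒mu (∼-sym e)    h α = sym (∼⇒mu e h α)
∼⇒mu (∼-trans e f) h α = trans (∼⇒mu e h α) (∼⇒mu f h α)
∼⇒mu {n = n} (∼-++ {p} {p′} {q} {q′} e f) h α
  rewrite List.++-ʳ++ p {q} {h} | List.++-ʳ++ p′ {q′} {h} =
  trans (mu-cong-ʳ++ q (∼⇒mu e h) α) (∼⇒mu f (p′ ʳ++ h) α)

infix 4 _≐_

-- Multiplicities can be ignored: an action fires at most once on a valid path, so no label repeats
-- there (`sv-∉`).
_≐_ : Path → Path → Set
p ≐ q = (∀ {l} → l ∈ p → l ∈ q) × (∀ {l} → l ∈ q → l ∈ p)

≐-sym : ∀ {p q} → p ≐ q → q ≐ p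
≐-sym (i , j) = j , i

≐-trans : ∀ {p q r} → p ≐ q → q ≐ r → p ≐ r
≐-trans (i , j) (k , l) = (λ x → k (i x)) , (λ x → j (l x))

∼⇒≐ : ∀ {p q} → p ∼ q → p ≐ q
∼⇒≐ (commute _)   = swap₂ , swap₂
  where
  swap₂ : ∀ {a b l} → l ∈ a ∷ b ∷ [] → l ∈ b ∷ a ∷ []
  swap₂ (here e)         = there (here e)
  swap₂ (there (here e)) = here e
∼⇒≐ ∼-refl        = (λ x → x) , (λ x → x)
∼⇒≐ (∼-sym e)     = ≐-sym (∼⇒≐ e)
∼⇒≐ (∼-trans e f) = ≐-trans (∼⇒≐ e) (∼⇒≐ f)
∼⇒≐ (∼-++ {p} {p′} e f) with ∼⇒≐ e | ∼⇒≐ f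
... | i , j | k , l =
    (λ x → [ (λ y → ∈-++⁺ˡ (i y)) , (λ y → ∈-++⁺ʳ p′ (k y)) ]′ (∈-++⁻ p x))
  , (λ x → [ (λ y → ∈-++⁺ˡ (j y)) , (λ y → ∈-++⁺ʳ p (l y)) ]′ (∈-++⁻ p′ x))

-- In the cancellation form of homotopy the common head can be pulled by `here`, and `pull-unique`
-- says that every other way of pulling it leaves the same rest.
∼-cancelˡ : ∀ p {q r} → p ++ q ∼ p ++ r → q ∼ r
∼-cancelˡ p e = ≅⇒∼ (go p (∼⇒≅ e))
  where
  open Cancellation
  go : ∀ p {q r} → p ++ q ≅ p ++ r → q ≅ r
  go []      e          = e
  go (a ∷ p) (pull x e) with pull-unique x here
  ... | refl = go p e

module Congruence {c ℓ} (𝕂 : CommutativeSemiring c ℓ) where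

  open Calculus 𝕂

  -- Static reading of transitions: addresses, names and enabled labels.

  under : {A : Set} → ℤ → (Label → A) → Label → A
  under z n (ι , κ) = n (z ∷ ι , z ∷ κ)

  -- A static reading of transitions: positions are read as addresses of the
  -- action occurrences of one fixed term, and μ gives each fired action the
  -- name it has received. The free name y is called e y, the name hidden at
  -- address r is called h r.

  data Vis {A : Set} : Term → (Name → A) → (List ℕ → A) → (Position → Maybe A) →
                       Position → A → Sign → Set c where
    act   : ∀ {u ε P e h μ g} → μ [] ≡ nothing → g ≡ e u →
            Vis (act u ε P) e h μ [] g ε
    fired : ∀ {u δ P e h μ ι g ε x} → μ [] ≡ just x →
            Vis P (x ▸ e) (h ∘ (1 ∷_)) (μ ∘ (+ 1 ∷_)) ι g ε →
            Vis (act u δ P) e h μ (+ 1 ∷ ι) g ε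
    ◇_    : ∀ {P e h μ ι g ε} → Vis P e (h ∘ (1 ∷_)) (μ ∘ (+ 1 ∷_)) ι g ε →
            Vis (◇ P) e h μ (+ 1 ∷ ι) g ε
    ∣ˡ    : ∀ {P Q e h μ ι g ε} → Vis P e (h ∘ (1 ∷_)) (μ ∘ (+ 1 ∷_)) ι g ε →
            Vis (P ∣ Q) e h μ (+ 1 ∷ ι) g ε
    ∣ʳ    : ∀ {P Q e h μ ι g ε} → Vis Q e (h ∘ (2 ∷_)) (μ ∘ (+ 2 ∷_)) ι g ε →
            Vis (P ∣ Q) e h μ (+ 2 ∷ ι) g ε
    ∥ˡ    : ∀ {P Q e h μ ι g ε} → Vis P e (h ∘ (1 ∷_)) (μ ∘ (+ 1 ∷_)) ι g ε →
            Vis (P ∥ Q) e h μ (+ 1 ∷ ι) g ε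
    ∥ʳ    : ∀ {P Q e h μ ι g ε} → Vis Q e (h ∘ (2 ∷_)) (μ ∘ (+ 2 ∷_)) ι g ε →
            Vis (P ∥ Q) e h μ (+ 2 ∷ ι) g ε
    hide  : ∀ {P e h μ ι g ε} → Vis P (h [] ▸ e) (h ∘ (0 ∷_)) μ ι g ε →
            Vis (hide P) e h μ ι g ε

  data Act : Term → Position → Set c where
    here : ∀ {u ε P} → Act (act u ε P) []
    act  : ∀ {u ε P ι} → Act P ι → Act (act u ε P) (+ 1 ∷ ι)
    ◇_   : ∀ {P ι} → Act P ι → Act (◇ P) (+ 1 ∷ ι)
    ∣ˡ   : ∀ {P Q ι} → Act P ι → Act (P ∣ Q) (+ 1 ∷ ι)
    ∣ʳ   : ∀ {P Q ι} → Act Q ι → Act (P ∣ Q) (+ 2 ∷ ι)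
    ∥ˡ   : ∀ {P Q ι} → Act P ι → Act (P ∥ Q) (+ 1 ∷ ι)
    ∥ʳ   : ∀ {P Q ι} → Act Q ι → Act (P ∥ Q) (+ 2 ∷ ι)
    hide : ∀ {P ι} → Act P ι → Act (hide P) ι

  -- The pairs of actions that may synchronise, were their subjects to match.

  data Conn : Term → Label → Set c where
    act  : ∀ {u ε P ι κ} → Conn P (ι , κ) → Conn (act u ε P) (+ 1 ∷ ι , + 1 ∷ κ)
    ◇_   : ∀ {P ι κ} → Conn P (ι , κ) → Conn (◇ P) (+ 1 ∷ ι , + 1 ∷ κ)
    ∣ˡ   : ∀ {P Q ι κ} → Conn P (ι , κ) → Conn (P ∣ Q) (+ 1 ∷ ι , + 1 ∷ κ)
    ∣ʳ   : ∀ {P Q ι κ} → Conn Q (ι , κ) → Conn (P ∣ Q) (+ 2 ∷ ι , + 2 ∷ κ)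
    ∥ˡ   : ∀ {P Q ι κ} → Conn P (ι , κ) → Conn (P ∥ Q) (+ 1 ∷ ι , + 1 ∷ κ)
    ∥ʳ   : ∀ {P Q ι κ} → Conn Q (ι , κ) → Conn (P ∥ Q) (+ 2 ∷ ι , + 2 ∷ κ)
    hide : ∀ {P l} → Conn P l → Conn (hide P) l
    sync : ∀ {P Q ι κ} → Act P ι → Act Q κ → Conn (P ∣ Q) (+ 1 ∷ ι , + 2 ∷ κ)

  -- Binders cannot be addressed by positions, because a `hide` leaves no trace in a position; the
  -- entry 0 records the passage below one.
  data Hid : Term → List ℕ → Set c where
    here : ∀ {P} → Hid (hide P) []
    hide : ∀ {P r} → Hid P r → Hid (hide P) (0 ∷ r)
    act  : ∀ {u ε P r} → Hid P r → Hid (act u ε P) (1 ∷ r)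
    ◇_   : ∀ {P r} → Hid P r → Hid (◇ P) (1 ∷ r)
    ∣ˡ   : ∀ {P Q r} → Hid P r → Hid (P ∣ Q) (1 ∷ r)
    ∣ʳ   : ∀ {P Q r} → Hid Q r → Hid (P ∣ Q) (2 ∷ r)
    ∥ˡ   : ∀ {P Q r} → Hid P r → Hid (P ∥ Q) (1 ∷ r)
    ∥ʳ   : ∀ {P Q r} → Hid Q r → Hid (P ∥ Q) (2 ∷ r)

  En : {A : Set} → Term → (Name → A) → (List ℕ → A) → (Position → Maybe A) → Label → Set c
  En X e h μ (ι , κ) =
    Conn X (ι , κ) × ∃[ g ] ∃[ ε ] Vis X e h μ ι g ε × Vis X e h μ κ g (opposite ε)

  st : {A : Set} → Term → (Position → Maybe A) → K
  st (const k)   μ = k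
  st (act u ε P) μ = maybe′ (λ _ → st P (μ ∘ (+ 1 ∷_))) 1# (μ [])
  st (◇ P)       μ = st P (μ ∘ (+ 1 ∷_))
  st (P ∣ Q)     μ = st P (μ ∘ (+ 1 ∷_)) *ᴷ st Q (μ ∘ (+ 2 ∷_))
  st (P ∥ Q)     μ = st P (μ ∘ (+ 1 ∷_)) *ᴷ st Q (μ ∘ (+ 2 ∷_))
  st (hide P)    μ = st P μ

  -- Distinctness is asked only of addresses that occur in `X`, so that names can be pulled back
  -- along address translations that are meaningful only there.
  record Names {A : Set} (X : Term) (h : List ℕ → A) (n : Label → A) : Set c where
    field
      h-inj : ∀ {r s} → Hid X r → Hid X s → h r ≡ h s → r ≡ s
      n-inj : ∀ {l m} → Conn X l → Conn X m → n l ≡ n m → l ≡ m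
      h≢n   : ∀ {r l} → Hid X r → Conn X l → h r ≢ n l

  -- The labels in `ls` are exempt in `f≢n`: their names have become values of `f` below the hides
  -- that those synchronisations created (`out-cross`).
  record Out {A : Set} (X : Term) (ls : Path) (f : Name → A) (h : List ℕ → A) (n : Label → A) :
             Set c where
    field
      f-inj : ∀ {u v} → f u ≡ f v → u ≡ v
      f≢h   : ∀ {u r} → Hid X r → f u ≢ h r
      f≢n   : ∀ {u l} → Conn X l → l ∉ ls → f u ≢ n l

  open Names
  open Out

  names-sub : ∀ {A : Set} {X P} {h : List ℕ → A} {n} i z →
              (∀ {r} → Hid P r → Hid X (i ∷ r)) →
              (∀ {ι κ} → Conn P (ι , κ) → Conn X (z ∷ ι , z ∷ κ)) →
              Names X h n → Names P (h ∘ (i ∷_)) (under z n)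
  names-sub i z H C N = record
    { h-inj = λ p q e → List.∷-injectiveʳ (h-inj N (H p) (H q) e)
    ; n-inj = λ p q e → strip (n-inj N (C p) (C q) e)
    ; h≢n   = λ p q → h≢n N (H p) (C q)
    }
    where
    strip : ∀ {ι κ ι′ κ′ : Position} →
            (z ∷ ι , z ∷ κ) ≡ (z ∷ ι′ , z ∷ κ′) → (ι , κ) ≡ (ι′ , κ′)
    strip refl = refl

  out-sub : ∀ {A : Set} {X P ls} {f : Name → A} {h : List ℕ → A} {n} i z →
            (∀ {r} → Hid P r → Hid X (i ∷ r)) →
            (∀ {ι κ} → Conn P (ι , κ) → Conn X (z ∷ ι , z ∷ κ)) →
            (∀ {ι κ} → (z ∷ ι , z ∷ κ) ∉ ls) →
            Out X ls f h n → Out P [] f (h ∘ (i ∷_)) (under z n)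
  out-sub i z H C ∉ls O = record
    { f-inj = f-inj O
    ; f≢h   = λ p → f≢h O (H p)
    ; f≢n   = λ p _ → f≢n O (C p) ∉ls
    }

  names-hide : ∀ {A : Set} {P} {h : List ℕ → A} {n} →
               Names (hide P) h n → Names P (h ∘ (0 ∷_)) n
  names-hide N = record
    { h-inj = λ p q e → List.∷-injectiveʳ (h-inj N (hide p) (hide q) e)
    ; n-inj = λ p q → n-inj N (hide p) (hide q)
    ; h≢n   = λ p q → h≢n N (hide p) (hide q)
    }

  ▸-inj : ∀ {A : Set} {x : A} {f : Name → A} → (∀ {u v} → f u ≡ f v → u ≡ v) →
          (∀ {u} → f u ≢ x) → ∀ {u v} → (x ▸ f) u ≡ (x ▸ f) v → u ≡ v
  ▸-inj i j {zero}  {zero}  e = refl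
  ▸-inj i j {zero}  {suc v} e = ⊥-elim (j (sym e))
  ▸-inj i j {suc u} {zero}  e = ⊥-elim (j e)
  ▸-inj i j {suc u} {suc v} e = cong suc (i e)

  out-hide : ∀ {A : Set} {P} {f : Name → A} {h : List ℕ → A} {n} →
             Names (hide P) h n → Out (hide P) [] f h n → Out P [] (h [] ▸ f) (h ∘ (0 ∷_)) n
  out-hide {f = f} {h} N O = record
    { f-inj = ▸-inj (f-inj O) (f≢h O here)
    ; f≢h   = λ { {zero} p e → nil≢ (h-inj N here (hide p) e)
                ; {suc u} p → f≢h O (hide p) }
    ; f≢n   = λ { {zero} p _ → h≢n N here (hide p)
                ; {suc u} p i → f≢n O (hide p) i }
    }
    where
    nil≢ : ∀ {i : ℕ} {r} → _≢_ {A = List ℕ} [] (i ∷ r)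
    nil≢ ()

  out-cross : ∀ {A : Set} {X ls} {f : Name → A} {h : List ℕ → A} {n l} →
              Conn X l → l ∉ ls →
              Names X h n → Out X ls f h n → Out X (l ∷ ls) (n l ▸ f) h n
  out-cross {l = l} C ∉ls N O = record
    { f-inj = ▸-inj (f-inj O) (f≢n O C ∉ls)
    ; f≢h   = λ { {zero} p e → h≢n N p C (sym e)
                ; {suc u} p → f≢h O p }
    ; f≢n   = λ { {zero} p i e → i (here (sym (n-inj N C p e)))
                ; {suc u} p i → f≢n O p (λ j → i (there j)) }
    }

  -- Rel X₀ e h n μ X f: the term X, whose free name y is called f y, is what
  -- has become of X₀ after the firings recorded by μ. At a parallel
  -- composition, ls lists the synchronisations across it whose names are
  -- hidden further up.

  data Rel {A : Set} : Term → (Name → A) → (List ℕ → A) → (Label → A) →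
                       (Position → Maybe A) → Term → (Name → A) → Set c
  data Par {A : Set} (P Q : Term) (e : Name → A) (h : List ℕ → A) (n : Label → A)
                     (μ : Position → Maybe A) : Path → Term → (Name → A) → Set c

  data Rel {A} where
    const : ∀ {k e h n μ f} → Rel (const k) e h n μ (const k) f
    act   : ∀ {u v ε P P′ e h n μ f} ρ → (∀ α → μ α ≡ nothing) → (∀ y → f (ρ y) ≡ e y) →
            v ≡ ρ u → P′ ≡ rename (ext ρ) P →
            Rel (act u ε P) e h n μ (act v ε P′) f
    fired : ∀ {u ε P e h n μ X f x} → μ [] ≡ just x →
            Rel P (x ▸ e) (h ∘ (1 ∷_)) (under (+ 1) n) (μ ∘ (+ 1 ∷_)) X f →
            Rel (act u ε P) e h n μ (◇ X) f
    ◇_    : ∀ {P e h n μ X f} →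
            Rel P e (h ∘ (1 ∷_)) (under (+ 1) n) (μ ∘ (+ 1 ∷_)) X f →
            Rel (◇ P) e h n μ (◇ X) f
    par   : ∀ {P Q e h n μ X f} → Par P Q e h n μ [] X f → Rel (P ∣ Q) e h n μ X f
    para  : ∀ {P Q e h n μ X Y f} →
            Rel P e (h ∘ (1 ∷_)) (under (+ 1) n) (μ ∘ (+ 1 ∷_)) X f →
            Rel Q e (h ∘ (2 ∷_)) (under (+ 2) n) (μ ∘ (+ 2 ∷_)) Y f →
            Rel (P ∥ Q) e h n μ (X ∥ Y) f
    hide  : ∀ {P e h n μ X f} → Rel P (h [] ▸ e) (h ∘ (0 ∷_)) n μ X (h [] ▸ f) →
            Rel (hide P) e h n μ (hide X) f

  data Par {A} P Q e h n μ where
    base   : ∀ {ls X Y f} →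
             Rel P e (h ∘ (1 ∷_)) (under (+ 1) n) (μ ∘ (+ 1 ∷_)) X f →
             Rel Q e (h ∘ (2 ∷_)) (under (+ 2) n) (μ ∘ (+ 2 ∷_)) Y f →
             Par P Q e h n μ ls (X ∣ Y) f
    hidden : ∀ {ls X f} ι κ → let l = (+ 1 ∷ ι , + 2 ∷ κ) in
             Conn (P ∣ Q) l → l ∉ ls → Fired (μ (+ 1 ∷ ι)) →
             Par P Q e h n μ (l ∷ ls) X (n l ▸ f) → Par P Q e h n μ ls (hide X) f

  -- Renamings of terms.

  ext-cong : ∀ {ρ σ : Name → Name} → ρ ≗ σ → ext ρ ≗ ext σ
  ext-cong e zero    = refl
  ext-cong e (suc y) = cong suc (e y)

  rename-cong : ∀ {ρ σ} → ρ ≗ σ → ∀ P → rename ρ P ≡ rename σ P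
  rename-cong e (const k)   = refl
  rename-cong e (act u ε P) = cong₂ (λ v Q → act v ε Q) (e u) (rename-cong (ext-cong e) P)
  rename-cong e (◇ P)       = cong ◇_ (rename-cong e P)
  rename-cong e (P ∣ Q)     = cong₂ _∣_ (rename-cong e P) (rename-cong e Q)
  rename-cong e (P ∥ Q)     = cong₂ _∥_ (rename-cong e P) (rename-cong e Q)
  rename-cong e (hide P)    = cong hide (rename-cong (ext-cong e) P)

  ext-∘ : ∀ {ρ σ : Name → Name} → ext ρ ∘ ext σ ≗ ext (ρ ∘ σ)
  ext-∘ zero    = refl
  ext-∘ (suc y) = refl

  rename-∘ : ∀ {ρ σ} P → rename ρ (rename σ P) ≡ rename (ρ ∘ σ) P
  rename-∘ (const k)   = refl
  rename-∘ (act u ε P) = cong (act _ ε) (trans (rename-∘ P) (rename-cong ext-∘ P))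
  rename-∘ (◇ P)       = cong ◇_ (rename-∘ P)
  rename-∘ (P ∣ Q)     = cong₂ _∣_ (rename-∘ P) (rename-∘ Q)
  rename-∘ (P ∥ Q)     = cong₂ _∥_ (rename-∘ P) (rename-∘ Q)
  rename-∘ (hide P)    = cong hide (trans (rename-∘ P) (rename-cong ext-∘ P))

  rename-id : ∀ {ρ} → ρ ≗ (λ y → y) → ∀ P → rename ρ P ≡ P
  rename-id e (const k)   = refl
  rename-id e (act u ε P) = cong₂ (λ v Q → act v ε Q) (e u) (rename-id (λ { zero → refl ; (suc y) → cong suc (e y) }) P)
  rename-id e (◇ P)       = cong ◇_ (rename-id e P)
  rename-id e (P ∣ Q)     = cong₂ _∣_ (rename-id e P) (rename-id e Q)
  rename-id e (P ∥ Q)     = cong₂ _∥_ (rename-id e P) (rename-id e Q)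
  rename-id e (hide P)    = cong hide (rename-id (λ { zero → refl ; (suc y) → cong suc (e y) }) P)

  ▸-ext : ∀ {A : Set} {x : A} {f f′ : Name → A} {ρ} →
          (∀ y → f′ (ρ y) ≡ f y) → ∀ y → (x ▸ f′) (ext ρ y) ≡ (x ▸ f) y
  ▸-ext e zero    = refl
  ▸-ext e (suc y) = e y

  rel-init : ∀ {A : Set} P {e : Name → A} {h n μ f} ρ →
             (∀ α → μ α ≡ nothing) → (∀ y → f (ρ y) ≡ e y) →
             Rel P e h n μ (rename ρ P) f
  rel-init (const k)   ρ z E = const
  rel-init (act u ε P) ρ z E = act ρ z E refl refl
  rel-init (◇ P)       ρ z E = ◇ rel-init P ρ (z ∘ _) E
  rel-init (P ∣ Q)     ρ z E = par (base (rel-init P ρ (z ∘ _) E) (rel-init Q ρ (z ∘ _) E))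
  rel-init (P ∥ Q)     ρ z E = para (rel-init P ρ (z ∘ _) E) (rel-init Q ρ (z ∘ _) E)
  rel-init (hide P)    ρ z E = hide (rel-init P (ext ρ) z (▸-ext E))

  -- Transitions of the reached term against the static reading.

  module _ {A : Set} where

    rel-rename : ∀ {X₀ X} {e : Name → A} {h n μ f f′} ρ → (∀ y → f′ (ρ y) ≡ f y) →
                 Rel X₀ e h n μ X f → Rel X₀ e h n μ (rename ρ X) f′
    par-rename : ∀ {P Q X ls} {e : Name → A} {h n μ f f′} ρ → (∀ y → f′ (ρ y) ≡ f y) →
                 Par P Q e h n μ ls X f → Par P Q e h n μ ls (rename ρ X) f′
    rel-rename ρ E const = const
    rel-rename ρ E (act {P = P} σ z F refl refl) =
      act (ρ ∘ σ) z (λ y → trans (E (σ y)) (F y)) refl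
        (trans (rename-∘ P) (rename-cong ext-∘ P))
    rel-rename ρ E (fired m R) = fired m (rel-rename ρ E R)
    rel-rename ρ E (◇ R)       = ◇ rel-rename ρ E R
    rel-rename ρ E (par R)     = par (par-rename ρ E R)
    rel-rename ρ E (para R S)     = para (rel-rename ρ E R) (rel-rename ρ E S)
    rel-rename ρ E (hide R)    = hide (rel-rename (ext ρ) (▸-ext E) R)
    par-rename ρ E (base R S)  = base (rel-rename ρ E R) (rel-rename ρ E S)
    par-rename ρ E (hidden ι κ C i m R) = hidden ι κ C i m (par-rename (ext ρ) (▸-ext E) R)

    rel-μ : ∀ {X₀ X} {e : Name → A} {h n μ μ′ f} → (∀ α → μ′ α ≡ μ α) →
            Rel X₀ e h n μ X f → Rel X₀ e h n μ′ X f
    par-μ : ∀ {P Q X ls} {e : Name → A} {h n μ μ′ f} → (∀ α → μ′ α ≡ μ α) →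
            Par P Q e h n μ ls X f → Par P Q e h n μ′ ls X f
    rel-μ E const = const
    rel-μ E (act σ z F p q) = act σ (λ α → trans (E α) (z α)) F p q
    rel-μ E (fired m R) = fired (trans (E []) m) (rel-μ (E ∘ _) R)
    rel-μ E (◇ R)       = ◇ rel-μ (E ∘ _) R
    rel-μ E (par R)     = par (par-μ E R)
    rel-μ E (para R S)     = para (rel-μ (E ∘ _) R) (rel-μ (E ∘ _) S)
    rel-μ E (hide R)    = hide (rel-μ E R)
    par-μ E (base R S)  = base (rel-μ (E ∘ _) R) (rel-μ (E ∘ _) S)
    par-μ E (hidden ι κ C i (x , m) R) = hidden ι κ C i (x , trans (E _) m) (par-μ E R)

    state-rel : ∀ {X₀ X} {e : Name → A} {h n μ f} →
                Rel X₀ e h n μ X f → state X ≡ st X₀ μ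
    state-par : ∀ {P Q X ls} {e : Name → A} {h n μ f} →
                Par P Q e h n μ ls X f → state X ≡ st (P ∣ Q) μ
    state-rel const = refl
    state-rel (act σ z F p q) rewrite z [] = refl
    state-rel (fired m R) rewrite m = state-rel R
    state-rel (◇ R)       = state-rel R
    state-rel (par R)     = state-par R
    state-rel (para R S)     = cong₂ _*ᴷ_ (state-rel R) (state-rel S)
    state-rel (hide R)    = state-rel R
    state-par (base R S)  = cong₂ _*ᴷ_ (state-rel R) (state-rel S)
    state-par (hidden ι κ C i m R) = state-par R

    vis-unfired : ∀ {X e h μ ι} {g : A} {ε} → Vis X e h μ ι g ε → μ ι ≡ nothing
    vis-unfired (act m _)   = m
    vis-unfired (fired _ v) = vis-unfired v
    vis-unfired (◇ v)       = vis-unfired v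
    vis-unfired (∣ˡ v)      = vis-unfired v
    vis-unfired (∣ʳ v)      = vis-unfired v
    vis-unfired (∥ˡ v)      = vis-unfired v
    vis-unfired (∥ʳ v)      = vis-unfired v
    vis-unfired (hide v)    = vis-unfired v

    vis-act : ∀ {X e h μ ι} {g : A} {ε} → Vis X e h μ ι g ε → Act X ι
    vis-act (act _ _)   = here
    vis-act (fired _ v) = act (vis-act v)
    vis-act (◇ v)       = ◇ vis-act v
    vis-act (∣ˡ v)      = ∣ˡ (vis-act v)
    vis-act (∣ʳ v)      = ∣ʳ (vis-act v)
    vis-act (∥ˡ v)      = ∥ˡ (vis-act v)
    vis-act (∥ʳ v)      = ∥ʳ (vis-act v)
    vis-act (hide v)    = hide (vis-act v)

    Fires : (Position → Maybe A) → (Position → Maybe A) → (Position → Set) → A → Set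
    Fires μ μ′ T x = (∀ {α} → T α → μ′ α ≡ just x) × (∀ {α} → ¬ T α → μ′ α ≡ μ α)

    fires-sub : ∀ {μ μ′ : Position → Maybe A} {T U x} z →
                (∀ {α} → U α → T (z ∷ α)) → (∀ {α} → T (z ∷ α) → U α) →
                Fires μ μ′ T x → Fires (μ ∘ (z ∷_)) (μ′ ∘ (z ∷_)) U x
    fires-sub z i j (p , q) = (p ∘ i) , (λ ¬u → q (¬u ∘ j))

    fires-fired : ∀ {μ μ′ : Position → Maybe A} {T x α} → Fires μ μ′ T x → (∀ α → Dec (T α)) →
                  Fired (μ α) → Fired (μ′ α)
    fires-fired {α = α} (p , q) T? (y , m) with T? α
    ... | yes t = _ , p t
    ... | no ¬t = y , trans (q ¬t) m

    private
      at-sub : ∀ {μ μ′ : Position → Maybe A} {x ι} z → Fires μ μ′ (_≡ z ∷ ι) x →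
               Fires (μ ∘ (z ∷_)) (μ′ ∘ (z ∷_)) (_≡ ι) x
      at-sub z = fires-sub z (cong (z ∷_)) List.∷-injectiveʳ

    swap-▸ : ∀ {x y : A} {f} u → (y ▸ x ▸ f) (swap u) ≡ (x ▸ y ▸ f) u
    swap-▸ zero          = refl
    swap-▸ (suc zero)    = refl
    swap-▸ (suc (suc u)) = refl

    -- In the conclusion `μ′` and `x` stay arbitrary, since the name that the action receives is
    -- decided by the synchronisation around it, which is not known here.
    visible⇒ : ∀ {X₀ X X′ u ε ι} {e : Name → A} {h n μ f} →
               Rel X₀ e h n μ X f → X —[ u ^ ε ∶ ι ]→ X′ →
               Vis X₀ e h μ ι (f u) ε ×
               (∀ {μ′ x} → Fires μ μ′ (_≡ ι) x → Rel X₀ e h n μ′ X′ (x ▸ f))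
    visiblePar⇒ : ∀ {P Q X X′ u ε ι ls} {e : Name → A} {h n μ f} →
               Par P Q e h n μ ls X f → X —[ u ^ ε ∶ ι ]→ X′ →
               Vis (P ∣ Q) e h μ ι (f u) ε ×
               (∀ {μ′ x} → Fires μ μ′ (_≡ ι) x → Par P Q e h n μ′ ls X′ (x ▸ f))
    visible⇒ (act {P = P} ρ z E refl refl) act =
        act (z []) (E _)
      , λ (p , q) → fired (p refl)
          (rel-init P (ext ρ) (λ α → trans (q λ ()) (z (+ 1 ∷ α))) (▸-ext E))
    visible⇒ (fired m R) (◇ s) with visible⇒ R s
    ... | v , k = fired m v , λ F → fired (trans (proj₂ F λ ()) m) (k (at-sub (+ 1) F))
    visible⇒ (◇ R) (◇ s) with visible⇒ R s
    ... | v , k = ◇ v , λ F → ◇ k (at-sub (+ 1) F)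
    visible⇒ (par R) s with visiblePar⇒ R s
    ... | v , k = v , λ F → par (k F)
    visible⇒ (para R S) (∥ˡ s) with visible⇒ R s
    ... | v , k = ∥ˡ v , λ F → para (k (at-sub (+ 1) F))
                                 (rel-rename suc (λ _ → refl) (rel-μ (λ α → proj₂ F λ ()) S))
    visible⇒ (para R S) (∥ʳ s) with visible⇒ S s
    ... | v , k = ∥ʳ v , λ F → para (rel-rename suc (λ _ → refl) (rel-μ (λ α → proj₂ F λ ()) R))
                                 (k (at-sub (+ 2) F))
    visible⇒ (hide R) (hide s) with visible⇒ R s
    ... | v , k = hide v , λ F → hide (rel-rename swap swap-▸ (k F))
    visiblePar⇒ (base R S) (∣ˡ s) with visible⇒ R s
    ... | v , k = ∣ˡ v , λ F → base (k (at-sub (+ 1) F))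
                                 (rel-rename suc (λ _ → refl) (rel-μ (λ α → proj₂ F λ ()) S))
    visiblePar⇒ (base R S) (∣ʳ s) with visible⇒ S s
    ... | v , k = ∣ʳ v , λ F → base (rel-rename suc (λ _ → refl) (rel-μ (λ α → proj₂ F λ ()) R))
                                 (k (at-sub (+ 2) F))
    visiblePar⇒ (hidden ι κ C i m R) (hide s) with visiblePar⇒ R s
    ... | v , k = v , λ F → hidden ι κ C i (fires-fired F (_≟ᵖ _) m) (par-rename swap swap-▸ (k F))

    -- This makes a new synchronisation fresh: its actions are still unfired, so its label cannot be
    -- one of those in `ls` (`unfired-∉`).
    FiredAll : (Position → Maybe A) → Path → Set
    FiredAll μ ls = ∀ {l} → l ∈ ls → Fired (μ (proj₁ l))

    unfired-∉ : ∀ {μ : Position → Maybe A} {ls l} → FiredAll μ ls → μ (proj₁ l) ≡ nothing → l ∉ ls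
    unfired-∉ F z i with F i
    ... | _ , m with trans (sym z) m
    ...   | ()

    private
      touches-sub : ∀ {μ μ′ : Position → Maybe A} {x ι κ} z →
                    Fires μ μ′ (λ α → Touches α (z ∷ ι , z ∷ κ)) x →
                    Fires (μ ∘ (z ∷_)) (μ′ ∘ (z ∷_)) (λ α → Touches α (ι , κ)) x
      touches-sub z = fires-sub z
        (λ { (inj₁ e) → inj₁ (cong (z ∷_) e) ; (inj₂ e) → inj₂ (cong (z ∷_) e) })
        (λ { (inj₁ e) → inj₁ (List.∷-injectiveʳ e) ; (inj₂ e) → inj₂ (List.∷-injectiveʳ e) })

      apart : ∀ {μ μ′ : Position → Maybe A} {x z w ι κ} → z ≢ w →
              Fires μ μ′ (λ α → Touches α (z ∷ ι , z ∷ κ)) x → ∀ α → μ′ (w ∷ α) ≡ μ (w ∷ α)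
      apart z≢w (_ , q) α = q λ { (inj₁ refl) → z≢w refl ; (inj₂ refl) → z≢w refl }

    internal⇒ : ∀ {X₀ X X′ ι κ} {e : Name → A} {h n μ f} →
                Rel X₀ e h n μ X f → X —⟨ ι , κ ⟩→ X′ →
                En X₀ e h μ (ι , κ) ×
                (∀ {μ′} → Fires μ μ′ (λ α → Touches α (ι , κ)) (n (ι , κ)) → Rel X₀ e h n μ′ X′ f)
    internalPar⇒ : ∀ {P Q X X′ ι κ ls} {e : Name → A} {h n μ f} → FiredAll μ ls →
                Par P Q e h n μ ls X f → X —⟨ ι , κ ⟩→ X′ →
                En (P ∣ Q) e h μ (ι , κ) ×
                (∀ {μ′} → Fires μ μ′ (λ α → Touches α (ι , κ)) (n (ι , κ)) →
                 Par P Q e h n μ′ ls X′ f)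
    internal⇒ (fired m R) (◇ s) with internal⇒ R s
    ... | (C , g , ε , v , w) , k =
        (act C , g , ε , fired m v , fired m w)
      , λ F → fired (trans (proj₂ F λ { (inj₁ ()) ; (inj₂ ()) }) m) (k (touches-sub (+ 1) F))
    internal⇒ (◇ R) (◇ s) with internal⇒ R s
    ... | (C , g , ε , v , w) , k = (◇ C , g , ε , ◇ v , ◇ w) , λ F → ◇ k (touches-sub (+ 1) F)
    internal⇒ (par R) s with internalPar⇒ (λ ()) R s
    ... | E , k = E , λ F → par (k F)
    internal⇒ (para R S) (∥ˡ s) with internal⇒ R s
    ... | (C , g , ε , v , w) , k =
        (∥ˡ C , g , ε , ∥ˡ v , ∥ˡ w) , λ F → para (k (touches-sub (+ 1) F)) (rel-μ (apart (λ ()) F) S)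
    internal⇒ (para R S) (∥ʳ s) with internal⇒ S s
    ... | (C , g , ε , v , w) , k =
        (∥ʳ C , g , ε , ∥ʳ v , ∥ʳ w) , λ F → para (rel-μ (apart (λ ()) F) R) (k (touches-sub (+ 2) F))
    internal⇒ (hide R) (hide s) with internal⇒ R s
    ... | (C , g , ε , v , w) , k = (hide C , g , ε , hide v , hide w) , λ F → hide (k F)
    internalPar⇒ G (base R S) (∣ˡ s) with internal⇒ R s
    ... | (C , g , ε , v , w) , k =
        (∣ˡ C , g , ε , ∣ˡ v , ∣ˡ w) , λ F → base (k (touches-sub (+ 1) F)) (rel-μ (apart (λ ()) F) S)
    internalPar⇒ G (base R S) (∣ʳ s) with internal⇒ S s
    ... | (C , g , ε , v , w) , k =
        (∣ʳ C , g , ε , ∣ʳ v , ∣ʳ w) , λ F → base (rel-μ (apart (λ ()) F) R) (k (touches-sub (+ 2) F))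
    internalPar⇒ G (base R S) (sync s t) with visible⇒ R s | visible⇒ S t
    ... | v , k | w , j =
        (sync (vis-act v) (vis-act w) , _ , _ , ∣ˡ v , ∣ʳ w)
      , λ F → hidden _ _ (sync (vis-act v) (vis-act w)) (unfired-∉ G (vis-unfired v)) (_ , proj₁ F (inj₁ refl))
          (base (k (fires-sub (+ 1) (inj₁ ∘ cong _) (λ { (inj₁ e) → List.∷-injectiveʳ e }) F))
                (j (fires-sub (+ 2) (inj₂ ∘ cong _) (λ { (inj₂ e) → List.∷-injectiveʳ e }) F)))
    internalPar⇒ {μ = μ} G (hidden ι κ C i m R) (hide s)
      with internalPar⇒ (λ { (here refl) → m ; (there j) → G j }) R s
    ... | E , k = E , λ F → hidden ι κ C i (fires-fired F (λ α → touches? α _) m) (k F)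

    Region : Term → (List ℕ → A) → (Label → A) → A → Set c
    Region X h n g = (∃[ r ] Hid X r × g ≡ h r) ⊎ (∃[ l ] Conn X l × g ≡ n l)

    region-sub : ∀ {X P h n g} i z → (∀ {r} → Hid P r → Hid X (i ∷ r)) →
                 (∀ {ι κ} → Conn P (ι , κ) → Conn X (z ∷ ι , z ∷ κ)) →
                 Region P (h ∘ (i ∷_)) (under z n) g → Region X h n g
    region-sub i z H C (inj₁ (r , p , e)) = inj₁ (_ , H p , e)
    region-sub i z H C (inj₂ (l , p , e)) = inj₂ (_ , C p , e)

    VisibleOr : Set c → Term → (Name → A) → Position → A → Sign → Set c
    VisibleOr B X f ι g ε = (∃[ u ] ∃[ X′ ] g ≡ f u × X —[ u ^ ε ∶ ι ]→ X′) ⊎ B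

    -- A name is lost to the outside only at a hide of the reached term. Such a hide comes either
    -- from a binder of `X₀` or from a synchronisation inside it, which are the two cases of
    -- `Region`.
    visible⇐ : ∀ {X₀ X e h n μ f ι} {g : A} {ε} → Rel X₀ e h n μ X f →
               Vis X₀ e h μ ι g ε → VisibleOr (Region X₀ h n g) X f ι g ε
    visiblePar⇐ : ∀ {P Q X e h n μ f ι ls} {g : A} {ε} → Par P Q e h n μ ls X f →
               Vis (P ∣ Q) e h μ ι g ε → VisibleOr (Region (P ∣ Q) h n g) X f ι g ε
    visible⇐ (act ρ z E refl refl) (act m refl) = inj₁ (_ , _ , sym (E _) , act)
    visible⇐ (act ρ z E refl refl) (fired m v) with trans (sym m) (z [])
    ... | ()
    visible⇐ (fired m R) (act m′ _) with trans (sym m) m′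
    ... | ()
    visible⇐ (fired m R) (fired m′ v) with trans (sym m) m′
    ... | refl with visible⇐ R v
    ...   | inj₁ (u , X , e , s) = inj₁ (u , _ , e , ◇ s)
    ...   | inj₂ B = inj₂ (region-sub 1 (+ 1) act act B)
    visible⇐ (◇ R) (◇ v) with visible⇐ R v
    ...   | inj₁ (u , X , e , s) = inj₁ (u , _ , e , ◇ s)
    ...   | inj₂ B = inj₂ (region-sub 1 (+ 1) ◇_ ◇_ B)
    visible⇐ (par R) v = visiblePar⇐ R v
    visible⇐ (para R S) (∥ˡ v) with visible⇐ R v
    ...   | inj₁ (u , X , e , s) = inj₁ (u , _ , e , ∥ˡ s)
    ...   | inj₂ B = inj₂ (region-sub 1 (+ 1) ∥ˡ ∥ˡ B)
    visible⇐ (para R S) (∥ʳ v) with visible⇐ S v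
    ...   | inj₁ (u , X , e , s) = inj₁ (u , _ , e , ∥ʳ s)
    ...   | inj₂ B = inj₂ (region-sub 2 (+ 2) ∥ʳ ∥ʳ B)
    visible⇐ (hide R) (hide v) with visible⇐ R v
    ...   | inj₁ (zero  , X , e , s) = inj₂ (inj₁ (_ , here , e))
    ...   | inj₁ (suc u , X , e , s) = inj₁ (u , _ , e , hide s)
    ...   | inj₂ (inj₁ (r , p , e)) = inj₂ (inj₁ (_ , hide p , e))
    ...   | inj₂ (inj₂ (l , p , e)) = inj₂ (inj₂ (_ , hide p , e))
    visiblePar⇐ (base R S) (∣ˡ v) with visible⇐ R v
    ...   | inj₁ (u , X , e , s) = inj₁ (u , _ , e , ∣ˡ s)
    ...   | inj₂ B = inj₂ (region-sub 1 (+ 1) ∣ˡ ∣ˡ B)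
    visiblePar⇐ (base R S) (∣ʳ v) with visible⇐ S v
    ...   | inj₁ (u , X , e , s) = inj₁ (u , _ , e , ∣ʳ s)
    ...   | inj₂ B = inj₂ (region-sub 2 (+ 2) ∣ʳ ∣ʳ B)
    visiblePar⇐ (hidden ι κ C i m R) v with visiblePar⇐ R v
    ...   | inj₁ (zero  , X , e , s) = inj₂ (inj₂ (_ , C , e))
    ...   | inj₁ (suc u , X , e , s) = inj₁ (u , _ , e , hide s)
    ...   | inj₂ B = inj₂ B

    out-region : ∀ {X f h n} {u} → Out X [] f h n → ¬ Region X h n (f u)
    out-region O (inj₁ (r , p , e)) = f≢h O p e
    out-region O (inj₂ (l , p , e)) = f≢n O p (λ ()) e

    CrossAll : Path → Set
    CrossAll ls = ∀ {ι κ} → (ι , κ) ∈ ls → ∃[ ι′ ] ∃[ κ′ ] ι ≡ + 1 ∷ ι′ × κ ≡ + 2 ∷ κ′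

    cross-∉₁ : ∀ {ls ι κ} → CrossAll ls → (+ 1 ∷ ι , + 1 ∷ κ) ∉ ls
    cross-∉₁ G i with G i
    ... | _ , _ , _ , ()

    cross-∉₂ : ∀ {ls ι κ} → CrossAll ls → (+ 2 ∷ ι , + 2 ∷ κ) ∉ ls
    cross-∉₂ G i with G i
    ... | _ , _ , () , _

    regions-disjoint : ∀ {P Q h n g} → Names (P ∣ Q) h n →
                       Region P (h ∘ (1 ∷_)) (under (+ 1) n) g →
                       ¬ Region Q (h ∘ (2 ∷_)) (under (+ 2) n) g
    regions-disjoint N (inj₁ (_ , p , refl)) (inj₁ (_ , q , e)) with h-inj N (∣ˡ p) (∣ʳ q) e
    ... | ()
    regions-disjoint N (inj₁ (_ , p , refl)) (inj₂ (_ , q , e)) = h≢n N (∣ˡ p) (∣ʳ q) e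
    regions-disjoint N (inj₂ (_ , p , refl)) (inj₁ (_ , q , e)) = h≢n N (∣ʳ q) (∣ˡ p) (sym e)
    regions-disjoint N (inj₂ (_ , p , refl)) (inj₂ (_ , q , e)) with n-inj N (∣ˡ p) (∣ʳ q) e
    ... | ()

    -- The delicate case is a synchronisation across `∣`. The common name of its two actions must be
    -- free on both sides: `out-region` excludes a name local to one side and free on the other,
    -- `regions-disjoint` a name local to both.
    internal⇐ : ∀ {X₀ X} {e : Name → A} {h n μ f l} → Names X₀ h n → Out X₀ [] f h n →
                Rel X₀ e h n μ X f → En X₀ e h μ l → ∃[ X′ ] X —⟨ l ⟩→ X′
    internalPar⇐ : ∀ {P Q X} {e : Name → A} {h n μ f l ls} →
                Names (P ∣ Q) h n → Out (P ∣ Q) ls f h n → CrossAll ls →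
                Par P Q e h n μ ls X f → En (P ∣ Q) e h μ l → ∃[ X′ ] X —⟨ l ⟩→ X′
    internal⇐ N O (act ρ z E _ _) (act C , _ , _ , fired m v , _) with trans (sym m) (z [])
    ... | ()
    internal⇐ N O (fired m R) (act C , g , ε , fired m₁ v , fired m₂ w)
      with trans (sym m) m₁ | trans (sym m) m₂
    ... | refl | refl with internal⇐ (names-sub 1 (+ 1) act act N) (out-sub 1 (+ 1) act act (λ ()) O) R (C , g , ε , v , w)
    ...   | _ , s = _ , ◇ s
    internal⇐ N O (◇ R) (◇ C , g , ε , ◇ v , ◇ w)
      with internal⇐ (names-sub 1 (+ 1) ◇_ ◇_ N) (out-sub 1 (+ 1) ◇_ ◇_ (λ ()) O) R (C , g , ε , v , w)
    ... | _ , s = _ , ◇ s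
    internal⇐ N O (par R) E = internalPar⇐ N O (λ ()) R E
    internal⇐ N O (para R S) (∥ˡ C , g , ε , ∥ˡ v , ∥ˡ w)
      with internal⇐ (names-sub 1 (+ 1) ∥ˡ ∥ˡ N) (out-sub 1 (+ 1) ∥ˡ ∥ˡ (λ ()) O) R (C , g , ε , v , w)
    ... | _ , s = _ , ∥ˡ s
    internal⇐ N O (para R S) (∥ʳ C , g , ε , ∥ʳ v , ∥ʳ w)
      with internal⇐ (names-sub 2 (+ 2) ∥ʳ ∥ʳ N) (out-sub 2 (+ 2) ∥ʳ ∥ʳ (λ ()) O) S (C , g , ε , v , w)
    ... | _ , s = _ , ∥ʳ s
    internal⇐ N O (hide R) (hide C , g , ε , hide v , hide w)
      with internal⇐ (names-hide N) (out-hide N O) R (C , g , ε , v , w)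
    ... | _ , s = _ , hide s
    internalPar⇐ N O G (base R S) (∣ˡ C , g , ε , ∣ˡ v , ∣ˡ w)
      with internal⇐ (names-sub 1 (+ 1) ∣ˡ ∣ˡ N) (out-sub 1 (+ 1) ∣ˡ ∣ˡ (cross-∉₁ G) O) R (C , g , ε , v , w)
    ... | _ , s = _ , ∣ˡ s
    internalPar⇐ N O G (base R S) (∣ʳ C , g , ε , ∣ʳ v , ∣ʳ w)
      with internal⇐ (names-sub 2 (+ 2) ∣ʳ ∣ʳ N) (out-sub 2 (+ 2) ∣ʳ ∣ʳ (cross-∉₂ G) O) S (C , g , ε , v , w)
    ... | _ , s = _ , ∣ʳ s
    internalPar⇐ N O G (base R S) (sync _ _ , g , ε , ∣ˡ v , ∣ʳ w)
      with visible⇐ R v | visible⇐ S w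
    ... | inj₁ (u , _ , p , s) | inj₁ (u′ , _ , q , t) with f-inj O (trans (sym p) q)
    ...   | refl = _ , sync s t
    internalPar⇐ N O G (base R S) (sync _ _ , g , ε , ∣ˡ v , ∣ʳ w)
        | inj₁ (u , _ , refl , s) | inj₂ B =
      ⊥-elim (out-region (out-sub 2 (+ 2) ∣ʳ ∣ʳ (cross-∉₂ G) O) B)
    internalPar⇐ N O G (base R S) (sync _ _ , g , ε , ∣ˡ v , ∣ʳ w)
        | inj₂ B | inj₁ (u , _ , refl , s) =
      ⊥-elim (out-region (out-sub 1 (+ 1) ∣ˡ ∣ˡ (cross-∉₁ G) O) B)
    internalPar⇐ N O G (base R S) (sync _ _ , g , ε , ∣ˡ v , ∣ʳ w)
        | inj₂ B | inj₂ B′ = ⊥-elim (regions-disjoint N B B′)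
    internalPar⇐ N O G (hidden ι κ C i m R) E
      with internalPar⇐ N (out-cross C i N O)
             (λ { (here refl) → _ , _ , refl , refl ; (there j) → G j }) R E
    ... | _ , s = _ , hide s

  -- Valid paths without terms.

  -- The choice of names is left open because valid paths do not depend on it: two terms can then be
  -- given names under which they enable corresponding labels with literally equal subjects.
  record Naming (A : Set) (X : Term) : Set c where
    field
      e     : Name → A
      h     : List ℕ → A
      n     : Label → A
      names : Names X h n
      out   : Out X [] e h n

  record Enabled {A : Set} {X : Term} (N : Naming A X) (hist : Path) (l : Label) : Set c where
    constructor enabled
    field
      en : En X (Naming.e N) (Naming.h N) (mu (Naming.n N) hist) l

  -- Histories list the latest label first while paths list the earliest first, hence the use of
  -- `_ʳ++_` wherever a path extends a history.
  data SV {A : Set} {X : Term} (N : Naming A X) (hist : Path) : Path → Set c where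
    []  : SV N hist []
    _∷_ : ∀ {l p} → Enabled N hist l → SV N (l ∷ hist) p → SV N hist (l ∷ p)

  module _ {A : Set} {X : Term} (N : Naming A X) where

    open Naming N

    At : Path → Term → Set c
    At hist Z = Rel X e h n (mu n hist) Z e

    fires-mu : ∀ hist l → Fires (mu n hist) (mu n (l ∷ hist)) (λ α → Touches α l) (n l)
    fires-mu hist l = mu-hit {n = n} {l = l} hist , mu-miss {n = n} {l = l} hist

    at-start : At [] X
    at-start = subst (At []) (rename-id (λ _ → refl) X) (rel-init X (λ y → y) (λ _ → refl) (λ _ → refl))

    -- With its converse `link⇐` this replaces validity by `SV`; the relation `At` to the reached
    -- term also delivers its state.
    link⇒ : ∀ {hist Z p W} → At hist Z → Z —⟪ p ⟫→ W → SV N hist p × At (p ʳ++ hist) W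
    link⇒ R []       = [] , R
    link⇒ {hist} R (_∷_ {a = l} s ss) with internal⇒ R s
    ... | E , k with link⇒ (k (fires-mu hist l)) ss
    ...   | V , R′ = enabled E ∷ V , R′

    link⇐ : ∀ {hist Z p} → At hist Z → SV N hist p → Valid Z p
    link⇐ R []      = _ , []
    link⇐ {hist} R (_∷_ {l = l} (enabled E) V) with internal⇐ names out R E
    ... | _ , s with internal⇒ R s
    ...   | _ , k with link⇐ (k (fires-mu hist l)) V
    ...     | _ , ss = _ , s ∷ ss

  module 𝕂 = CommutativeSemiring 𝕂

  -- Locality of enabledness, and homotopy from equality of label sets.

  module _ {A : Set} where

    -- The source of commutation: a label touches no prefix of the positions of a label independent
    -- of it, so its firing neither enables nor disables that label.
    vis-local : ∀ {X e h μ μ′ ι} {g : A} {ε} →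
                (∀ {α} → Prefix _≡_ α ι → μ′ α ≡ μ α) →
                Vis X e h μ ι g ε → Vis X e h μ′ ι g ε
    vis-local E (act m p)   = act (trans (E []) m) p
    vis-local E (fired m v) = fired (trans (E []) m) (vis-local (E ∘ (refl ∷_)) v)
    vis-local E (◇ v)       = ◇ vis-local (E ∘ (refl ∷_)) v
    vis-local E (∣ˡ v)      = ∣ˡ (vis-local (E ∘ (refl ∷_)) v)
    vis-local E (∣ʳ v)      = ∣ʳ (vis-local (E ∘ (refl ∷_)) v)
    vis-local E (∥ˡ v)      = ∥ˡ (vis-local (E ∘ (refl ∷_)) v)
    vis-local E (∥ʳ v)      = ∥ʳ (vis-local (E ∘ (refl ∷_)) v)
    vis-local E (hide v)    = hide (vis-local E v)

    -- An action strictly below another one is reached only after the upper one has fired, and then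
    -- the upper one is no longer available.
    antichain : ∀ {X e h μ ι κ} {g g′ : A} {ε ε′} → Vis X e h μ ι g ε → Vis X e h μ κ g′ ε′ →
                Prefix _≡_ ι κ → ι ≡ κ
    antichain (act m _)   (act _ _)   p = refl
    antichain (act m _)   (fired m′ _) p with trans (sym m) m′
    ... | ()
    antichain (fired m v) (fired m′ w) (refl ∷ p) with trans (sym m) m′
    ... | refl = cong (_ ∷_) (antichain v w p)
    antichain (◇ v)       (◇ w)       (refl ∷ p) = cong (_ ∷_) (antichain v w p)
    antichain (∣ˡ v)      (∣ˡ w)      (refl ∷ p) = cong (_ ∷_) (antichain v w p)
    antichain (∣ˡ v)      (∣ʳ w)      (() ∷ p)
    antichain (∣ʳ v)      (∣ˡ w)      (() ∷ p)
    antichain (∣ʳ v)      (∣ʳ w)      (refl ∷ p) = cong (_ ∷_) (antichain v w p)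
    antichain (∥ˡ v)      (∥ˡ w)      (refl ∷ p) = cong (_ ∷_) (antichain v w p)
    antichain (∥ˡ v)      (∥ʳ w)      (() ∷ p)
    antichain (∥ʳ v)      (∥ˡ w)      (() ∷ p)
    antichain (∥ʳ v)      (∥ʳ w)      (refl ∷ p) = cong (_ ∷_) (antichain v w p)
    antichain (hide v)    (hide w)    p = antichain v w p

    st-cong : ∀ X {μ μ′ : Position → Maybe A} → μ ≗ μ′ → st X μ ≡ st X μ′
    st-cong (const k)   E = refl
    st-cong (act u ε P) {μ} {μ′} E with μ [] | μ′ [] | E []
    ... | just _  | _ | refl = st-cong P (E ∘ _)
    ... | nothing | _ | refl = refl
    st-cong (◇ P)       E = st-cong P (E ∘ _)
    st-cong (P ∣ Q)     E = cong₂ _*ᴷ_ (st-cong P (E ∘ _)) (st-cong Q (E ∘ _))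
    st-cong (P ∥ Q)     E = cong₂ _*ᴷ_ (st-cong P (E ∘ _)) (st-cong Q (E ∘ _))
    st-cong (hide P)    E = st-cong P E

    vis-acts : ∀ {X e h μ μ′ ι} {g : A} {ε} → (∀ {α} → Act X α → μ′ α ≡ μ α) →
               Vis X e h μ ι g ε → Vis X e h μ′ ι g ε
    vis-acts E (act m p)   = act (trans (E here) m) p
    vis-acts E (fired m v) = fired (trans (E here) m) (vis-acts (E ∘ act) v)
    vis-acts E (◇ v)       = ◇ vis-acts (E ∘ ◇_) v
    vis-acts E (∣ˡ v)      = ∣ˡ (vis-acts (E ∘ ∣ˡ) v)
    vis-acts E (∣ʳ v)      = ∣ʳ (vis-acts (E ∘ ∣ʳ) v)
    vis-acts E (∥ˡ v)      = ∥ˡ (vis-acts (E ∘ ∥ˡ) v)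
    vis-acts E (∥ʳ v)      = ∥ʳ (vis-acts (E ∘ ∥ʳ) v)
    vis-acts E (hide v)    = hide (vis-acts (E ∘ hide) v)

    st-acts : ∀ X {μ μ′ : Position → Maybe A} → (∀ {α} → Act X α → μ′ α ≡ μ α) → st X μ ≡ st X μ′
    st-acts (const k)   E = refl
    st-acts (act u ε P) {μ} {μ′} E with μ [] | μ′ [] | E here
    ... | just _  | _ | refl = st-acts P (E ∘ act)
    ... | nothing | _ | refl = refl
    st-acts (◇ P)       E = st-acts P (E ∘ ◇_)
    st-acts (P ∣ Q)     E = cong₂ _*ᴷ_ (st-acts P (E ∘ ∣ˡ)) (st-acts Q (E ∘ ∣ʳ))
    st-acts (P ∥ Q)     E = cong₂ _*ᴷ_ (st-acts P (E ∘ ∥ˡ)) (st-acts Q (E ∘ ∥ʳ))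
    st-acts (hide P)    E = st-acts P (E ∘ hide)

  conn-acts : ∀ {X ι κ} → Conn X (ι , κ) → Act X ι × Act X κ
  conn-acts (act C)    with conn-acts C
  ... | a , b = act a , act b
  conn-acts (◇ C)      with conn-acts C
  ... | a , b = ◇ a , ◇ b
  conn-acts (∣ˡ C)     with conn-acts C
  ... | a , b = ∣ˡ a , ∣ˡ b
  conn-acts (∣ʳ C)     with conn-acts C
  ... | a , b = ∣ʳ a , ∣ʳ b
  conn-acts (∥ˡ C)     with conn-acts C
  ... | a , b = ∥ˡ a , ∥ˡ b
  conn-acts (∥ʳ C)     with conn-acts C
  ... | a , b = ∥ʳ a , ∥ʳ b
  conn-acts (hide C)   with conn-acts C
  ... | a , b = hide a , hide b
  conn-acts (sync a b) = ∣ˡ a , ∣ʳ b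

  module _ {A : Set} {X : Term} (N : Naming A X) where

    open Naming N using (n)

    enabled-mu : ∀ {hist hist′ l} → (∀ {α β} → Touches β l → Prefix _≡_ α β → mu n hist′ α ≡ mu n hist α) →
                 Enabled N hist l → Enabled N hist′ l
    enabled-mu E (enabled (C , g , ε , v , w)) =
      enabled (C , g , ε , vis-local (E (inj₁ refl)) v , vis-local (E (inj₂ refl)) w)

    sv-mu : ∀ {hist hist′ p} → mu n hist ≗ mu n hist′ → SV N hist p → SV N hist′ p
    sv-mu E []      = []
    sv-mu {hist} {hist′} E (_∷_ {l} x V) =
      enabled-mu {hist} {hist′} (λ {α} _ _ → sym (E α)) x ∷
      sv-mu (mu-cong {n = n} {hist} {hist′} l E) V

    sv-++⁻ : ∀ {hist} p {q} → SV N hist (p ++ q) → SV N hist p × SV N (p ʳ++ hist) q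
    sv-++⁻ []      V = [] , V
    sv-++⁻ (l ∷ p) (x ∷ V) with sv-++⁻ p V
    ... | V₁ , V₂ = x ∷ V₁ , V₂

    sv-++⁺ : ∀ {hist p q} → SV N hist p → SV N (p ʳ++ hist) q → SV N hist (p ++ q)
    sv-++⁺ []       W = W
    sv-++⁺ (x ∷ V) W = x ∷ sv-++⁺ V W

    #-miss : ∀ {a b α β} → a # b → Touches β b → Prefix _≡_ α β → ¬ Touches α a
    #-miss ((p , _) , _)         (inj₁ refl) q (inj₁ refl) = p q
    #-miss (_ , _ , (p , _) , _) (inj₁ refl) q (inj₂ refl) = p q
    #-miss (_ , (p , _) , _)     (inj₂ refl) q (inj₁ refl) = p q
    #-miss (_ , _ , _ , (p , _)) (inj₂ refl) q (inj₂ refl) = p q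

    enabled-postpone : ∀ {hist a b} → a # b → Enabled N hist b → Enabled N (a ∷ hist) b
    enabled-postpone {hist} {a} i = enabled-mu {hist} {a ∷ hist}
      (λ t q → mu-miss {n = n} {l = a} hist (#-miss i t q))

    enabled-advance : ∀ {hist a b} → a # b → Enabled N (a ∷ hist) b → Enabled N hist b
    enabled-advance {hist} {a} i = enabled-mu {a ∷ hist} {hist}
      (λ t q → sym (mu-miss {n = n} {l = a} hist (#-miss i t q)))

    ∼⇒sv : ∀ {p q} → p ∼ q → ∀ {hist} → (SV N hist p → SV N hist q) × (SV N hist q → SV N hist p)
    ∼⇒sv (commute i) = go i , go (Cancellation.#-sym i)
      where
      go : ∀ {a b hist} → a # b → SV N hist (a ∷ b ∷ []) → SV N hist (b ∷ a ∷ [])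
      go i (x ∷ y ∷ []) = enabled-advance i y ∷ enabled-postpone (Cancellation.#-sym i) x ∷ []
    ∼⇒sv ∼-refl = (λ V → V) , (λ V → V)
    ∼⇒sv (∼-sym e) = proj₂ (∼⇒sv e) , proj₁ (∼⇒sv e)
    ∼⇒sv (∼-trans e f) = proj₁ (∼⇒sv f) ∘ proj₁ (∼⇒sv e) , proj₂ (∼⇒sv e) ∘ proj₂ (∼⇒sv f)
    ∼⇒sv (∼-++ {p} {p′} {q} {q′} e f) {hist} = to , from
      where
      to : SV N hist (p ++ q) → SV N hist (p′ ++ q′)
      to V with sv-++⁻ p V
      ... | V₁ , V₂ = sv-++⁺ (proj₁ (∼⇒sv e) V₁)
                        (sv-mu (∼⇒mu {n = n} e hist) (proj₁ (∼⇒sv f) V₂))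
      from : SV N hist (p′ ++ q′) → SV N hist (p ++ q)
      from V with sv-++⁻ p′ V
      ... | V₁ , V₂ = sv-++⁺ (proj₂ (∼⇒sv e) V₁)
                        (sv-mu (λ α → sym (∼⇒mu {n = n} e hist α)) (proj₂ (∼⇒sv f) V₂))

    enabled-fresh : ∀ {hist l m α} → m ∈ hist → Touches α m → Enabled N hist l → ¬ Touches α l
    enabled-fresh {hist} i t (enabled (C , g , ε , v , w)) (inj₁ refl) = mu-nothing {n = n} hist (vis-unfired v) i t
    enabled-fresh {hist} i t (enabled (C , g , ε , v , w)) (inj₂ refl) = mu-nothing {n = n} hist (vis-unfired w) i t

    sv-fresh : ∀ {hist p l m α} → SV N hist p → m ∈ hist → Touches α m → l ∈ p → ¬ Touches α l
    sv-fresh (x ∷ V) i t (here refl) = enabled-fresh i t x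
    sv-fresh (x ∷ V) i t (there j)   = sv-fresh V (there i) t j

    sv-∉ : ∀ {hist l p} → SV N (l ∷ hist) p → l ∉ p
    sv-∉ V i = sv-fresh V (here refl) (inj₁ refl) i (inj₁ refl)

    -- Since `a` still fires after `b`, the two share no address; and distinct addresses that are
    -- available at the same time are incomparable by `antichain`.
    enabled-# : ∀ {hist a b p} → Enabled N hist a → Enabled N hist b → SV N (b ∷ hist) p → a ∈ p → a # b
    enabled-# {a = ι , κ} {b = ι′ , κ′} (enabled (_ , _ , _ , v , w)) (enabled (_ , _ , _ , v′ , w′)) V i =
        ind (inj₁ refl) (inj₁ refl) v v′ , ind (inj₁ refl) (inj₂ refl) v w′
      , ind (inj₂ refl) (inj₁ refl) w v′ , ind (inj₂ refl) (inj₂ refl) w w′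
      where
      ind : ∀ {α β g g′ δ δ′} → Touches α (ι , κ) → Touches β (ι′ , κ′) →
            Vis X (Naming.e N) (Naming.h N) _ α g δ → Vis X (Naming.e N) (Naming.h N) _ β g′ δ′ →
            Independent α β
      ind s t x y =
          (λ q → apart s (subst (λ β → Touches β _) (sym (antichain x y q)) t))
        , (λ q → apart s (subst (λ β → Touches β _) (antichain y x q) t))
        where
        apart : ∀ {α} → Touches α (ι , κ) → ¬ Touches α (ι′ , κ′)
        apart s t = sv-fresh V (here refl) t i s

    to-front : ∀ {hist a} q {r} → Enabled N hist a → SV N hist (q ++ a ∷ r) → q ++ a ∷ r ∼ a ∷ q ++ r
    to-front []      x V = ∼-refl
    to-front {a = a} (b ∷ q) x (y ∷ V) with enabled-# x y V (∈-++⁺ʳ q (here refl))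
    ... | i = ∼-trans (∼-++ (∼-refl {b ∷ []}) (to-front q (enabled-postpone (Cancellation.#-sym i) x) V))
                      (∼-++ (commute (Cancellation.#-sym i)) ∼-refl)

    -- The first label of `p` is already enabled at `hist`, so it is independent of every label that
    -- precedes it in `q` and can be commuted to the front; induction does the rest. Runs may
    -- therefore be compared as sets of labels.
    ≐⇒∼ : ∀ {hist p q} → SV N hist p → SV N hist q → p ≐ q → p ∼ q
    ≐⇒∼ {p = []} {[]} V W e = ∼-refl
    ≐⇒∼ {p = []} {l ∷ q} V W (_ , j) with j (here refl)
    ... | ()
    ≐⇒∼ {hist} {a ∷ p} {q} (x ∷ V) W (i , j) with ∈-∃++ (i (here refl))
    ... | q₁ , q₂ , refl with to-front q₁ x W
    ...   | f with proj₁ (∼⇒sv f) W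
    ...     | (_ ∷ W′) = ∼-trans (∼-++ (∼-refl {a ∷ []}) (≐⇒∼ V W′ (to , from))) (∼-sym f)
      where
      to : ∀ {l} → l ∈ p → l ∈ q₁ ++ q₂
      to k with proj₁ (∼⇒≐ f) (i (there k))
      ... | here refl = ⊥-elim (sv-∉ V k)
      ... | there m   = m
      from : ∀ {l} → l ∈ q₁ ++ q₂ → l ∈ p
      from k with j (proj₂ (∼⇒≐ f) (there k))
      ... | here refl = ⊥-elim (sv-∉ W′ k)
      ... | there m   = m

  -- Finite sums: matching of terms and splitting into fibres.

  module _ {a} {B : Set a} where

    Σw : (B → K) → List B → K
    Σw w = foldr (λ x k → w x +ᴷ k) 0#

    +-swap : ∀ x y z → x +ᴷ (y +ᴷ z) ≈ y +ᴷ (x +ᴷ z)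
    +-swap x y z = 𝕂.trans (𝕂.sym (𝕂.+-assoc _ _ _))
      (𝕂.trans (𝕂.+-congʳ (𝕂.+-comm _ _)) (𝕂.+-assoc _ _ _))

    Σw-mid : ∀ w xs {y ys} → Σw w (xs ++ y ∷ ys) ≈ w y +ᴷ Σw w (xs ++ ys)
    Σw-mid w []       = 𝕂.refl
    Σw-mid w (x ∷ xs) = 𝕂.trans (𝕂.+-congˡ (Σw-mid w xs)) (+-swap _ _ _)

    Σw-zero : ∀ w xs → (∀ {x} → x ∈ xs → w x ≈ 0#) → Σw w xs ≈ 0#
    Σw-zero w []       z = 𝕂.refl
    Σw-zero w (x ∷ xs) z =
      𝕂.trans (𝕂.+-cong (z (here refl)) (Σw-zero w xs (z ∘ there))) (𝕂.+-identityˡ _)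

    unique-mid : ∀ {r} {_≉_ : B → B → Set r} → (∀ {x y} → x ≉ y → y ≉ x) →
                 ∀ xs {y ys} → AllPairs _≉_ (xs ++ y ∷ ys) →
                 (∀ {z} → z ∈ xs ++ ys → y ≉ z) × AllPairs _≉_ (xs ++ ys)
    unique-mid s []       (A ∷ U) = All.lookup A , U
    unique-mid s (x ∷ xs) (A ∷ U) with unique-mid s xs U
    ... | f , U′ =
        (λ { (here refl) → s (All.lookup A (∈-++⁺ʳ xs (here refl))) ; (there i) → f i })
      , All.tabulate (λ i → All.lookup A (mid i)) ∷ U′
      where
      mid : ∀ {z y ys} → z ∈ xs ++ ys → z ∈ xs ++ y ∷ ys
      mid i with ∈-++⁻ xs i
      ... | inj₁ j = ∈-++⁺ˡ j
      ... | inj₂ j = ∈-++⁺ʳ xs (there j)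

  module _ {a b r s t} {B : Set a} {D : Set b} (w : B → K) (v : D → K)
           {_≉ᴮ_ : B → B → Set r} {_≉ᴰ_ : D → D → Set s}
           (symᴰ : ∀ {x y} → x ≉ᴰ y → y ≉ᴰ x)
           (R : B → D → Set t)
           (R-w : ∀ {x y} → R x y → w x ≈ v y)
           (R-left : ∀ {x x′ y} → R x y → R x′ y → ¬ x ≉ᴮ x′)
           (R-right : ∀ {x y y′} → R x y → R x y′ → ¬ y ≉ᴰ y′) where

    -- Induction removes `x` together with its partner `y`. By `R-left` and `R-right`, applied to
    -- lists without repetition, no remaining element had `x` or `y` as its partner. Elements of
    -- weight `0#` may stay without one.
    Σw-match : ∀ xs ys → AllPairs _≉ᴮ_ xs → AllPairs _≉ᴰ_ ys →
               (∀ {x} → x ∈ xs → w x ≈ 0# ⊎ ∃[ y ] y ∈ ys × R x y) →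
               (∀ {y} → y ∈ ys → v y ≈ 0# ⊎ ∃[ x ] x ∈ xs × R x y) →
               Σw w xs ≈ Σw v ys
    Σw-match [] ys U V F G = 𝕂.sym (Σw-zero v ys λ i → weightless (G i))
      where
      weightless : ∀ {y} → v y ≈ 0# ⊎ ∃[ x ] x ∈ [] × R x y → v y ≈ 0#
      weightless (inj₁ z) = z
      weightless (inj₂ (_ , () , _))
    Σw-match (x ∷ xs) ys (A ∷ U) V F G with F (here refl)
    ... | inj₁ z = 𝕂.trans (𝕂.trans (𝕂.+-congʳ z) (𝕂.+-identityˡ _))
                     (Σw-match xs ys U V (F ∘ there) G′)
      where
      G′ : ∀ {y} → y ∈ ys → v y ≈ 0# ⊎ ∃[ x ] x ∈ xs × R x y
      G′ i with G i
      ... | inj₁ z′                  = inj₁ z′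
      -- A partner of the dropped weightless `x` becomes weightless itself.
      ... | inj₂ (_ , here refl , q) = inj₁ (𝕂.trans (𝕂.sym (R-w q)) z)
      ... | inj₂ (_ , there j , q)   = inj₂ (_ , j , q)
    ... | inj₂ (y , i , q) with ∈-∃++ i
    ...   | ys₁ , ys₂ , refl with unique-mid symᴰ ys₁ V
    ...     | y≉ , V′ = 𝕂.trans (𝕂.+-cong (R-w q) (Σw-match xs (ys₁ ++ ys₂) U V′ F′ G′))
                          (𝕂.sym (Σw-mid v ys₁))
      where
      F′ : ∀ {x} → x ∈ xs → w x ≈ 0# ⊎ ∃[ y ] y ∈ ys₁ ++ ys₂ × R x y
      F′ j with F (there j)
      ... | inj₁ z            = inj₁ z
      ... | inj₂ (y′ , k , p) with ∈-++⁻ ys₁ k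
      ...   | inj₁ k′          = inj₂ (y′ , ∈-++⁺ˡ k′ , p)
      ...   | inj₂ (there k′)  = inj₂ (y′ , ∈-++⁺ʳ ys₁ k′ , p)
      ...   | inj₂ (here refl) = ⊥-elim (R-left q p (All.lookup A j))
      G′ : ∀ {y} → y ∈ ys₁ ++ ys₂ → v y ≈ 0# ⊎ ∃[ x ] x ∈ xs × R x y
      G′ {y′} j with G (mid j)
        where
        mid : y′ ∈ ys₁ ++ ys₂ → y′ ∈ ys₁ ++ y ∷ ys₂
        mid k with ∈-++⁻ ys₁ k
        ... | inj₁ k′ = ∈-++⁺ˡ k′
        ... | inj₂ k′ = ∈-++⁺ʳ ys₁ (there k′)
      ... | inj₁ z                  = inj₁ z
      ... | inj₂ (_ , there k , p)   = inj₂ (_ , k , p)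
      ... | inj₂ (_ , here refl , p) = ⊥-elim (R-right q p (y≉ j))

  module _ {i r} {I : Set i} {_∼ᵢ_ : I → I → Set r} (eq : IsEquivalence _∼ᵢ_) (_≟ᵢ_ : Decidable _∼ᵢ_) where

    module ∼ᵢ = IsEquivalence eq

    module _ {a} {B : Set a} (w : B → K) (f : B → I) where

      fibre : I → List B → List B
      fibre i = filter (λ x → f x ≟ᵢ i)

      others : I → List B → List B
      others i = filter (λ x → ¬? (f x ≟ᵢ i))

      Σw-split : ∀ i xs → Σw w xs ≈ Σw w (fibre i xs) +ᴷ Σw w (others i xs)
      Σw-split i []       = 𝕂.sym (𝕂.+-identityˡ _)
      Σw-split i (x ∷ xs) with f x ≟ᵢ i
      ... | yes _ = 𝕂.trans (𝕂.+-congˡ (Σw-split i xs)) (𝕂.sym (𝕂.+-assoc _ _ _))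
      ... | no _  = 𝕂.trans (𝕂.+-congˡ (Σw-split i xs)) (+-swap {B = B} _ _ _)

      fibre-others : ∀ {i j} xs → ¬ j ∼ᵢ i → fibre j (others i xs) ≡ fibre j xs
      fibre-others []       ¬e = refl
      fibre-others {i} {j} (x ∷ xs) ¬e with f x ≟ᵢ i
      fibre-others {i} {j} (x ∷ xs) ¬e | yes p with f x ≟ᵢ j
      ... | yes q = ⊥-elim (¬e (∼ᵢ.trans (∼ᵢ.sym q) p))
      ... | no _  = fibre-others xs ¬e
      fibre-others {i} {j} (x ∷ xs) ¬e | no _ with f x ≟ᵢ j
      ... | yes _ = cong (x ∷_) (fibre-others xs ¬e)
      ... | no _  = fibre-others xs ¬e

      fibre-others-[] : ∀ {i j} xs → j ∼ᵢ i → fibre j (others i xs) ≡ []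
      fibre-others-[] []       e = refl
      fibre-others-[] {i} {j} (x ∷ xs) e with f x ≟ᵢ i
      fibre-others-[] {i} {j} (x ∷ xs) e | yes p = fibre-others-[] xs e
      fibre-others-[] {i} {j} (x ∷ xs) e | no ¬p with f x ≟ᵢ j
      ... | yes q = ⊥-elim (¬p (∼ᵢ.trans q e))
      ... | no _  = fibre-others-[] xs e

    module _ {a b} {B : Set a} {D : Set b} (w : B → K) (v : D → K) (f : B → I) (g : D → I) where

      -- The list `is` may repeat an index up to `_∼ᵢ_`: after a fibre has been split off, it is
      -- empty in the remainder (`fibre-others-[]`) and contributes nothing more.
      Σw-fibres′ : ∀ is xs ys →
        (∀ {x} → x ∈ xs → ∃[ i ] i ∈ is × f x ∼ᵢ i) →
        (∀ {y} → y ∈ ys → ∃[ i ] i ∈ is × g y ∼ᵢ i) →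
        (∀ {i} → i ∈ is → Σw w (fibre w f i xs) ≈ Σw v (fibre v g i ys)) →
        Σw w xs ≈ Σw v ys
      Σw-fibres′ [] []       []       F G E = 𝕂.refl
      Σw-fibres′ [] (x ∷ xs) ys       F G E with F (here refl)
      ... | _ , () , _
      Σw-fibres′ [] []       (y ∷ ys) F G E with G (here refl)
      ... | _ , () , _
      Σw-fibres′ (i ∷ is) xs ys F G E =
        𝕂.trans (Σw-split w f i xs)
          (𝕂.trans (𝕂.+-cong (E (here refl))
            (Σw-fibres′ is (others w f i xs) (others v g i ys) F′ G′ E′))
          (𝕂.sym (Σw-split v g i ys)))
        where
        F′ : ∀ {x} → x ∈ others w f i xs → ∃[ j ] j ∈ is × f x ∼ᵢ j
        F′ k with ∈-filter⁻ (λ x → ¬? (f x ≟ᵢ i)) {xs = xs} k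
        ... | k′ , ¬e with F k′
        ...   | _ , here refl , e = ⊥-elim (¬e e)
        ...   | j , there m , e   = j , m , e
        G′ : ∀ {y} → y ∈ others v g i ys → ∃[ j ] j ∈ is × g y ∼ᵢ j
        G′ k with ∈-filter⁻ (λ x → ¬? (g x ≟ᵢ i)) {xs = ys} k
        ... | k′ , ¬e with G k′
        ...   | _ , here refl , e = ⊥-elim (¬e e)
        ...   | j , there m , e   = j , m , e
        E′ : ∀ {j} → j ∈ is → Σw w (fibre w f j (others w f i xs)) ≈ Σw v (fibre v g j (others v g i ys))
        E′ {j} m with j ≟ᵢ i
        ... | yes e rewrite fibre-others-[] w f xs e | fibre-others-[] v g ys e = 𝕂.refl
        ... | no ¬e rewrite fibre-others w f xs ¬e | fibre-others v g ys ¬e = E (there m)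

      Σw-fibres : ∀ xs ys →
        (∀ {x} → x ∈ xs → Σw w (fibre w f (f x) xs) ≈ Σw v (fibre v g (f x) ys)) →
        (∀ {y} → y ∈ ys → Σw w (fibre w f (g y) xs) ≈ Σw v (fibre v g (g y) ys)) →
        Σw w xs ≈ Σw v ys
      Σw-fibres xs ys E₁ E₂ = Σw-fibres′ (map f xs ++ map g ys) xs ys
        (λ k → _ , ∈-++⁺ˡ (∈-map⁺ f k) , ∼ᵢ.refl)
        (λ k → _ , ∈-++⁺ʳ (map f xs) (∈-map⁺ g k) , ∼ᵢ.refl)
        E
        where
        open import Data.List.Membership.Propositional.Properties using (∈-map⁺; ∈-map⁻)
        E : ∀ {i} → i ∈ map f xs ++ map g ys → Σw w (fibre w f i xs) ≈ Σw v (fibre v g i ys)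
        E k with ∈-++⁻ (map f xs) k
        ... | inj₁ k′ with ∈-map⁻ f k′
        ...   | x , j , refl = E₁ j
        E k | inj₂ k′ with ∈-map⁻ g k′
        ...   | y , j , refl = E₂ j

  -- Runs as maximal static paths, and sums over them.

  data Src : Set where
    free : Name → Src
    hid  : List ℕ → Src
    ev   : Label → Src

  canonical : ∀ X → Naming Src X
  canonical X = record
    { e = free ; h = hid ; n = ev
    ; names = record { h-inj = λ { _ _ refl → refl } ; n-inj = λ { _ _ refl → refl } ; h≢n = λ _ _ () }
    ; out = record { f-inj = λ { refl → refl } ; f≢h = λ _ () ; f≢n = λ _ _ () }
    }

  past : Path → Path
  past p = p ʳ++ []

  module _ {A : Set} {X : Term} (N : Naming A X) where

    open Naming N using (n)

    Max : Path → Set c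
    Max p = SV N [] p × (∀ l → ¬ Enabled N (past p) l)

    weight : Path → K
    weight p = st X (mu n (past p))

    max⇒ : ∀ ρ → Max (path ρ)
    max⇒ ρ with link⇒ N (at-start N) (reaches ρ)
    ... | V , R = V , stuck
      where
      stuck : ∀ l → ¬ Enabled N (past (path ρ)) l
      stuck l x with maximal ρ (l ∷ []) (link⇐ N (at-start N) (sv-++⁺ N V (x ∷ [])))
      ... | ()

    max⇐ : ∀ {p} → Max p → ∃[ ρ ] path ρ ≡ p
    max⇐ {p} (V , stuck) with link⇐ N (at-start N) V
    ... | Z , ss = record { path = p ; target = Z ; reaches = ss ; maximal = maximal′ } , refl
      where
      maximal′ : ∀ q → Valid X (p ++ q) → q ≡ []
      maximal′ []      _ = refl
      maximal′ (l ∷ q) (_ , ts) with sv-++⁻ N p (proj₁ (link⇒ N (at-start N) ts))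
      ... | _ , x ∷ _ = ⊥-elim (stuck l x)

    state-weight : ∀ ρ → state (target ρ) ≡ weight (path ρ)
    state-weight ρ = state-rel (proj₂ (link⇒ N (at-start N) (reaches ρ)))

    weight-∼ : ∀ {p q} → p ∼ q → weight p ≡ weight q
    weight-∼ e = st-cong X (∼⇒mu {n = n} e [])

    max-∼ : ∀ {p q} → p ∼ q → Max p → Max q
    max-∼ {p} {q} e (V , stuck) =
        proj₁ (∼⇒sv N e) V
      , λ l x → stuck l (enabled-mu N {past q} {past p} (λ {α} _ _ → ∼⇒mu {n = n} e [] α) x)

    -- The enumeration of runs is used only through these properties, so that `runs X` and its
    -- fibres are handled alike and its order never matters.
    record Lists {s} (S : Path → Set s) (xs : List (MaximalPath X)) : Set (c ⊔ s) where
      field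
        unique   : AllPairs (λ ρ σ → ¬ path ρ ∼ path σ) xs
        sound    : ∀ {ρ} → ρ ∈ xs → S (path ρ)
        complete : ∀ {p} → Max p → S p → ∃[ ρ ] ρ ∈ xs × p ∼ path ρ

    runs-complete : ∀ {p} → Max p → ∃[ ρ ] ρ ∈ runs X × p ∼ path ρ
    runs-complete m with max⇐ m
    ... | ρ , refl with find (proj₂ (proj₂ (finite X)) ρ)
    ...   | σ , i , e = σ , i , e

    runs-list : Lists (λ _ → ⊤) (runs X)
    runs-list = record
      { unique   = proj₁ (proj₂ (finite X))
      ; sound    = λ _ → tt
      ; complete = λ m _ → runs-complete m
      }

  Weight : ∀ {X} → MaximalPath X → K
  Weight ρ = state (target ρ)

  module _ {A B : Set} {X Y : Term} (N : Naming A X) (M : Naming B Y)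
           {s t r} {S : Path → Set s} {T : Path → Set t} (R : Path → Path → Set r)
           (R-∼ : ∀ {p p′ q q′} → p ∼ p′ → q ∼ q′ → R p q → R p′ q′)
           (R-weight : ∀ {p q} → Max N p → Max M q → R p q → weight N p ≈ weight M q)
           (R-left : ∀ {p p′ q} → Max N p → Max N p′ → R p q → R p′ q → p ∼ p′)
           (R-right : ∀ {p q q′} → Max M q → Max M q′ → R p q → R p q′ → q ∼ q′)
           (to : ∀ {p} → Max N p → S p → weight N p ≈ 0# ⊎ ∃[ q ] Max M q × T q × R p q)
           (from : ∀ {q} → Max M q → T q → weight M q ≈ 0# ⊎ ∃[ p ] Max N p × S p × R p q)
           where

    sum-match : ∀ {xs ys} → Lists N S xs → Lists M T ys → Σw Weight xs ≈ Σw Weight ys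
    sum-match {xs} {ys} L L′ = Σw-match Weight Weight (λ ¬e e → ¬e (∼-sym e))
      (λ ρ σ → R (path ρ) (path σ))
      (λ {ρ} {σ} q → 𝕂.trans (𝕂.reflexive (state-weight N ρ))
         (𝕂.trans (R-weight (max⇒ N ρ) (max⇒ M σ) q) (𝕂.reflexive (sym (state-weight M σ)))))
      (λ {ρ} {ρ′} q q′ ¬e → ¬e (R-left (max⇒ N ρ) (max⇒ N ρ′) q q′))
      (λ {_} {σ} {σ′} q q′ ¬e → ¬e (R-right (max⇒ M σ) (max⇒ M σ′) q q′))
      xs ys (Lists.unique L) (Lists.unique L′) F G
      where
      F : ∀ {ρ} → ρ ∈ xs → Weight ρ ≈ 0# ⊎ ∃[ σ ] σ ∈ ys × R (path ρ) (path σ)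
      F {ρ} i with to (max⇒ N ρ) (Lists.sound L i)
      ... | inj₁ z = inj₁ (𝕂.trans (𝕂.reflexive (state-weight N ρ)) z)
      ... | inj₂ (q , m , k , x) with Lists.complete L′ m k
      ...   | σ , j , e = inj₂ (σ , j , R-∼ ∼-refl e x)
      G : ∀ {σ} → σ ∈ ys → Weight σ ≈ 0# ⊎ ∃[ ρ ] ρ ∈ xs × R (path ρ) (path σ)
      G {σ} i with from (max⇒ M σ) (Lists.sound L′ i)
      ... | inj₁ z = inj₁ (𝕂.trans (𝕂.reflexive (state-weight M σ)) z)
      ... | inj₂ (q , m , k , x) with Lists.complete L m k
      ...   | ρ , j , e = inj₂ (ρ , j , R-∼ e ∼-refl x)

  sv-conn : ∀ {A X} {N : Naming A X} {hist p} → All (Conn X) hist → SV N hist p →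
            All (Conn X) (p ʳ++ hist)
  sv-conn C []      = C
  sv-conn C (enabled (x , _) ∷ V) = sv-conn (x ∷ C) V

  sv-all-conn : ∀ {A X} {N : Naming A X} {hist p} → SV N hist p → All (Conn X) p
  sv-all-conn []                    = []
  sv-all-conn (enabled (x , _) ∷ V) = x ∷ sv-all-conn V

  -- Equality of outcomes along bijections of labels.

  map-≐ : ∀ (φ : Label → Label) {p q} → p ≐ q → map φ p ≐ map φ q
  map-≐ φ (i , j) = go i , go j
    where
    go : ∀ {p q} → (∀ {l} → l ∈ p → l ∈ q) → ∀ {l} → l ∈ map φ p → l ∈ map φ q
    go i k with ∈-map⁻ φ k
    ... | _ , m , refl = ∈-map⁺ φ (i m)

  module _ {B : Set} {X Y : Term} (N : Naming B X) (M : Naming B Y) (φ : Label → Label)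
           (φ-inj : ∀ {l m} → Conn X l → Conn X m → φ l ≡ φ m → l ≡ m)
           (en-to : ∀ {hist l} → All (Conn X) hist → Enabled N hist l →
                    Enabled M (map φ hist) (φ l))
           (en-from : ∀ {hist l} → All (Conn X) hist → Enabled M (map φ hist) l →
                      ∃[ m ] φ m ≡ l × Enabled N hist m)
           (st-≈ : ∀ {hist} → All (Conn X) hist →
                   st X (mu (Naming.n N) hist) ≈ st Y (mu (Naming.n M) (map φ hist)))
           where

    private
      sv-to : ∀ {hist p} → All (Conn X) hist → SV N hist p → SV M (map φ hist) (map φ p)
      sv-to Cs []                      = []
      sv-to Cs (x@(enabled (C , _)) ∷ V) = en-to Cs x ∷ sv-to (C ∷ Cs) V

      sv-from : ∀ {hist q} → All (Conn X) hist → SV M (map φ hist) q → ∃[ p ] map φ p ≡ q × SV N hist p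
      sv-from Cs []      = [] , refl , []
      sv-from Cs (x ∷ V) with en-from Cs x
      ... | m , refl , y@(enabled (C , _)) with sv-from (C ∷ Cs) V
      ...   | p , refl , W = m ∷ p , refl , y ∷ W

      conn-past : ∀ {p} → SV N [] p → All (Conn X) (past p)
      conn-past V = sv-conn [] V

      past-map : ∀ p → past (map φ p) ≡ map φ (past p)
      past-map p = sym (List.map-ʳ++ φ p)

      max-to : ∀ {p} → Max N p → Max M (map φ p)
      max-to {p} (V , stuck) = sv-to [] V , stuck′
        where
        stuck′ : ∀ l → ¬ Enabled M (past (map φ p)) l
        stuck′ l x with en-from (conn-past V) (subst (λ h → Enabled M h l) (past-map p) x)
        ... | m , _ , y = stuck m y

      max-from : ∀ {q} → Max M q → ∃[ p ] map φ p ≡ q × Max N p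
      max-from (V , stuck) with sv-from [] V
      ... | p , refl , W = p , refl , W , λ l x →
        stuck (φ l) (subst (λ h → Enabled M h (φ l)) (sym (past-map p)) (en-to (conn-past W) x))

      weight-to : ∀ {p} → Max N p → weight N p ≈ weight M (map φ p)
      weight-to {p} (V , _) rewrite past-map p = st-≈ (conn-past V)

      reflect : ∀ {p p′} → All (Conn X) p → All (Conn X) p′ → map φ p ≐ map φ p′ → p ≐ p′
      reflect C C′ (i , j) = go C C′ i , go C′ C j
        where
        go : ∀ {p p′} → All (Conn X) p → All (Conn X) p′ →
             (∀ {l} → l ∈ map φ p → l ∈ map φ p′) → ∀ {l} → l ∈ p → l ∈ p′
        go C C′ i k with ∈-map⁻ φ (i (∈-map⁺ φ k))
        ... | m , k′ , e rewrite φ-inj (All.lookup C k) (All.lookup C′ k′) e = k′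

    -- The correspondence compares only the set of labels of `q` with that of `map φ p`, which makes
    -- it stable under homotopy; `≐⇒∼` recovers the run from the set.
    outcome-bijection : outcome X ≈ outcome Y
    outcome-bijection = sum-match N M {S = λ _ → ⊤} {T = λ _ → ⊤}
      (λ p q → map φ p ≐ q)
      (λ e f r → ≐-trans (map-≐ φ (≐-sym (∼⇒≐ e))) (≐-trans r (∼⇒≐ f)))
      (λ {p} m m′ r → 𝕂.trans (weight-to m)
        (𝕂.reflexive (weight-∼ M (≐⇒∼ M (proj₁ (max-to m)) (proj₁ m′) r))))
      (λ m m′ r r′ → ≐⇒∼ N (proj₁ m) (proj₁ m′)
        (reflect (sv-all-conn (proj₁ m)) (sv-all-conn (proj₁ m′)) (≐-trans r (≐-sym r′))))
      (λ m m′ r r′ → ≐⇒∼ M (proj₁ m) (proj₁ m′) (≐-trans (≐-sym r) r′))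
      (λ {p} m _ → inj₂ (map φ p , max-to m , tt , (λ k → k) , (λ k → k)))
      (λ m _ → inj₂ (from m))
      (runs-list N) (runs-list M)
      where
      from : ∀ {q} → Max M q → ∃[ p ] Max N p × ⊤ × map φ p ≐ q
      from m with max-from m
      ... | p , refl , m′ = p , m′ , tt , (λ k → k) , (λ k → k)

  module _ {B : Set} {X Y : Term} (N : Naming B X) (M : Naming B Y)
           (en-to : ∀ {hist l} → Enabled N hist l → Enabled M hist l)
           (en-from : ∀ {hist l} → Enabled M hist l → Enabled N hist l)
           (st-≈ : ∀ hist → st X (mu (Naming.n N) hist) ≈ st Y (mu (Naming.n M) hist)) where

    outcome-same : outcome X ≈ outcome Y
    outcome-same = outcome-bijection N M (λ l → l) (λ _ _ e → e)
      (λ {hist} _ x → subst (λ h → Enabled M h _) (sym (List.map-id hist)) (en-to x))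
      (λ {hist} _ x → _ , refl , en-from (subst (λ h → Enabled M h _) (List.map-id hist) x))
      (λ {hist} _ → subst (λ h → st X (mu (Naming.n N) hist) ≈ st Y (mu (Naming.n M) h))
                      (sym (List.map-id hist)) (st-≈ hist))

  -- `φ` need not be `A` on both components: when the sides of a parallel composition trade places,
  -- a synchronisation across it has its label reversed, which is the second case of `φ-A`.
  record Iso (X Y : Term) : Set (Level.suc 0ℓ ⊔ c ⊔ ℓ) where
    field
      φ         : Label → Label
      A         : Position → Position
      θ         : List ℕ → List ℕ
      φ⁻        : Label → Label
      A⁻        : Position → Position
      θ⁻        : List ℕ → List ℕ
      A-left    : ∀ {α} → Act X α → A⁻ (A α) ≡ α
      φ-A       : ∀ {ι κ} → Conn X (ι , κ) → φ (ι , κ) ≡ (A ι , A κ) ⊎ φ (ι , κ) ≡ (A κ , A ι)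
      φ-left    : ∀ {l} → Conn X l → φ⁻ (φ l) ≡ l
      conn-to   : ∀ {l} → Conn X l → Conn Y (φ l)
      conn-from : ∀ {l} → Conn Y l → ∃[ m ] φ m ≡ l × Conn X m
      hid-to    : ∀ {r} → Hid X r → Hid Y (θ r)
      θ-left    : ∀ {r} → Hid X r → θ⁻ (θ r) ≡ r
      vis-to    : ∀ {B : Set} {e h} {μ μ′ : Position → Maybe B} {α g ε} →
                  (∀ {β} → Act X β → μ′ (A β) ≡ μ β) → Act X α →
                  Vis X e (h ∘ θ) μ α g ε → Vis Y e h μ′ (A α) g ε
      vis-from  : ∀ {B : Set} {e h} {μ μ′ : Position → Maybe B} {α g ε} →
                  (∀ {β} → Act X β → μ′ (A β) ≡ μ β) → Act X α →
                  Vis Y e h μ′ (A α) g ε → Vis X e (h ∘ θ) μ α g ε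
      st-≈      : ∀ {B : Set} {μ μ′ : Position → Maybe B} →
                  (∀ {β} → Act X β → μ′ (A β) ≡ μ β) → st X μ ≈ st Y μ′

    A-inj : ∀ {α β} → Act X α → Act X β → A α ≡ A β → α ≡ β
    A-inj a b e = trans (sym (A-left a)) (trans (cong A⁻ e) (A-left b))

    φ-inj : ∀ {l m} → Conn X l → Conn X m → φ l ≡ φ m → l ≡ m
    φ-inj a b e = trans (sym (φ-left a)) (trans (cong φ⁻ e) (φ-left b))

    θ-inj : ∀ {r s} → Hid X r → Hid X s → θ r ≡ θ s → r ≡ s
    θ-inj a b e = trans (sym (θ-left a)) (trans (cong θ⁻ e) (θ-left b))

    touch-to : ∀ {α ι κ} → Conn X (ι , κ) → Touches α (ι , κ) → Touches (A α) (φ (ι , κ))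
    touch-to C t with φ-A C
    touch-to C (inj₁ refl) | inj₁ e rewrite e = inj₁ refl
    touch-to C (inj₂ refl) | inj₁ e rewrite e = inj₂ refl
    touch-to C (inj₁ refl) | inj₂ e rewrite e = inj₂ refl
    touch-to C (inj₂ refl) | inj₂ e rewrite e = inj₁ refl

    touch-from : ∀ {α ι κ} → Act X α → Conn X (ι , κ) → Touches (A α) (φ (ι , κ)) → Touches α (ι , κ)
    touch-from s C t with φ-A C | conn-acts C
    ... | inj₁ e | si , sk rewrite e = [ inj₁ ∘ A-inj s si , inj₂ ∘ A-inj s sk ]′ t
    ... | inj₂ e | si , sk rewrite e = [ inj₂ ∘ A-inj s sk , inj₁ ∘ A-inj s si ]′ t

    mu-A : ∀ {B : Set} {n : Label → B} {hist} → All (Conn X) hist → ∀ {α} → Act X α →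
           mu n (map φ hist) (A α) ≡ mu (n ∘ φ) hist α
    mu-A []      s = refl
    mu-A {n = n} {l ∷ hist} (C ∷ Cs) {α} s with touches? α l
    ... | yes t = mu-hit {n = n} {l = φ l} (map φ hist) (touch-to C t)
    ... | no ¬t = trans (mu-miss {n = n} {l = φ l} (map φ hist) (¬t ∘ touch-from s C)) (mu-A Cs s)

    pulled : ∀ {B : Set} → Naming B Y → Naming B X
    pulled M = record
      { e = e ; h = h ∘ θ ; n = n ∘ φ
      ; names = record
        { h-inj = λ p q x → θ-inj p q (h-inj names (hid-to p) (hid-to q) x)
        ; n-inj = λ p q x → φ-inj p q (n-inj names (conn-to p) (conn-to q) x)
        ; h≢n   = λ p q → h≢n names (hid-to p) (conn-to q)
        }
      ; out = record
        { f-inj = f-inj out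
        ; f≢h   = λ p → f≢h out (hid-to p)
        ; f≢n   = λ p _ → f≢n out (conn-to p) (λ ())
        }
      }
      where
      open Naming M

  module _ {X Y : Term} (I : Iso X Y) where

    open Iso I

    private
      M : Naming Src Y
      M = canonical Y
      N : Naming Src X
      N = pulled M

    en-to : ∀ {hist l} → All (Conn X) hist → Enabled N hist l → Enabled M (map φ hist) (φ l)
    en-to {hist} {ι , κ} Cs (enabled (C , g , ε , v , w)) with conn-to C | φ-A C | conn-acts C
    ... | D | inj₁ e | si , sk rewrite e =
      enabled (D , g , ε , vis-to (mu-A Cs) si v , vis-to (mu-A Cs) sk w)
    -- The label is reversed, so its first component now carries the polarity `opposite ε`.
    ... | D | inj₂ e | si , sk rewrite e =
      enabled (D , g , opposite ε , vis-to (mu-A Cs) sk w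
              , subst (Vis Y free hid _ (A ι) g) (sym (Sign.opposite-involutive ε)) (vis-to (mu-A Cs) si v))

    en-from : ∀ {hist l} → All (Conn X) hist → Enabled M (map φ hist) l →
              ∃[ m ] φ m ≡ l × Enabled N hist m
    en-from {hist} Cs (enabled (D , g , ε , v , w)) with conn-from D
    ... | (ι , κ) , refl , C with φ-A C | conn-acts C
    ...   | inj₁ e | si , sk rewrite e =
      (ι , κ) , e , enabled (C , g , ε , vis-from (mu-A Cs) si v , vis-from (mu-A Cs) sk w)
    ...   | inj₂ e | si , sk rewrite e =
      (ι , κ) , e , enabled (C , g , opposite ε , vis-from (mu-A Cs) si w
              , subst (Vis X free (hid ∘ θ) _ κ g) (sym (Sign.opposite-involutive ε)) (vis-from (mu-A Cs) sk v))

    outcome-iso : outcome X ≈ outcome Y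
    outcome-iso = outcome-bijection N M φ φ-inj en-to en-from (λ Cs → st-≈ (mu-A Cs))

  -- Renaming, hiding and scope extrusion.

  act-rename⁺ : ∀ {P ι ρ} → Act P ι → Act (rename ρ P) ι
  act-rename⁺ here     = here
  act-rename⁺ (act a)  = act (act-rename⁺ a)
  act-rename⁺ (◇ a)    = ◇ act-rename⁺ a
  act-rename⁺ (∣ˡ a)   = ∣ˡ (act-rename⁺ a)
  act-rename⁺ (∣ʳ a)   = ∣ʳ (act-rename⁺ a)
  act-rename⁺ (∥ˡ a)   = ∥ˡ (act-rename⁺ a)
  act-rename⁺ (∥ʳ a)   = ∥ʳ (act-rename⁺ a)
  act-rename⁺ (hide a) = hide (act-rename⁺ a)

  act-rename⁻ : ∀ P {ι ρ} → Act (rename ρ P) ι → Act P ι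
  act-rename⁻ (act u ε P) here     = here
  act-rename⁻ (act u ε P) (act a)  = act (act-rename⁻ P a)
  act-rename⁻ (◇ P)       (◇ a)    = ◇ act-rename⁻ P a
  act-rename⁻ (P ∣ Q)     (∣ˡ a)   = ∣ˡ (act-rename⁻ P a)
  act-rename⁻ (P ∣ Q)     (∣ʳ a)   = ∣ʳ (act-rename⁻ Q a)
  act-rename⁻ (P ∥ Q)     (∥ˡ a)   = ∥ˡ (act-rename⁻ P a)
  act-rename⁻ (P ∥ Q)     (∥ʳ a)   = ∥ʳ (act-rename⁻ Q a)
  act-rename⁻ (hide P)    (hide a) = hide (act-rename⁻ P a)

  conn-rename⁺ : ∀ {P l ρ} → Conn P l → Conn (rename ρ P) l
  conn-rename⁺ (act C)  = act (conn-rename⁺ C)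
  conn-rename⁺ (◇ C)    = ◇ conn-rename⁺ C
  conn-rename⁺ (∣ˡ C)   = ∣ˡ (conn-rename⁺ C)
  conn-rename⁺ (∣ʳ C)   = ∣ʳ (conn-rename⁺ C)
  conn-rename⁺ (∥ˡ C)   = ∥ˡ (conn-rename⁺ C)
  conn-rename⁺ (∥ʳ C)   = ∥ʳ (conn-rename⁺ C)
  conn-rename⁺ (hide C) = hide (conn-rename⁺ C)
  conn-rename⁺ (sync a b) = sync (act-rename⁺ a) (act-rename⁺ b)

  conn-rename⁻ : ∀ P {l ρ} → Conn (rename ρ P) l → Conn P l
  conn-rename⁻ (act u ε P) (act C)  = act (conn-rename⁻ P C)
  conn-rename⁻ (◇ P)       (◇ C)    = ◇ conn-rename⁻ P C
  conn-rename⁻ (P ∣ Q)     (∣ˡ C)   = ∣ˡ (conn-rename⁻ P C)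
  conn-rename⁻ (P ∣ Q)     (∣ʳ C)   = ∣ʳ (conn-rename⁻ Q C)
  conn-rename⁻ (P ∥ Q)     (∥ˡ C)   = ∥ˡ (conn-rename⁻ P C)
  conn-rename⁻ (P ∥ Q)     (∥ʳ C)   = ∥ʳ (conn-rename⁻ Q C)
  conn-rename⁻ (hide P)    (hide C) = hide (conn-rename⁻ P C)
  conn-rename⁻ (P ∣ Q)     (sync a b) = sync (act-rename⁻ P a) (act-rename⁻ Q b)

  module _ {A : Set} where

    vis-rename⁺ : ∀ {P h μ ι} {g : A} {ε e e′} ρ → (∀ y → e (ρ y) ≡ e′ y) →
                  Vis P e′ h μ ι g ε → Vis (rename ρ P) e h μ ι g ε
    vis-rename⁺ ρ E (act m p)   = act m (trans p (sym (E _)))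
    vis-rename⁺ ρ E (fired m v) = fired m (vis-rename⁺ (ext ρ) (▸-ext E) v)
    vis-rename⁺ ρ E (◇ v)       = ◇ vis-rename⁺ ρ E v
    vis-rename⁺ ρ E (∣ˡ v)      = ∣ˡ (vis-rename⁺ ρ E v)
    vis-rename⁺ ρ E (∣ʳ v)      = ∣ʳ (vis-rename⁺ ρ E v)
    vis-rename⁺ ρ E (∥ˡ v)      = ∥ˡ (vis-rename⁺ ρ E v)
    vis-rename⁺ ρ E (∥ʳ v)      = ∥ʳ (vis-rename⁺ ρ E v)
    vis-rename⁺ ρ E (hide v)    = hide (vis-rename⁺ (ext ρ) (▸-ext E) v)

    vis-rename⁻ : ∀ P {h μ ι} {g : A} {ε e e′} ρ → (∀ y → e (ρ y) ≡ e′ y) →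
                  Vis (rename ρ P) e h μ ι g ε → Vis P e′ h μ ι g ε
    vis-rename⁻ (act u ε P) ρ E (act m p)   = act m (trans p (E _))
    vis-rename⁻ (act u ε P) ρ E (fired m v) = fired m (vis-rename⁻ P (ext ρ) (▸-ext E) v)
    vis-rename⁻ (◇ P)       ρ E (◇ v)       = ◇ vis-rename⁻ P ρ E v
    vis-rename⁻ (P ∣ Q)     ρ E (∣ˡ v)      = ∣ˡ (vis-rename⁻ P ρ E v)
    vis-rename⁻ (P ∣ Q)     ρ E (∣ʳ v)      = ∣ʳ (vis-rename⁻ Q ρ E v)
    vis-rename⁻ (P ∥ Q)     ρ E (∥ˡ v)      = ∥ˡ (vis-rename⁻ P ρ E v)
    vis-rename⁻ (P ∥ Q)     ρ E (∥ʳ v)      = ∥ʳ (vis-rename⁻ Q ρ E v)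
    vis-rename⁻ (hide P)    ρ E (hide v)    = hide (vis-rename⁻ P (ext ρ) (▸-ext E) v)

    st-rename : ∀ P {ρ} {μ : Position → Maybe A} → st (rename ρ P) μ ≡ st P μ
    st-rename (const k)   = refl
    st-rename (act u ε P) {μ = μ} with μ []
    ... | just _  = st-rename P
    ... | nothing = refl
    st-rename (◇ P)       = st-rename P
    st-rename (P ∣ Q)     = cong₂ _*ᴷ_ (st-rename P) (st-rename Q)
    st-rename (P ∥ Q)     = cong₂ _*ᴷ_ (st-rename P) (st-rename Q)
    st-rename (hide P)    = st-rename P

  -- A `hide` adds nothing to positions, and the name that it binds can serve as the name of the
  -- variable 0, so both terms enable the same labels.
  outcome-hide : ∀ P → outcome (hide P) ≈ outcome P
  outcome-hide P = outcome-same (canonical (hide P)) N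
    (λ { (enabled (hide C , _ , _ , hide v , hide w)) → enabled (C , _ , _ , v , w) })
    (λ { (enabled (C , _ , _ , v , w)) → enabled (hide C , _ , _ , hide v , hide w) })
    (λ _ → 𝕂.refl)
    where
    open Naming (canonical (hide P))
    N : Naming Src P
    N = record { e = hid [] ▸ free ; h = hid ∘ (0 ∷_) ; n = ev
               ; names = names-hide names ; out = out-hide names out }

  free-▸-inj : ∀ {r u v} → (hid r ▸ free) u ≡ (hid r ▸ free) v → u ≡ v
  free-▸-inj {u = zero}  {zero}  _    = refl
  free-▸-inj {u = suc _} {suc _} refl = refl

  -- An outcome has no observer outside, so the hidden name may as well be the free variable 0,
  -- which `↑ P` cannot mention.
  extrudeʳ : ∀ P Q → outcome (P ∣ hide Q) ≈ outcome (↑ P ∣ Q)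
  extrudeʳ P Q = outcome-same (canonical (P ∣ hide Q)) N
    (λ { (enabled (C , _ , _ , v , w)) → enabled (conn⁺ C , _ , _ , vis⁺ v , vis⁺ w) })
    (λ { (enabled (C , _ , _ , v , w)) → enabled (conn⁻ C , _ , _ , vis⁻ v , vis⁻ w) })
    (λ _ → 𝕂.reflexive (cong₂ _*ᴷ_ (sym (st-rename P)) refl))
    where
    h : List ℕ → Src
    -- Binders below the removed `hide` keep the address that they had under it.
    h (2 ∷ r) = hid (2 ∷ 0 ∷ r)
    h r       = hid r
    N : Naming Src (↑ P ∣ Q)
    N = record
      { e = hid (2 ∷ []) ▸ free ; h = h ; n = ev
      ; names = record
        { h-inj = λ { (∣ˡ _) (∣ˡ _) refl → refl ; (∣ˡ _) (∣ʳ _) () ; (∣ʳ _) (∣ˡ _) ()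
                    ; (∣ʳ _) (∣ʳ _) refl → refl }
        ; n-inj = λ { _ _ refl → refl }
        ; h≢n   = λ { (∣ˡ _) _ () ; (∣ʳ _) _ () } }
      ; out = record
        { f-inj = free-▸-inj
        ; f≢h   = λ { {zero} (∣ˡ _) () ; {zero} (∣ʳ _) () ; {suc _} (∣ˡ _) () ; {suc _} (∣ʳ _) () }
        ; f≢n   = λ { {zero} _ _ () ; {suc _} _ _ () } } }
    conn⁺ : ∀ {l} → Conn (P ∣ hide Q) l → Conn (↑ P ∣ Q) l
    conn⁺ (∣ˡ C)        = ∣ˡ (conn-rename⁺ C)
    conn⁺ (∣ʳ (hide C)) = ∣ʳ C
    conn⁺ (sync a (hide b)) = sync (act-rename⁺ a) b
    conn⁻ : ∀ {l} → Conn (↑ P ∣ Q) l → Conn (P ∣ hide Q) l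
    conn⁻ (∣ˡ C) = ∣ˡ (conn-rename⁻ P C)
    conn⁻ (∣ʳ C) = ∣ʳ (hide C)
    conn⁻ (sync a b) = sync (act-rename⁻ P a) (hide b)
    vis⁺ : ∀ {μ α g ε} → Vis (P ∣ hide Q) free hid μ α g ε → Vis (↑ P ∣ Q) (hid (2 ∷ []) ▸ free) h μ α g ε
    vis⁺ (∣ˡ v)        = ∣ˡ (vis-rename⁺ suc (λ _ → refl) v)
    vis⁺ (∣ʳ (hide v)) = ∣ʳ v
    vis⁻ : ∀ {μ α g ε} → Vis (↑ P ∣ Q) (hid (2 ∷ []) ▸ free) h μ α g ε → Vis (P ∣ hide Q) free hid μ α g ε
    vis⁻ (∣ˡ v) = ∣ˡ (vis-rename⁻ P suc (λ _ → refl) v)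
    vis⁻ (∣ʳ v) = ∣ʳ (hide v)

  extrudeˡ : ∀ P Q → outcome (hide P ∣ Q) ≈ outcome (P ∣ ↑ Q)
  extrudeˡ P Q = outcome-same (canonical (hide P ∣ Q)) N
    (λ { (enabled (C , _ , _ , v , w)) → enabled (conn⁺ C , _ , _ , vis⁺ v , vis⁺ w) })
    (λ { (enabled (C , _ , _ , v , w)) → enabled (conn⁻ C , _ , _ , vis⁻ v , vis⁻ w) })
    (λ _ → 𝕂.reflexive (cong₂ _*ᴷ_ refl (sym (st-rename Q))))
    where
    h : List ℕ → Src
    h (1 ∷ r) = hid (1 ∷ 0 ∷ r)
    h r       = hid r
    N : Naming Src (P ∣ ↑ Q)
    N = record
      { e = hid (1 ∷ []) ▸ free ; h = h ; n = ev
      ; names = record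
        { h-inj = λ { (∣ˡ _) (∣ˡ _) refl → refl ; (∣ˡ _) (∣ʳ _) () ; (∣ʳ _) (∣ˡ _) ()
                    ; (∣ʳ _) (∣ʳ _) refl → refl }
        ; n-inj = λ { _ _ refl → refl }
        ; h≢n   = λ { (∣ˡ _) _ () ; (∣ʳ _) _ () } }
      ; out = record
        { f-inj = free-▸-inj
        ; f≢h   = λ { {zero} (∣ˡ _) () ; {zero} (∣ʳ _) () ; {suc _} (∣ˡ _) () ; {suc _} (∣ʳ _) () }
        ; f≢n   = λ { {zero} _ _ () ; {suc _} _ _ () } } }
    conn⁺ : ∀ {l} → Conn (hide P ∣ Q) l → Conn (P ∣ ↑ Q) l
    conn⁺ (∣ˡ (hide C)) = ∣ˡ C
    conn⁺ (∣ʳ C)        = ∣ʳ (conn-rename⁺ C)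
    conn⁺ (sync (hide a) b) = sync a (act-rename⁺ b)
    conn⁻ : ∀ {l} → Conn (P ∣ ↑ Q) l → Conn (hide P ∣ Q) l
    conn⁻ (∣ˡ C) = ∣ˡ (hide C)
    conn⁻ (∣ʳ C) = ∣ʳ (conn-rename⁻ Q C)
    conn⁻ (sync a b) = sync (hide a) (act-rename⁻ Q b)
    vis⁺ : ∀ {μ α g ε} → Vis (hide P ∣ Q) free hid μ α g ε → Vis (P ∣ ↑ Q) (hid (1 ∷ []) ▸ free) h μ α g ε
    vis⁺ (∣ˡ (hide v)) = ∣ˡ v
    vis⁺ (∣ʳ v)        = ∣ʳ (vis-rename⁺ suc (λ _ → refl) v)
    vis⁻ : ∀ {μ α g ε} → Vis (P ∣ ↑ Q) (hid (1 ∷ []) ▸ free) h μ α g ε → Vis (hide P ∣ Q) free hid μ α g ε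
    vis⁻ (∣ˡ v) = ∣ˡ (hide v)
    vis⁻ (∣ʳ v) = ∣ʳ (vis-rename⁻ Q suc (λ _ → refl) v)

  -- The name x of the left-hand side is bound to 0, and the name suc x is
  -- unknown to it; on the right-hand side of unbind it is hidden.

  bound : Name → Name → Name
  bound x zero = suc x
  bound x (suc y) with x ℕ.≟ y
  ... | yes _ = zero
  ... | no _  = suc y

  bind-inj : ∀ x {u v} → bind x u ≡ bind x v → u ≡ v
  bind-inj x {u} {v} e with x ℕ.≟ u | x ℕ.≟ v
  bind-inj x e    | yes refl | yes refl = refl
  bind-inj x refl | no _     | no _     = refl

  bind-≢ : ∀ x {u} → bind x u ≢ suc x
  bind-≢ x {u} e with x ℕ.≟ u
  bind-≢ x refl | no ¬e = ¬e refl

  -- This trades a binding around `P` for a change of the test, so that an equivalence of `P` and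
  -- `Q` can be used below a binder. The test may mention a name `x` of its own, which must stay
  -- distinct from the bound one; hence the `hide`.
  unbind : ∀ x P R → outcome (rename (bind x) P ∣ R) ≈ outcome (P ∣ hide (rename (bound x) R))
  unbind x P R = outcome-same (canonical (rename (bind x) P ∣ R)) N
    (λ { (enabled (C , _ , _ , v , w)) → enabled (conn⁺ C , _ , _ , vis⁺ v , vis⁺ w) })
    (λ { (enabled (C , _ , _ , v , w)) → enabled (conn⁻ C , _ , _ , vis⁻ v , vis⁻ w) })
    (λ _ → 𝕂.reflexive (cong₂ _*ᴷ_ (st-rename P) (sym (st-rename R))))
    where
    e : Name → Src
    e y = free (bind x y)
    h : List ℕ → Src
    h (2 ∷ [])    = free (suc x)
    h (2 ∷ _ ∷ r) = hid (2 ∷ r)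
    h r           = hid r
    N : Naming Src (P ∣ hide (rename (bound x) R))
    N = record
      { e = e ; h = h ; n = ev
      ; names = record
        { h-inj = λ { (∣ˡ _) (∣ˡ _) refl → refl
                    ; (∣ˡ _) (∣ʳ here) () ; (∣ˡ _) (∣ʳ (hide _)) ()
                    ; (∣ʳ here) (∣ˡ _) () ; (∣ʳ (hide _)) (∣ˡ _) ()
                    ; (∣ʳ here) (∣ʳ here) refl → refl
                    ; (∣ʳ here) (∣ʳ (hide _)) () ; (∣ʳ (hide _)) (∣ʳ here) ()
                    ; (∣ʳ (hide _)) (∣ʳ (hide _)) refl → refl }
        ; n-inj = λ { _ _ refl → refl }
        ; h≢n   = λ { (∣ˡ _) _ () ; (∣ʳ here) _ () ; (∣ʳ (hide _)) _ () } }
      ; out = record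
        { f-inj = λ p → bind-inj x (free-inj p)
        ; f≢h   = λ { (∣ˡ _) () ; (∣ʳ here) p → bind-≢ x (free-inj p) ; (∣ʳ (hide _)) () }
        ; f≢n   = λ _ _ () } }
      where
      free-inj : ∀ {u v} → free u ≡ free v → u ≡ v
      free-inj refl = refl
    conn⁺ : ∀ {l} → Conn (rename (bind x) P ∣ R) l → Conn (P ∣ hide (rename (bound x) R)) l
    conn⁺ (∣ˡ C) = ∣ˡ (conn-rename⁻ P C)
    conn⁺ (∣ʳ C) = ∣ʳ (hide (conn-rename⁺ C))
    conn⁺ (sync a b) = sync (act-rename⁻ P a) (hide (act-rename⁺ b))
    conn⁻ : ∀ {l} → Conn (P ∣ hide (rename (bound x) R)) l → Conn (rename (bind x) P ∣ R) l
    conn⁻ (∣ˡ C)        = ∣ˡ (conn-rename⁺ C)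
    conn⁻ (∣ʳ (hide C)) = ∣ʳ (conn-rename⁻ R C)
    conn⁻ (sync a (hide b)) = sync (act-rename⁺ a) (act-rename⁻ R b)
    bound-free : ∀ z → (free (suc x) ▸ e) (bound x z) ≡ free z
    bound-free zero with x ℕ.≟ x
    ... | yes _ = refl
    ... | no ¬e = ⊥-elim (¬e refl)
    bound-free (suc y) with x ℕ.≟ y in eq
    ... | yes refl = refl
    ... | no _ rewrite eq = refl
    vis⁺ : ∀ {μ α g ε} → Vis (rename (bind x) P ∣ R) free hid μ α g ε →
           Vis (P ∣ hide (rename (bound x) R)) e h μ α g ε
    vis⁺ (∣ˡ v) = ∣ˡ (vis-rename⁻ P (bind x) (λ _ → refl) v)
    vis⁺ (∣ʳ v) = ∣ʳ (hide (vis-rename⁺ (bound x) bound-free v))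
    vis⁻ : ∀ {μ α g ε} → Vis (P ∣ hide (rename (bound x) R)) e h μ α g ε →
           Vis (rename (bind x) P ∣ R) free hid μ α g ε
    vis⁻ (∣ˡ v)        = ∣ˡ (vis-rename⁺ (bind x) (λ _ → refl) v)
    vis⁻ (∣ʳ (hide v)) = ∣ʳ (vis-rename⁻ R (bound x) bound-free v)

  ≃-ν : ∀ {P Q} x → P ≃ Q → ν x P ≃ ν x Q
  ≃-ν {P} {Q} x E R = 𝕂.trans (test P) (𝕂.trans (E _) (𝕂.sym (test Q)))
    where
    test : ∀ P → outcome (ν x P ∣ R) ≈ outcome (P ∣ hide (rename (bound x) (↑ R)))
    test P = 𝕂.trans (extrudeˡ (rename (bind x) P) R) (unbind x P (↑ R))

  -- Rearranging contexts: `◇`, `∣` and the symmetry of `∥`.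

  iso-◇ : ∀ P R → Iso (◇ P ∣ R) (P ∣ R)
  iso-◇ P R = record
    { φ = λ (ι , κ) → A ι , A κ ; A = A ; θ = θ
    ; φ⁻ = λ (ι , κ) → A⁻ ι , A⁻ κ ; A⁻ = A⁻ ; θ⁻ = θ⁻
    ; A-left = A-left ; φ-A = λ _ → inj₁ refl
    ; φ-left = λ C → cong₂ _,_ (A-left (proj₁ (conn-acts C))) (A-left (proj₂ (conn-acts C)))
    ; conn-to   = λ { (∣ˡ (◇ C)) → ∣ˡ C ; (∣ʳ C) → ∣ʳ C ; (sync (◇ a) b) → sync a b }
    ; conn-from = λ { (∣ˡ C) → _ , refl , ∣ˡ (◇ C) ; (∣ʳ C) → _ , refl , ∣ʳ C
                    ; (sync a b) → _ , refl , sync (◇ a) b }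
    ; hid-to    = λ { (∣ˡ (◇ H)) → ∣ˡ H ; (∣ʳ H) → ∣ʳ H }
    ; θ-left    = λ { (∣ˡ (◇ _)) → refl ; (∣ʳ _) → refl }
    ; vis-to    = λ { E _ (∣ˡ (◇ v)) → ∣ˡ (vis-acts (λ a → E (∣ˡ (◇ a))) v)
                    ; E _ (∣ʳ v) → ∣ʳ (vis-acts (λ a → E (∣ʳ a)) v) }
    ; vis-from  = λ { E (∣ˡ (◇ _)) (∣ˡ v) → ∣ˡ (◇ vis-acts (λ a → sym (E (∣ˡ (◇ a)))) v)
                    ; E (∣ʳ _) (∣ʳ v) → ∣ʳ (vis-acts (λ a → sym (E (∣ʳ a))) v) }
    ; st-≈      = λ E → 𝕂.*-cong (𝕂.reflexive (st-acts P (λ a → E (∣ˡ (◇ a)))))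
                                 (𝕂.reflexive (st-acts R (λ a → E (∣ʳ a))))
    }
    where
    A : Position → Position
    A (+ 1 ∷ + 1 ∷ ι) = + 1 ∷ ι
    A ι               = ι
    A⁻ : Position → Position
    A⁻ (+ 1 ∷ ι) = + 1 ∷ + 1 ∷ ι
    A⁻ ι         = ι
    θ : List ℕ → List ℕ
    θ (1 ∷ 1 ∷ r) = 1 ∷ r
    θ r           = r
    θ⁻ : List ℕ → List ℕ
    θ⁻ (1 ∷ r) = 1 ∷ 1 ∷ r
    θ⁻ r       = r
    A-left : ∀ {α} → Act (◇ P ∣ R) α → A⁻ (A α) ≡ α
    A-left (∣ˡ (◇ _)) = refl
    A-left (∣ʳ _) = refl

  iso-∣-assoc : ∀ P R S → Iso ((P ∣ R) ∣ S) (P ∣ (R ∣ S))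
  iso-∣-assoc P R S = record
    { φ = λ (ι , κ) → A ι , A κ ; A = A ; θ = θ
    ; φ⁻ = λ (ι , κ) → A⁻ ι , A⁻ κ ; A⁻ = A⁻ ; θ⁻ = θ⁻
    ; A-left = A-left ; φ-A = λ _ → inj₁ refl
    ; φ-left = λ C → cong₂ _,_ (A-left (proj₁ (conn-acts C))) (A-left (proj₂ (conn-acts C)))
    ; conn-to   = λ { (∣ˡ (∣ˡ C)) → ∣ˡ C ; (∣ˡ (∣ʳ C)) → ∣ʳ (∣ˡ C) ; (∣ʳ C) → ∣ʳ (∣ʳ C)
                    ; (∣ˡ (sync a b)) → sync a (∣ˡ b) ; (sync (∣ˡ a) b) → sync a (∣ʳ b)
                    ; (sync (∣ʳ a) b) → ∣ʳ (sync a b) }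
    ; conn-from = λ { (∣ˡ C) → _ , refl , ∣ˡ (∣ˡ C) ; (∣ʳ (∣ˡ C)) → _ , refl , ∣ˡ (∣ʳ C)
                    ; (∣ʳ (∣ʳ C)) → _ , refl , ∣ʳ C
                    ; (sync a (∣ˡ b)) → (_ ∷ _ ∷ _ , _ ∷ _ ∷ _) , refl , ∣ˡ (sync a b)
                    ; (sync a (∣ʳ b)) → _ , refl , sync (∣ˡ a) b
                    ; (∣ʳ (sync a b)) → _ , refl , sync (∣ʳ a) b }
    ; hid-to    = λ { (∣ˡ (∣ˡ H)) → ∣ˡ H ; (∣ˡ (∣ʳ H)) → ∣ʳ (∣ˡ H) ; (∣ʳ H) → ∣ʳ (∣ʳ H) }
    ; θ-left    = θ-left
    ; vis-to    = λ { E _ (∣ˡ (∣ˡ v)) → ∣ˡ (vis-acts (λ a → E (∣ˡ (∣ˡ a))) v)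
                    ; E _ (∣ˡ (∣ʳ v)) → ∣ʳ (∣ˡ (vis-acts (λ a → E (∣ˡ (∣ʳ a))) v))
                    ; E _ (∣ʳ v) → ∣ʳ (∣ʳ (vis-acts (λ a → E (∣ʳ a)) v)) }
    ; vis-from  = λ { E (∣ˡ (∣ˡ _)) (∣ˡ v) → ∣ˡ (∣ˡ (vis-acts (λ a → sym (E (∣ˡ (∣ˡ a)))) v))
                    ; E (∣ˡ (∣ʳ _)) (∣ʳ (∣ˡ v)) → ∣ˡ (∣ʳ (vis-acts (λ a → sym (E (∣ˡ (∣ʳ a)))) v))
                    ; E (∣ʳ _) (∣ʳ (∣ʳ v)) → ∣ʳ (vis-acts (λ a → sym (E (∣ʳ a))) v) }
    ; st-≈      = λ E → 𝕂.trans (𝕂.*-assoc _ _ _)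
        (𝕂.*-cong (𝕂.reflexive (st-acts P (λ a → E (∣ˡ (∣ˡ a)))))
        (𝕂.*-cong (𝕂.reflexive (st-acts R (λ a → E (∣ˡ (∣ʳ a))))) (𝕂.reflexive (st-acts S (λ a → E (∣ʳ a))))))
    }
    where
    A : Position → Position
    A (+ 1 ∷ + 1 ∷ ι) = + 1 ∷ ι
    A (+ 1 ∷ + 2 ∷ ι) = + 2 ∷ + 1 ∷ ι
    A (+ 2 ∷ ι)       = + 2 ∷ + 2 ∷ ι
    A ι               = ι
    A⁻ : Position → Position
    A⁻ (+ 1 ∷ ι)       = + 1 ∷ + 1 ∷ ι
    A⁻ (+ 2 ∷ + 1 ∷ ι) = + 1 ∷ + 2 ∷ ι
    A⁻ (+ 2 ∷ + 2 ∷ ι) = + 2 ∷ ι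
    A⁻ ι               = ι
    θ : List ℕ → List ℕ
    θ (1 ∷ 1 ∷ r) = 1 ∷ r
    θ (1 ∷ 2 ∷ r) = 2 ∷ 1 ∷ r
    θ (2 ∷ r)     = 2 ∷ 2 ∷ r
    θ r           = r
    θ⁻ : List ℕ → List ℕ
    θ⁻ (1 ∷ r)     = 1 ∷ 1 ∷ r
    θ⁻ (2 ∷ 1 ∷ r) = 1 ∷ 2 ∷ r
    θ⁻ (2 ∷ 2 ∷ r) = 2 ∷ r
    θ⁻ r           = r
    A-left : ∀ {α} → Act ((P ∣ R) ∣ S) α → A⁻ (A α) ≡ α
    A-left (∣ˡ (∣ˡ _)) = refl
    A-left (∣ˡ (∣ʳ _)) = refl
    A-left (∣ʳ _) = refl
    θ-left : ∀ {r} → Hid ((P ∣ R) ∣ S) r → θ⁻ (θ r) ≡ r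
    θ-left (∣ˡ (∣ˡ _)) = refl
    θ-left (∣ˡ (∣ʳ _)) = refl
    θ-left (∣ʳ _) = refl

  iso-∣-swap : ∀ R P S → Iso ((R ∣ P) ∣ S) (P ∣ (R ∣ S))
  iso-∣-swap R P S = record
    { φ = φ ; A = A ; θ = θ ; φ⁻ = φ⁻ ; A⁻ = A⁻ ; θ⁻ = θ⁻
    ; A-left = A-left ; φ-A = φ-A ; φ-left = φ-left
    ; conn-to   = λ { (∣ˡ (∣ˡ C)) → ∣ʳ (∣ˡ C) ; (∣ˡ (∣ʳ C)) → ∣ˡ C ; (∣ʳ C) → ∣ʳ (∣ʳ C)
                    ; (∣ˡ (sync a b)) → sync b (∣ˡ a) ; (sync (∣ʳ a) b) → sync a (∣ʳ b)
                    ; (sync (∣ˡ a) b) → ∣ʳ (sync a b) }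
    ; conn-from = λ { (∣ʳ (∣ˡ C)) → _ , refl , ∣ˡ (∣ˡ C) ; (∣ˡ C) → _ , refl , ∣ˡ (∣ʳ C)
                    ; (∣ʳ (∣ʳ C)) → _ , refl , ∣ʳ C
                    ; (sync a (∣ˡ b)) → (_ ∷ _ ∷ _ , _ ∷ _ ∷ _) , refl , ∣ˡ (sync b a)
                    ; (sync a (∣ʳ b)) → _ , refl , sync (∣ʳ a) b
                    ; (∣ʳ (sync a b)) → _ , refl , sync (∣ˡ a) b }
    ; hid-to    = λ { (∣ˡ (∣ˡ H)) → ∣ʳ (∣ˡ H) ; (∣ˡ (∣ʳ H)) → ∣ˡ H ; (∣ʳ H) → ∣ʳ (∣ʳ H) }
    ; θ-left    = θ-left
    ; vis-to    = λ { E _ (∣ˡ (∣ˡ v)) → ∣ʳ (∣ˡ (vis-acts (λ a → E (∣ˡ (∣ˡ a))) v))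
                    ; E _ (∣ˡ (∣ʳ v)) → ∣ˡ (vis-acts (λ a → E (∣ˡ (∣ʳ a))) v)
                    ; E _ (∣ʳ v) → ∣ʳ (∣ʳ (vis-acts (λ a → E (∣ʳ a)) v)) }
    ; vis-from  = λ { E (∣ˡ (∣ʳ _)) (∣ˡ v) → ∣ˡ (∣ʳ (vis-acts (λ a → sym (E (∣ˡ (∣ʳ a)))) v))
                    ; E (∣ˡ (∣ˡ _)) (∣ʳ (∣ˡ v)) → ∣ˡ (∣ˡ (vis-acts (λ a → sym (E (∣ˡ (∣ˡ a)))) v))
                    ; E (∣ʳ _) (∣ʳ (∣ʳ v)) → ∣ʳ (vis-acts (λ a → sym (E (∣ʳ a))) v) }
    ; st-≈      = λ E → 𝕂.trans (𝕂.*-congʳ (𝕂.*-comm _ _)) (𝕂.trans (𝕂.*-assoc _ _ _)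
        (𝕂.*-cong (𝕂.reflexive (st-acts P (λ a → E (∣ˡ (∣ʳ a)))))
        (𝕂.*-cong (𝕂.reflexive (st-acts R (λ a → E (∣ˡ (∣ˡ a))))) (𝕂.reflexive (st-acts S (λ a → E (∣ʳ a)))))))
    }
    where
    A : Position → Position
    A (+ 1 ∷ + 1 ∷ ι) = + 2 ∷ + 1 ∷ ι
    A (+ 1 ∷ + 2 ∷ ι) = + 1 ∷ ι
    A (+ 2 ∷ ι)       = + 2 ∷ + 2 ∷ ι
    A ι               = ι
    φ : Label → Label
    -- A synchronisation of `R` with `P`: since `P` moves to the left of `R`, its label is reversed.
    φ (+ 1 ∷ + 1 ∷ ι , + 1 ∷ + 2 ∷ κ) = + 1 ∷ κ , + 2 ∷ + 1 ∷ ι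
    φ (ι , κ)                         = A ι , A κ
    A⁻ : Position → Position
    A⁻ (+ 1 ∷ ι)       = + 1 ∷ + 2 ∷ ι
    A⁻ (+ 2 ∷ + 1 ∷ ι) = + 1 ∷ + 1 ∷ ι
    A⁻ (+ 2 ∷ + 2 ∷ ι) = + 2 ∷ ι
    A⁻ ι               = ι
    φ⁻ : Label → Label
    φ⁻ (+ 1 ∷ κ , + 2 ∷ + 1 ∷ ι) = + 1 ∷ + 1 ∷ ι , + 1 ∷ + 2 ∷ κ
    φ⁻ (ι , κ)                   = A⁻ ι , A⁻ κ
    θ : List ℕ → List ℕ
    θ (1 ∷ 1 ∷ r) = 2 ∷ 1 ∷ r
    θ (1 ∷ 2 ∷ r) = 1 ∷ r
    θ (2 ∷ r)     = 2 ∷ 2 ∷ r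
    θ r           = r
    θ⁻ : List ℕ → List ℕ
    θ⁻ (1 ∷ r)     = 1 ∷ 2 ∷ r
    θ⁻ (2 ∷ 1 ∷ r) = 1 ∷ 1 ∷ r
    θ⁻ (2 ∷ 2 ∷ r) = 2 ∷ r
    θ⁻ r           = r
    A-left : ∀ {α} → Act ((R ∣ P) ∣ S) α → A⁻ (A α) ≡ α
    A-left (∣ˡ (∣ˡ _)) = refl
    A-left (∣ˡ (∣ʳ _)) = refl
    A-left (∣ʳ _) = refl
    φ-A : ∀ {ι κ} → Conn ((R ∣ P) ∣ S) (ι , κ) → φ (ι , κ) ≡ (A ι , A κ) ⊎ φ (ι , κ) ≡ (A κ , A ι)
    φ-A (∣ˡ (∣ˡ C))      = inj₁ refl
    φ-A (∣ˡ (∣ʳ C))      = inj₁ refl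
    φ-A (∣ˡ (sync _ _))  = inj₂ refl
    φ-A (∣ʳ C)           = inj₁ refl
    φ-A (sync (∣ˡ _) _)  = inj₁ refl
    φ-A (sync (∣ʳ _) _)  = inj₁ refl
    φ-left : ∀ {l} → Conn ((R ∣ P) ∣ S) l → φ⁻ (φ l) ≡ l
    φ-left (∣ˡ (∣ˡ _)) = refl
    φ-left (∣ˡ (∣ʳ _)) = refl
    φ-left (∣ˡ (sync _ _)) = refl
    φ-left (∣ʳ _) = refl
    φ-left (sync (∣ˡ _) _) = refl
    φ-left (sync (∣ʳ _) _) = refl
    θ-left : ∀ {r} → Hid ((R ∣ P) ∣ S) r → θ⁻ (θ r) ≡ r
    θ-left (∣ˡ (∣ˡ _)) = refl
    θ-left (∣ˡ (∣ʳ _)) = refl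
    θ-left (∣ʳ _) = refl

  iso-∥-swap : ∀ R P S → Iso ((R ∥ P) ∣ S) ((P ∥ R) ∣ S)
  iso-∥-swap R P S = record
    { φ = λ (ι , κ) → A ι , A κ ; A = A ; θ = θ
    ; φ⁻ = λ (ι , κ) → A ι , A κ ; A⁻ = A ; θ⁻ = θ
    ; A-left = A-left ; φ-A = λ _ → inj₁ refl
    ; φ-left = λ C → cong₂ _,_ (A-left (proj₁ (conn-acts C))) (A-left (proj₂ (conn-acts C)))
    ; conn-to   = λ { (∣ˡ (∥ˡ C)) → ∣ˡ (∥ʳ C) ; (∣ˡ (∥ʳ C)) → ∣ˡ (∥ˡ C) ; (∣ʳ C) → ∣ʳ C
                    ; (sync (∥ˡ a) b) → sync (∥ʳ a) b ; (sync (∥ʳ a) b) → sync (∥ˡ a) b }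
    ; conn-from = λ { (∣ˡ (∥ˡ C)) → _ , refl , ∣ˡ (∥ʳ C) ; (∣ˡ (∥ʳ C)) → _ , refl , ∣ˡ (∥ˡ C)
                    ; (∣ʳ C) → _ , refl , ∣ʳ C
                    ; (sync (∥ˡ a) b) → _ , refl , sync (∥ʳ a) b
                    ; (sync (∥ʳ a) b) → _ , refl , sync (∥ˡ a) b }
    ; hid-to    = λ { (∣ˡ (∥ˡ H)) → ∣ˡ (∥ʳ H) ; (∣ˡ (∥ʳ H)) → ∣ˡ (∥ˡ H) ; (∣ʳ H) → ∣ʳ H }
    ; θ-left    = θ-left
    ; vis-to    = λ { E _ (∣ˡ (∥ˡ v)) → ∣ˡ (∥ʳ (vis-acts (λ a → E (∣ˡ (∥ˡ a))) v))
                    ; E _ (∣ˡ (∥ʳ v)) → ∣ˡ (∥ˡ (vis-acts (λ a → E (∣ˡ (∥ʳ a))) v))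
                    ; E _ (∣ʳ v) → ∣ʳ (vis-acts (λ a → E (∣ʳ a)) v) }
    ; vis-from  = λ { E (∣ˡ (∥ʳ _)) (∣ˡ (∥ˡ v)) → ∣ˡ (∥ʳ (vis-acts (λ a → sym (E (∣ˡ (∥ʳ a)))) v))
                    ; E (∣ˡ (∥ˡ _)) (∣ˡ (∥ʳ v)) → ∣ˡ (∥ˡ (vis-acts (λ a → sym (E (∣ˡ (∥ˡ a)))) v))
                    ; E (∣ʳ _) (∣ʳ v) → ∣ʳ (vis-acts (λ a → sym (E (∣ʳ a))) v) }
    ; st-≈      = λ E → 𝕂.*-cong
        (𝕂.trans (𝕂.*-comm _ _) (𝕂.*-cong (𝕂.reflexive (st-acts P (λ a → E (∣ˡ (∥ʳ a)))))
                                          (𝕂.reflexive (st-acts R (λ a → E (∣ˡ (∥ˡ a)))))))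
        (𝕂.reflexive (st-acts S (λ a → E (∣ʳ a))))
    }
    where
    A : Position → Position
    A (+ 1 ∷ + 1 ∷ ι) = + 1 ∷ + 2 ∷ ι
    A (+ 1 ∷ + 2 ∷ ι) = + 1 ∷ + 1 ∷ ι
    A ι               = ι
    θ : List ℕ → List ℕ
    θ (1 ∷ 1 ∷ r) = 1 ∷ 2 ∷ r
    θ (1 ∷ 2 ∷ r) = 1 ∷ 1 ∷ r
    θ r           = r
    A-left : ∀ {α} → Act ((R ∥ P) ∣ S) α → A (A α) ≡ α
    A-left (∣ˡ (∥ˡ _)) = refl
    A-left (∣ˡ (∥ʳ _)) = refl
    A-left (∣ʳ _) = refl
    θ-left : ∀ {r} → Hid ((R ∥ P) ∣ S) r → θ (θ r) ≡ r
    θ-left (∣ˡ (∥ˡ _)) = refl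
    θ-left (∣ˡ (∥ʳ _)) = refl
    θ-left (∣ʳ _) = refl

  ≃-◇ : ∀ {P Q} → P ≃ Q → ◇ P ≃ ◇ Q
  ≃-◇ {P} {Q} E R =
    𝕂.trans (outcome-iso (iso-◇ P R)) (𝕂.trans (E R) (𝕂.sym (outcome-iso (iso-◇ Q R))))

  ≃-∣ˡ : ∀ {P Q} → P ≃ Q → ∀ R → P ∣ R ≃ Q ∣ R
  ≃-∣ˡ {P} {Q} E R S = 𝕂.trans (outcome-iso (iso-∣-assoc P R S))
    (𝕂.trans (E (R ∣ S)) (𝕂.sym (outcome-iso (iso-∣-assoc Q R S))))

  ≃-∣ʳ : ∀ {P Q} → P ≃ Q → ∀ R → R ∣ P ≃ R ∣ Q
  ≃-∣ʳ {P} {Q} E R S = 𝕂.trans (outcome-iso (iso-∣-swap R P S))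
    (𝕂.trans (E (R ∣ S)) (𝕂.sym (outcome-iso (iso-∣-swap R Q S))))

  -- Structural equality implies observational equivalence.

  vis-names : ∀ {X e e′ h h′ μ ι} {g : Src} {ε} → (∀ y → e y ≡ e′ y) → (∀ r → h r ≡ h′ r) →
              Vis X e h μ ι g ε → Vis X e′ h′ μ ι g ε
  vis-names E H (act m p)   = act m (trans p (E _))
  vis-names E H (fired m v) = fired m (vis-names (λ { zero → refl ; (suc y) → E y }) (H ∘ (1 ∷_)) v)
  vis-names E H (◇ v)       = ◇ vis-names E (H ∘ (1 ∷_)) v
  vis-names E H (∣ˡ v)      = ∣ˡ (vis-names E (H ∘ (1 ∷_)) v)
  vis-names E H (∣ʳ v)      = ∣ʳ (vis-names E (H ∘ (2 ∷_)) v)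
  vis-names E H (∥ˡ v)      = ∥ˡ (vis-names E (H ∘ (1 ∷_)) v)
  vis-names E H (∥ʳ v)      = ∥ʳ (vis-names E (H ∘ (2 ∷_)) v)
  vis-names E H (hide v)    = hide (vis-names (λ { zero → H [] ; (suc y) → E y }) (H ∘ (0 ∷_)) v)

  -- Structurally equal terms have the same actions at the same addresses, up
  -- to a permutation of the addresses of their hidden names.

  record Sim (P Q : Term) : Set (c ⊔ ℓ) where
    field
      τ τ⁻   : List ℕ → List ℕ
      left   : ∀ r → τ⁻ (τ r) ≡ r
      right  : ∀ r → τ (τ⁻ r) ≡ r
      acts⇒  : ∀ {ι} → Act P ι → Act Q ι
      acts⇐  : ∀ {ι} → Act Q ι → Act P ι
      conn⇒  : ∀ {l} → Conn P l → Conn Q l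
      conn⇐  : ∀ {l} → Conn Q l → Conn P l
      vis⇒   : ∀ {e h μ ι g ε} → Vis {Src} P e h μ ι g ε → Vis Q e (h ∘ τ) μ ι g ε
      vis⇐   : ∀ {e h μ ι g ε} → Vis {Src} Q e (h ∘ τ) μ ι g ε → Vis P e h μ ι g ε
      st-≈   : ∀ μ → st {Src} P μ ≈ st Q μ

  open Sim

  sim-refl : ∀ {P} → Sim P P
  sim-refl = record
    { τ = id ; τ⁻ = id ; left = λ _ → refl ; right = λ _ → refl
    ; acts⇒ = id ; acts⇐ = id ; conn⇒ = id ; conn⇐ = id ; vis⇒ = id ; vis⇐ = id
    ; st-≈ = λ _ → 𝕂.refl }

  sim-sym : ∀ {P Q} → Sim P Q → Sim Q P
  sim-sym S = record
    { τ = τ⁻ S ; τ⁻ = τ S ; left = right S ; right = left S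
    ; acts⇒ = acts⇐ S ; acts⇐ = acts⇒ S ; conn⇒ = conn⇐ S ; conn⇐ = conn⇒ S
    ; vis⇒ = λ {e} {h} v → vis⇐ S (vis-names (λ _ → refl) (λ r → cong h (sym (left S r))) v)
    ; vis⇐ = λ {e} {h} v → vis-names (λ _ → refl) (λ r → cong h (left S r)) (vis⇒ S v)
    ; st-≈ = λ μ → 𝕂.sym (st-≈ S μ) }

  sim-trans : ∀ {P Q R} → Sim P Q → Sim Q R → Sim P R
  sim-trans S T = record
    { τ = τ S ∘ τ T ; τ⁻ = τ⁻ T ∘ τ⁻ S
    ; left = λ r → trans (cong (τ⁻ T) (left S (τ T r))) (left T r)
    ; right = λ r → trans (cong (τ S) (right T (τ⁻ S r))) (right S r)
    ; acts⇒ = acts⇒ T ∘ acts⇒ S ; acts⇐ = acts⇐ S ∘ acts⇐ T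
    ; conn⇒ = conn⇒ T ∘ conn⇒ S ; conn⇐ = conn⇐ S ∘ conn⇐ T
    ; vis⇒ = λ v → vis⇒ T (vis⇒ S v) ; vis⇐ = λ v → vis⇐ S (vis⇐ T v)
    ; st-≈ = λ μ → 𝕂.trans (st-≈ S μ) (st-≈ T μ) }

  at : ℕ → (List ℕ → List ℕ) → List ℕ → List ℕ
  at i f []      = []
  at i f (j ∷ r) with j ℕ.≟ i
  ... | yes _ = j ∷ f r
  ... | no _  = j ∷ r

  at-inverse : ∀ i {f g} → (∀ r → g (f r) ≡ r) → ∀ r → at i g (at i f r) ≡ r
  at-inverse i E []      = refl
  at-inverse i E (j ∷ r) with j ℕ.≟ i in eq
  ... | yes _ rewrite eq = cong (j ∷_) (E r)
  ... | no _  rewrite eq = refl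

  sim-hide : ∀ {P Q} → Sim P Q → Sim (hide P) (hide Q)
  sim-hide S = record
    { τ = at 0 (τ S) ; τ⁻ = at 0 (τ⁻ S)
    ; left = at-inverse 0 (left S) ; right = at-inverse 0 (right S)
    ; acts⇒ = λ { (hide a) → hide (acts⇒ S a) } ; acts⇐ = λ { (hide a) → hide (acts⇐ S a) }
    ; conn⇒ = λ { (hide C) → hide (conn⇒ S C) } ; conn⇐ = λ { (hide C) → hide (conn⇐ S C) }
    ; vis⇒ = λ { (hide v) → hide (vis⇒ S v) } ; vis⇐ = λ { (hide v) → hide (vis⇐ S v) }
    ; st-≈ = st-≈ S }

  sim-◇ : ∀ {P Q} → Sim P Q → Sim (◇ P) (◇ Q)
  sim-◇ S = record
    { τ = at 1 (τ S) ; τ⁻ = at 1 (τ⁻ S)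
    ; left = at-inverse 1 (left S) ; right = at-inverse 1 (right S)
    ; acts⇒ = λ { (◇ a) → ◇ acts⇒ S a } ; acts⇐ = λ { (◇ a) → ◇ acts⇐ S a }
    ; conn⇒ = λ { (◇ C) → ◇ conn⇒ S C } ; conn⇐ = λ { (◇ C) → ◇ conn⇐ S C }
    ; vis⇒ = λ { (◇ v) → ◇ vis⇒ S v } ; vis⇐ = λ { (◇ v) → ◇ vis⇐ S v }
    ; st-≈ = λ μ → st-≈ S _ }

  sim-act : ∀ {u ε P Q} → Sim P Q → Sim (act u ε P) (act u ε Q)
  sim-act {u} {ε} {P} {Q} S = record
    { τ = at 1 (τ S) ; τ⁻ = at 1 (τ⁻ S)
    ; left = at-inverse 1 (left S) ; right = at-inverse 1 (right S)
    ; acts⇒ = λ { here → here ; (act a) → act (acts⇒ S a) }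
    ; acts⇐ = λ { here → here ; (act a) → act (acts⇐ S a) }
    ; conn⇒ = λ { (act C) → act (conn⇒ S C) } ; conn⇐ = λ { (act C) → act (conn⇐ S C) }
    ; vis⇒ = λ { (act m p) → act m p ; (fired m v) → fired m (vis⇒ S v) }
    ; vis⇐ = λ { (act m p) → act m p ; (fired m v) → fired m (vis⇐ S v) }
    ; st-≈ = st-act }
    where
    st-act : ∀ μ → st {Src} (act u ε P) μ ≈ st (act u ε Q) μ
    st-act μ with μ []
    ... | just _  = st-≈ S _
    ... | nothing = 𝕂.refl

  sim-∣ : ∀ {P P′ Q Q′} → Sim P P′ → Sim Q Q′ → Sim (P ∣ Q) (P′ ∣ Q′)
  sim-∣ S T = record
    { τ = at 1 (τ S) ∘ at 2 (τ T) ; τ⁻ = at 2 (τ⁻ T) ∘ at 1 (τ⁻ S)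
    ; left  = λ r → trans (cong (at 2 (τ⁻ T)) (at-inverse 1 (left S) (at 2 (τ T) r)))
                          (at-inverse 2 (left T) r)
    ; right = λ r → trans (cong (at 1 (τ S)) (at-inverse 2 (right T) (at 1 (τ⁻ S) r)))
                          (at-inverse 1 (right S) r)
    ; acts⇒ = λ { (∣ˡ a) → ∣ˡ (acts⇒ S a) ; (∣ʳ a) → ∣ʳ (acts⇒ T a) }
    ; acts⇐ = λ { (∣ˡ a) → ∣ˡ (acts⇐ S a) ; (∣ʳ a) → ∣ʳ (acts⇐ T a) }
    ; conn⇒ = λ { (∣ˡ C) → ∣ˡ (conn⇒ S C) ; (∣ʳ C) → ∣ʳ (conn⇒ T C)
                ; (sync a b) → sync (acts⇒ S a) (acts⇒ T b) }
    ; conn⇐ = λ { (∣ˡ C) → ∣ˡ (conn⇐ S C) ; (∣ʳ C) → ∣ʳ (conn⇐ T C)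
                ; (sync a b) → sync (acts⇐ S a) (acts⇐ T b) }
    ; vis⇒ = λ { (∣ˡ v) → ∣ˡ (vis⇒ S v) ; (∣ʳ v) → ∣ʳ (vis⇒ T v) }
    ; vis⇐ = λ { (∣ˡ v) → ∣ˡ (vis⇐ S v) ; (∣ʳ v) → ∣ʳ (vis⇐ T v) }
    ; st-≈ = λ μ → 𝕂.*-cong (st-≈ S _) (st-≈ T _) }

  sim-∥ : ∀ {P P′ Q Q′} → Sim P P′ → Sim Q Q′ → Sim (P ∥ Q) (P′ ∥ Q′)
  sim-∥ S T = record
    { τ = at 1 (τ S) ∘ at 2 (τ T) ; τ⁻ = at 2 (τ⁻ T) ∘ at 1 (τ⁻ S)
    ; left  = λ r → trans (cong (at 2 (τ⁻ T)) (at-inverse 1 (left S) (at 2 (τ T) r)))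
                          (at-inverse 2 (left T) r)
    ; right = λ r → trans (cong (at 1 (τ S)) (at-inverse 2 (right T) (at 1 (τ⁻ S) r)))
                          (at-inverse 1 (right S) r)
    ; acts⇒ = λ { (∥ˡ a) → ∥ˡ (acts⇒ S a) ; (∥ʳ a) → ∥ʳ (acts⇒ T a) }
    ; acts⇐ = λ { (∥ˡ a) → ∥ˡ (acts⇐ S a) ; (∥ʳ a) → ∥ʳ (acts⇐ T a) }
    ; conn⇒ = λ { (∥ˡ C) → ∥ˡ (conn⇒ S C) ; (∥ʳ C) → ∥ʳ (conn⇒ T C) }
    ; conn⇐ = λ { (∥ˡ C) → ∥ˡ (conn⇐ S C) ; (∥ʳ C) → ∥ʳ (conn⇐ T C) }
    ; vis⇒ = λ { (∥ˡ v) → ∥ˡ (vis⇒ S v) ; (∥ʳ v) → ∥ʳ (vis⇒ T v) }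
    ; vis⇐ = λ { (∥ˡ v) → ∥ˡ (vis⇐ S v) ; (∥ʳ v) → ∥ʳ (vis⇐ T v) }
    ; st-≈ = λ μ → 𝕂.*-cong (st-≈ S _) (st-≈ T _) }

  sim-hide-hide : ∀ P → Sim (hide (hide P)) (hide (hide (rename swap P)))
  sim-hide-hide P = record
    { τ = flip ; τ⁻ = flip ; left = flip-flip ; right = flip-flip
    ; acts⇒ = λ { (hide (hide a)) → hide (hide (act-rename⁺ a)) }
    ; acts⇐ = λ { (hide (hide a)) → hide (hide (act-rename⁻ P a)) }
    ; conn⇒ = λ { (hide (hide C)) → hide (hide (conn-rename⁺ C)) }
    ; conn⇐ = λ { (hide (hide C)) → hide (hide (conn-rename⁻ P C)) }
    ; vis⇒ = λ { (hide (hide v)) → hide (hide (vis-rename⁺ swap swap-▸ v)) }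
    ; vis⇐ = λ { (hide (hide v)) → hide (hide (vis-rename⁻ P swap swap-▸ v)) }
    ; st-≈ = λ μ → 𝕂.reflexive (sym (st-rename P)) }
    where
    flip : List ℕ → List ℕ
    -- The outer of the two binders has the address `[]` and the inner one `0 ∷ []`; everything
    -- below them is left in place.
    flip []       = 0 ∷ []
    flip (0 ∷ []) = []
    flip r        = r
    flip-flip : ∀ r → flip (flip r) ≡ r
    flip-flip []              = refl
    flip-flip (zero ∷ [])     = refl
    flip-flip (zero ∷ _ ∷ _)  = refl
    flip-flip (suc _ ∷ _)     = refl

  ≋⇒sim : ∀ {P Q} → P ≋ Q → Sim P Q
  ≋⇒sim hide-hide      = sim-hide-hide _
  ≋⇒sim ≋-refl         = sim-refl
  ≋⇒sim (≋-sym e)      = sim-sym (≋⇒sim e)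
  ≋⇒sim (≋-trans e f)  = sim-trans (≋⇒sim e) (≋⇒sim f)
  ≋⇒sim (const-cong k) = record
    { τ = id ; τ⁻ = id ; left = λ _ → refl ; right = λ _ → refl
    ; acts⇒ = λ () ; acts⇐ = λ () ; conn⇒ = λ () ; conn⇐ = λ () ; vis⇒ = λ () ; vis⇐ = λ ()
    ; st-≈ = λ _ → k }
  ≋⇒sim (act-cong e)   = sim-act (≋⇒sim e)
  ≋⇒sim (◇-cong e)     = sim-◇ (≋⇒sim e)
  ≋⇒sim (∣-cong e f)   = sim-∣ (≋⇒sim e) (≋⇒sim f)
  ≋⇒sim (∥-cong e f)   = sim-∥ (≋⇒sim e) (≋⇒sim f)
  ≋⇒sim (hide-cong e)  = sim-hide (≋⇒sim e)

  sim⇒outcome : ∀ {X Y} → Sim X Y → outcome X ≈ outcome Y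
  sim⇒outcome {X} {Y} S = outcome-same (canonical X) N
    (λ { (enabled (C , _ , _ , v , w)) → enabled (conn⇒ S C , _ , _ , vis⇒ S v , vis⇒ S w) })
    (λ { (enabled (C , _ , _ , v , w)) → enabled (conn⇐ S C , _ , _ , vis⇐ S v , vis⇐ S w) })
    (λ _ → st-≈ S _)
    where
    hid-inj : ∀ {r s} → hid r ≡ hid s → r ≡ s
    hid-inj refl = refl
    N : Naming Src Y
    N = record
      { e = free ; h = hid ∘ τ S ; n = ev
      ; names = record
        { h-inj = λ {r} {s} _ _ p → trans (sym (left S r)) (trans (cong (τ⁻ S) (hid-inj p)) (left S s))
        ; n-inj = λ { _ _ refl → refl }
        ; h≢n   = λ _ _ () }
      ; out = record { f-inj = λ { refl → refl } ; f≢h = λ _ () ; f≢n = λ _ _ () } }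

  -- Terms are identified up to `_≋_`, so this is what makes `_≃_` well defined on them.
  ≋⇒≃ : ∀ {P Q} → P ≋ Q → P ≃ Q
  ≋⇒≃ e R = sim⇒outcome (sim-∣ (≋⇒sim e) sim-refl)

  -- Prefixes: sorting runs by a causal past.

  open Cancellation using (_#?_; #-sym)

  -- The runs of act u ε P ∣ R that fire act u ε P are sorted according to the
  -- causal past of that action, which does not depend on P.

  Fires₁ : Label → Set
  Fires₁ (ι , κ) = ι ≡ + 1 ∷ []

  fires₁? : ∀ l → Dec (Fires₁ l)
  fires₁? (ι , κ) = ι ≟ᵖ (+ 1 ∷ [])

  -- The path is scanned from its end. Labels after the firing are discarded; from the firing on, a
  -- label is kept exactly if it is not independent of everything kept so far, that is, if the
  -- firing has to wait for it.
  causal : Label → Maybe Path → Maybe Path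
  causal b nothing with fires₁? b
  ... | yes _ = just [ b ]
  ... | no _  = nothing
  causal b (just K) with All.all? (b #?_) K
  ... | yes _ = just K
  ... | no _  = just (b ∷ K)

  causes : Path → Maybe Path
  causes = foldr causal nothing

  infix 4 _∼ᴹ_

  _∼ᴹ_ : Maybe Path → Maybe Path → Set
  _∼ᴹ_ = Pointwise _∼_

  ∼ᴹ-equivalence : IsEquivalence _∼ᴹ_
  ∼ᴹ-equivalence = Maybe.isEquivalence
    (record { refl = ∼-refl ; sym = ∼-sym ; trans = ∼-trans })

  _∼ᴹ?_ : Decidable _∼ᴹ_
  _∼ᴹ?_ = Maybe.dec _∼?_

  private
    module ∼ᴹ = IsEquivalence ∼ᴹ-equivalence

  all-# : ∀ {b p q} → p ∼ q → All (b #_) p → All (b #_) q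
  all-# e A = All.tabulate (λ i → All.lookup A (proj₂ (∼⇒≐ e) i))

  causal-cong : ∀ b {s t} → s ∼ᴹ t → causal b s ∼ᴹ causal b t
  causal-cong b nothing = ∼ᴹ.refl
  causal-cong b (just {K} {K′} e) with All.all? (b #?_) K | All.all? (b #?_) K′
  ... | yes _ | yes _ = just e
  ... | yes A | no ¬A = ⊥-elim (¬A (all-# e A))
  ... | no ¬A | yes A = ⊥-elim (¬A (all-# (∼-sym e) A))
  ... | no _  | no _  = just (∼-++ (∼-refl {b ∷ []}) e)

  -- If both labels are kept, `commute` exchanges them. If one is dropped, it is independent of the
  -- other as well, so it is dropped in either order.
  causal-commute : ∀ {a b} → a # b → ∀ s → causal a (causal b s) ∼ᴹ causal b (causal a s)
  causal-commute {a} {b} i nothing with fires₁? a | fires₁? b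
  causal-commute {a} {b} i nothing | yes refl | yes refl = ⊥-elim (independent-≢ (proj₁ i) refl)
  causal-commute {a} {b} i nothing | yes p | no ¬q
    with fires₁? a | All.all? (b #?_) [ a ]
  ... | yes _ | yes _ = ∼ᴹ.refl
  ... | yes _ | no ¬A = ⊥-elim (¬A (#-sym i ∷ []))
  ... | no ¬p | _     = ⊥-elim (¬p p)
  causal-commute {a} {b} i nothing | no ¬p | yes q
    with fires₁? b | All.all? (a #?_) [ b ]
  ... | yes _ | yes _ = ∼ᴹ.refl
  ... | yes _ | no ¬A = ⊥-elim (¬A (i ∷ []))
  ... | no ¬q | _     = ⊥-elim (¬q q)
  causal-commute {a} {b} i nothing | no ¬p | no ¬q
    with fires₁? a | fires₁? b
  ... | yes p | _     = ⊥-elim (¬p p)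
  ... | no _  | yes q = ⊥-elim (¬q q)
  ... | no _  | no _  = nothing
  causal-commute {a} {b} i (just K) with All.all? (a #?_) K in p | All.all? (b #?_) K in q
  ... | yes A | yes B rewrite p | q = ∼ᴹ.refl
  ... | yes A | no ¬B rewrite q with All.all? (a #?_) (b ∷ K)
  ...   | yes _  = ∼ᴹ.refl
  ...   | no ¬A′ = ⊥-elim (¬A′ (i ∷ A))
  causal-commute {a} {b} i (just K) | no ¬A | yes B rewrite p with All.all? (b #?_) (a ∷ K)
  ...   | yes _  = ∼ᴹ.refl
  ...   | no ¬B′ = ⊥-elim (¬B′ (#-sym i ∷ B))
  causal-commute {a} {b} i (just K) | no ¬A | no ¬B
    with All.all? (a #?_) (b ∷ K) | All.all? (b #?_) (a ∷ K)
  ... | yes (_ ∷ A) | _           = ⊥-elim (¬A A)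
  ... | no _        | yes (_ ∷ B) = ⊥-elim (¬B B)
  ... | no _        | no _        = just (∼-++ (commute i) ∼-refl)

  causes-∼′ : ∀ {p q} → p ∼ q → ∀ {s t} → s ∼ᴹ t → foldr causal s p ∼ᴹ foldr causal t q
  causes-∼′ {p} ∼-refl {s} {t} e = go p
    where
    go : ∀ p → foldr causal s p ∼ᴹ foldr causal t p
    go []      = e
    go (b ∷ p) = causal-cong b (go p)
  causes-∼′ (commute {a} {b} i) {s} {t} e =
    ∼ᴹ.trans (causal-commute i s) (causal-cong b (causal-cong a e))
  causes-∼′ (∼-sym f)     e = ∼ᴹ.sym (causes-∼′ f (∼ᴹ.sym e))
  causes-∼′ (∼-trans f g) e = ∼ᴹ.trans (causes-∼′ f e) (causes-∼′ g ∼ᴹ.refl)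
  causes-∼′ (∼-++ {p} {p′} {q} {q′} f g) {s} {t} e
    rewrite List.foldr-++ causal s p q | List.foldr-++ causal t p′ q′ = causes-∼′ f (causes-∼′ g e)

  causes-∼ : ∀ {p q} → p ∼ q → causes p ∼ᴹ causes q
  causes-∼ e = causes-∼′ e nothing

  push : ∀ {b} K {d} → All (b #_) K → b ∷ K ++ d ∼ K ++ b ∷ d
  push []      []      = ∼-refl
  push {b} (a ∷ K) (i ∷ A) =
    ∼-trans (∼-++ (commute i) ∼-refl) (∼-++ (∼-refl {a ∷ []}) (push K A))

  record Factors (p K : Path) : Set where
    field
      rest    : Path
      factor  : p ∼ K ++ rest
      idem    : causes K ≡ just K
      init    : Path
      final   : Label
      fires   : Fires₁ final
      is-last : K ≡ init ++ [ final ]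

  -- A dropped label is independent of all of `K`, so `push` moves it past `K` into the rest. By
  -- `idem` the word `K` is its own past, which makes it a representative of its fibre.
  causes-factors : ∀ p {K} → causes p ≡ just K → Factors p K
  causes-factors (b ∷ p) e with causes p in eq
  causes-factors (b ∷ p) e | nothing with fires₁? b in r
  causes-factors (b ∷ p) refl | nothing | yes f = record
    { rest = p ; factor = ∼-refl ; idem = idem ; init = [] ; final = b ; fires = f ; is-last = refl }
    where
    idem : causes [ b ] ≡ just [ b ]
    idem rewrite r = refl
  causes-factors (b ∷ p) e | just K with causes-factors p eq | All.all? (b #?_) K in r
  causes-factors (b ∷ p) refl | just K | F | yes A = record
    { rest = b ∷ rest ; factor = ∼-trans (∼-++ (∼-refl {b ∷ []}) factor) (push K A)
    ; idem = idem ; init = init ; final = final ; fires = fires ; is-last = is-last }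
    where open Factors F
  causes-factors (b ∷ p) refl | just K | F | no ¬A = record
    { rest = rest ; factor = ∼-++ (∼-refl {b ∷ []}) factor
    ; idem = idem′ ; init = b ∷ init ; final = final ; fires = fires ; is-last = cong (b ∷_) is-last }
    where
    open Factors F
    idem′ : causes (b ∷ K) ≡ just (b ∷ K)
    idem′ rewrite idem | r = refl

  no-causes : ∀ q → (∀ {l} → l ∈ q → ¬ Fires₁ l) → causes q ≡ nothing
  no-causes []      z = refl
  no-causes (b ∷ q) z rewrite no-causes q (z ∘ there) with fires₁? b
  ... | yes f = ⊥-elim (z (here refl) f)
  ... | no _  = refl

  causes-nothing : ∀ p → causes p ≡ nothing → ∀ {l} → l ∈ p → ¬ Fires₁ l
  causes-nothing (b ∷ p) e i f with causes p in eq
  causes-nothing (b ∷ p) e i f | nothing with fires₁? b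
  causes-nothing (b ∷ p) e (here refl) f | nothing | no ¬f = ¬f f
  causes-nothing (b ∷ p) e (there i) f   | nothing | no ¬f = causes-nothing p eq i f
  causes-nothing (b ∷ p) e i f | just K with All.all? (b #?_) K
  causes-nothing (b ∷ p) () i f | just K | yes _
  causes-nothing (b ∷ p) () i f | just K | no _

  _⟫++_ : ∀ {X Y Z p q} → X —⟪ p ⟫→ Y → Y —⟪ q ⟫→ Z → X —⟪ p ++ q ⟫→ Z
  []       ⟫++ ts = ts
  (s ∷ ss) ⟫++ ts = s ∷ (ss ⟫++ ts)

  valid-after : ∀ {X Y p q} → X —⟪ p ⟫→ Y → Valid X (p ++ q) → Valid Y q
  valid-after []       V = V
  valid-after (s ∷ ss) (Z , t ∷ ts) with Finiteness.deterministic s t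
  ... | refl = valid-after ss (Z , ts)

  module _ {A X} (N : Naming A X) where

    max⇒valid : ∀ {p} → Max N p → Valid X p × (∀ l → ¬ Valid X (p ++ [ l ]))
    max⇒valid {p} (V , stuck) = link⇐ N (at-start N) V , stuck′
      where
      stuck′ : ∀ l → ¬ Valid X (p ++ [ l ])
      stuck′ l (_ , ss) with sv-++⁻ N p (proj₁ (link⇒ N (at-start N) ss))
      ... | _ , x ∷ [] = stuck l x

    valid⇒max : ∀ {p} → Valid X p → (∀ l → ¬ Valid X (p ++ [ l ])) → Max N p
    valid⇒max (Z , ss) stuck with link⇒ N (at-start N) ss
    ... | V , _ = V , λ l x → stuck l (link⇐ N (at-start N) (sv-++⁺ N V (x ∷ [])))

    lists-fibre : ∀ {i r} {I : Set i} {_∼ᵢ_ : I → I → Set r} (eq : IsEquivalence _∼ᵢ_)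
                  (_≟ᵢ_ : Decidable _∼ᵢ_) (F : Path → I) → (∀ {p q} → p ∼ q → F p ∼ᵢ F q) →
                  ∀ j → Lists N (λ p → F p ∼ᵢ j) (fibre eq _≟ᵢ_ Weight (F ∘ path) j (runs X))
    lists-fibre {_∼ᵢ_ = _∼ᵢ_} eq _≟ᵢ_ F F-∼ j = record
      { unique   = AllPairs.filter⁺ _ (Lists.unique (runs-list N))
      ; sound    = λ {ρ} k → proj₂ (∈-filter⁻ (λ ρ → F (path ρ) ≟ᵢ j) {xs = runs X} k)
      ; complete = λ m k → complete (runs-complete N m) k
      }
      where
      complete : ∀ {p} → ∃[ ρ ] ρ ∈ runs X × p ∼ path ρ → F p ∼ᵢ j →
                 ∃[ ρ ] ρ ∈ fibre eq _≟ᵢ_ Weight (F ∘ path) j (runs X) × p ∼ path ρ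
      complete (ρ , i , e) k =
        ρ , ∈-filter⁺ (λ ρ → F (path ρ) ≟ᵢ j) i (IsEquivalence.trans eq (F-∼ (∼-sym e)) k) , e

  module _ {u : Name} {ε : Sign} {R : Term} where

    -- Up to the firing all activity is in the test, and the firing itself does not inspect the
    -- continuation; so the path and the resulting test `R′` are the same for every `Q`.
    until-fired : ∀ {P Z a} K → (∀ {l} → l ∈ K → ¬ Fires₁ l) → Fires₁ a →
                  act u ε P ∣ R —⟪ K ++ [ a ] ⟫→ Z →
                  ∃[ R′ ] (∀ Q → act u ε Q ∣ R —⟪ K ++ [ a ] ⟫→ hide (◇ Q ∣ R′))
    until-fired K z f ss = go K z f ss
      where
      go : ∀ {P R Z a} K → (∀ {l} → l ∈ K → ¬ Fires₁ l) → Fires₁ a →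
           act u ε P ∣ R —⟪ K ++ [ a ] ⟫→ Z →
           ∃[ R′ ] (∀ Q → act u ε Q ∣ R —⟪ K ++ [ a ] ⟫→ hide (◇ Q ∣ R′))
      go []      z f  (sync act t ∷ []) = _ , λ Q → sync act t ∷ []
      go []      z () (∣ʳ s ∷ [])
      go (b ∷ K) z f  (∣ʳ s ∷ ss) with go K (z ∘ there) f ss
      ... | R′ , k = R′ , λ Q → ∣ʳ s ∷ k Q
      go (b ∷ K) z f  (sync act t ∷ ss) = ⊥-elim (z (here refl) refl)

    -- Prefixing with `K` sends the runs of `Z` to the fibre: it is injective up to homotopy by
    -- `∼-cancelˡ` and surjective by `causes-factors`. No later label is a firing, so the past of
    -- `K ++ q` is still `K`.
    fibre-sum : ∀ {P K Z} → act u ε P ∣ R —⟪ K ⟫→ Z → causes K ≡ just K →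
                ∀ {l} → l ∈ K → Fires₁ l →
                Σw Weight (fibre ∼ᴹ-equivalence _∼ᴹ?_ Weight (causes ∘ path) (just K)
                            (runs (act u ε P ∣ R))) ≈ outcome Z
    fibre-sum {P} {K} {Z} ss idem {l₀} l₀∈K f₀ =
      sum-match N M (λ p q → p ∼ K ++ q)
        (λ e f r → ∼-trans (∼-sym e) (∼-trans r (∼-++ (∼-refl {K}) f)))
        (λ m m′ r → 𝕂.reflexive (trans (weight-∼ N r) (weight-after m′)))
        (λ _ _ r r′ → ∼-trans r (∼-sym r′))
        (λ _ _ r r′ → ∼-cancelˡ K (∼-trans (∼-sym r) r′))
        to from
        (lists-fibre N ∼ᴹ-equivalence _∼ᴹ?_ causes causes-∼ (just K)) (runs-list M)
      where
      X : Term
      X = act u ε P ∣ R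
      N : Naming Src X
      N = canonical X
      M : Naming Src Z
      M = canonical Z
      weight-after : ∀ {q} → Max M q → weight N (K ++ q) ≡ weight M q
      weight-after {q} (V , _) with link⇐ M (at-start M) V
      ... | W , ts = trans (sym (state-rel (proj₂ (link⇒ N (at-start N) (ss ⟫++ ts)))))
                           (state-rel (proj₂ (link⇒ M (at-start M) ts)))
      to : ∀ {p} → Max N p → causes p ∼ᴹ just K →
           weight N p ≈ 0# ⊎ ∃[ q ] Max M q × ⊤ × p ∼ K ++ q
      to {p} m e with causes p in eq
      to {p} m (just e) | just K′ with causes-factors p eq
      ... | F with ∼-trans (Factors.factor F) (∼-++ e ∼-refl)
      ...   | r with max⇒valid N (max-∼ N r m)
      ...     | V , stuck = inj₂ (Factors.rest F , valid⇒max M (valid-after ss V) stuck′ , tt , r)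
        where
        stuck′ : ∀ l → ¬ Valid Z (Factors.rest F ++ [ l ])
        stuck′ l (W , ts) = stuck l
          (W , subst (λ q → X —⟪ q ⟫→ W) (sym (List.++-assoc K (Factors.rest F) [ l ])) (ss ⟫++ ts))
      from : ∀ {q} → Max M q → ⊤ →
             weight M q ≈ 0# ⊎ ∃[ p ] Max N p × causes p ∼ᴹ just K × p ∼ K ++ q
      from {q} m _ with max⇒valid M m
      ... | (W , ts) , stuck =
        inj₂ (K ++ q , valid⇒max N (W , ss ⟫++ ts) stuck′ , ∼ᴹ.reflexive once , ∼-refl)
        where
        stuck′ : ∀ l → ¬ Valid X ((K ++ q) ++ [ l ])
        stuck′ l (W , us) = stuck l (valid-after ss
          (W , subst (λ q → X —⟪ q ⟫→ W) (List.++-assoc K q [ l ]) us))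
        fresh : ∀ {l} → l ∈ q → ¬ Fires₁ l
        fresh i f = sv-fresh N (proj₂ (sv-++⁻ N {[]} K (proj₁ (link⇒ N (at-start N) (ss ⟫++ ts)))))
          (past-∈ K l₀∈K) (inj₁ refl) i (inj₁ (trans f₀ (sym f)))
          where
          past-∈ : ∀ p {h l} → l ∈ p → l ∈ p ʳ++ h
          past-∈ (a ∷ p) (there i)   = past-∈ p i
          past-∈ (a ∷ p) (here refl) = later p (here refl)
            where
            later : ∀ p {h l} → l ∈ h → l ∈ p ʳ++ h
            later []      i = i
            later (b ∷ p) i = later p (there i)
        once : causes (K ++ q) ≡ just K
        once rewrite List.foldr-++ causal nothing K q | no-causes q fresh = idem

    vis-inert : ∀ {P Q e h α} {μ : Position → Maybe Src} {g δ} → μ (+ 1 ∷ []) ≡ nothing →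
                Vis (act u ε P ∣ R) e h μ α g δ → Vis (act u ε Q ∣ R) e h μ α g δ
    vis-inert z (∣ˡ (act m p))   = ∣ˡ (act m p)
    vis-inert z (∣ˡ (fired m v)) with trans (sym z) m
    ... | ()
    vis-inert z (∣ʳ v)           = ∣ʳ v

    en-inert : ∀ {P Q e h} {μ : Position → Maybe Src} {l} → μ (+ 1 ∷ []) ≡ nothing →
               En (act u ε P ∣ R) e h μ l → En (act u ε Q ∣ R) e h μ l
    en-inert z (∣ˡ (act C) , _ , _ , ∣ˡ (fired m v) , _) with trans (sym z) m
    ... | ()
    en-inert z (∣ʳ C , g , δ , v , w) = ∣ʳ C , g , δ , vis-inert z v , vis-inert z w
    en-inert z (sync a b , g , δ , ∣ˡ (act m p) , w) =
      sync here b , g , δ , ∣ˡ (act m p) , vis-inert z w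
    en-inert z (sync a b , g , δ , ∣ˡ (fired m v) , _) with trans (sym z) m
    ... | ()

    private
      N : ∀ P → Naming Src (act u ε P ∣ R)
      N P = canonical (act u ε P ∣ R)

    sv-inert : ∀ {P Q hist p} → mu ev hist (+ 1 ∷ []) ≡ nothing → (∀ {l} → l ∈ p → ¬ Fires₁ l) →
               SV (N P) hist p → SV (N Q) hist p × mu ev (p ʳ++ hist) (+ 1 ∷ []) ≡ nothing
    sv-inert z f []                = [] , z
    sv-inert {hist = hist} z f (_∷_ {l} (enabled E) V) with sv-inert {hist = l ∷ hist} z′ (f ∘ there) V
      where
      untouched : ∀ {P} → En (act u ε P ∣ R) free hid (mu ev hist) l → ¬ Touches (+ 1 ∷ []) l
      untouched _ (inj₁ e) = f (here refl) (sym e)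
      untouched (sync _ _ , _) (inj₂ ())
      untouched (∣ʳ _ , _)     (inj₂ ())
      untouched (∣ˡ (act C) , _) (inj₂ ())
      z′ : mu ev (l ∷ hist) (+ 1 ∷ []) ≡ nothing
      z′ = trans (mu-miss {n = ev} {l = l} hist (untouched E)) z
    ... | W , z″ = enabled (en-inert z E) ∷ W , z″

    max-inert : ∀ {P Q p} → (∀ {l} → l ∈ p → ¬ Fires₁ l) → Max (N P) p →
                Max (N Q) p × weight (N P) p ≡ weight (N Q) p
    max-inert {P} {Q} {p} f (V , stuck) with sv-inert {Q = Q} refl f V
    ... | W , z = (W , λ { l (enabled x) → stuck l (enabled (en-inert z x)) }) , weights
      where
      weights : weight (N P) p ≡ weight (N Q) p
      weights rewrite z = refl

    -- An unfired prefix has state `1#` whatever its continuation, and no action of the continuation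
    -- is reached in such a run.
    unfired-sum : ∀ P Q →
      Σw Weight (fibre ∼ᴹ-equivalence _∼ᴹ?_ Weight (causes ∘ path) nothing (runs (act u ε P ∣ R))) ≈
      Σw Weight (fibre ∼ᴹ-equivalence _∼ᴹ?_ Weight (causes ∘ path) nothing (runs (act u ε Q ∣ R)))
    unfired-sum P Q = sum-match (N P) (N Q) (λ p q → p ∼ q × causes p ∼ᴹ nothing)
      (λ e f (r , z) → ∼-trans (∼-sym e) (∼-trans r f) , ∼ᴹ.trans (causes-∼ (∼-sym e)) z)
      (λ m m′ (r , z) → 𝕂.reflexive (trans (proj₂ (max-inert {Q = Q} (quiet z) m))
                                           (weight-∼ (N Q) r)))
      (λ _ _ (r , _) (r′ , _) → ∼-trans r (∼-sym r′))
      (λ _ _ (r , _) (r′ , _) → ∼-trans (∼-sym r) r′)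
      (λ {p} m z → inj₂ (p , proj₁ (max-inert (quiet z) m) , z , ∼-refl , z))
      (λ {p} m z → inj₂ (p , proj₁ (max-inert (quiet z) m) , z , ∼-refl , z))
      (lists-fibre (N P) ∼ᴹ-equivalence _∼ᴹ?_ causes causes-∼ nothing)
      (lists-fibre (N Q) ∼ᴹ-equivalence _∼ᴹ?_ causes causes-∼ nothing)
      where
      quiet : ∀ {p} → causes p ∼ᴹ nothing → ∀ {l} → l ∈ p → ¬ Fires₁ l
      quiet {p} z with causes p in eq
      quiet {p} nothing | nothing = causes-nothing p eq

    causes-sum : ∀ P Q → (∀ R → outcome (P ∣ R) ≈ outcome (Q ∣ R)) → ∀ {p} → Max (N P) p →
      Σw Weight (fibre ∼ᴹ-equivalence _∼ᴹ?_ Weight (causes ∘ path) (causes p) (runs (act u ε P ∣ R))) ≈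
      Σw Weight (fibre ∼ᴹ-equivalence _∼ᴹ?_ Weight (causes ∘ path) (causes p) (runs (act u ε Q ∣ R)))
    causes-sum P Q E {p} m with causes p in eq
    ... | nothing = unfired-sum P Q
    ... | just K with causes-factors p eq
    ...   | record { rest = d ; factor = r ; idem = idem ; init = I ; final = a ; fires = f ; is-last = refl }
      with max⇒valid (N P) (max-∼ (N P) r m)
    ...     | (Z , ss) , _ with split ss
      where
      split : ∀ {X q d Z} → X —⟪ q ++ d ⟫→ Z → ∃[ Y ] X —⟪ q ⟫→ Y
      split {q = []}    ss       = _ , []
      split {q = b ∷ q} (s ∷ ss) with split {q = q} ss
      ... | Y , ts = Y , s ∷ ts
    ...       | Y , ts with until-fired I init-quiet f ts
      where
      init-quiet : ∀ {l} → l ∈ I → ¬ Fires₁ l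
      init-quiet i g with ∈-∃++ i
      ... | I₁ , I₂ , refl with sv-++⁻ (N P) {[]} I₁
                                (subst (SV (N P) []) (List.++-assoc I₁ (_ ∷ I₂) [ a ])
                                  (proj₁ (link⇒ (N P) (at-start (N P)) ts)))
      ...   | _ , (_ ∷ W) = sv-fresh (N P) W (here refl) (inj₁ refl)
                              (∈-++⁺ʳ I₂ (here refl)) (inj₁ (trans g (sym f)))
    -- The hypothesis is used with the test `R′` left over by the past; the `hide` and the `◇`
    -- produced by the firing do not change the outcome (`remaining`).
    ...         | R′ , k = 𝕂.trans (fibre-sum (k P) idem last∈ f)
                    (𝕂.trans (remaining P) (𝕂.trans (E R′) (𝕂.sym (𝕂.trans (fibre-sum (k Q) idem last∈ f) (remaining Q)))))
      where
      last∈ : a ∈ I ++ [ a ]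
      last∈ = ∈-++⁺ʳ I (here refl)
      remaining : ∀ P → outcome (hide (◇ P ∣ R′)) ≈ outcome (P ∣ R′)
      remaining P = 𝕂.trans (outcome-hide (◇ P ∣ R′)) (outcome-iso (iso-◇ P R′))

    act-sum : ∀ {P Q} → (∀ R → outcome (P ∣ R) ≈ outcome (Q ∣ R)) →
              outcome (act u ε P ∣ R) ≈ outcome (act u ε Q ∣ R)
    act-sum {P} {Q} E = Σw-fibres ∼ᴹ-equivalence _∼ᴹ?_ Weight Weight (causes ∘ path) (causes ∘ path)
      (runs (act u ε P ∣ R)) (runs (act u ε Q ∣ R))
      (λ {ρ} _ → causes-sum P Q E (max⇒ (N P) ρ))
      (λ {ρ} _ → 𝕂.sym (causes-sum Q P (λ R → 𝕂.sym (E R)) (max⇒ (N Q) ρ)))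

  ≃-act : ∀ {P Q} → P ≃ Q → ∀ α → α ∙ P ≃ α ∙ Q
  ≃-act {P} {Q} E (u ^ ε ⟨ x ⟩) R = act-sum {u} {ε} {R} {rename (bind x) P} {rename (bind x) Q} λ R′ →
    𝕂.trans (unbind x P R′) (𝕂.trans (E _) (𝕂.sym (unbind x Q R′)))

  -- Translations of R and S into a test for P.

  -- What a prescribed run does with an action of S: nothing, a reaction with P or
  -- within S (inner), or a reaction with R (outer). The number is the channel of
  -- its token or of its synchronisation.

  data Kind : Set where
    unfired     : Kind
    inner outer : ℕ → Kind

  pattern pos = Sign.+
  pattern neg = Sign.-

  -- The action of S at address κ is found at a κ in trS, its token at b κ in
  -- tokens: both translations add a left component at every node.

  a : Position → Position
  a []      = []
  a (i ∷ κ) = i ∷ + 2 ∷ a κ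

  b : Position → Position
  b κ = a κ ++ + 1 ∷ + 1 ∷ []

  -- The entry 0 stays alone because `trS` adds no left component directly below a `hide`.
  aʰ : List ℕ → List ℕ
  aʰ []          = []
  aʰ (zero ∷ r)  = 0 ∷ aʰ r
  aʰ (suc i ∷ r) = suc i ∷ 2 ∷ aʰ r

  cell : Sign → K → Kind → Term
  cell δ z unfired   = const 1#
  cell δ z (inner i) = act i δ (const z)
  cell δ z (outer i) = const 1#

  -- The test contains tokens pos 1# and tokens neg 0#: a positive token that the
  -- corresponding action of S does not claim is absorbed by a negative one,
  -- which makes the weight 0.

  tokens : Sign → K → (Position → Kind) → Term → Term
  tokens δ z k (const _)   = const 1#
  -- The `◇` takes the place of the prefix, so that the token has the same address as the
  -- corresponding claim in `trS`.
  tokens δ z k (act u ε P) = ◇ (cell δ z (k []) ∥ tokens δ z (k ∘ (+ 1 ∷_)) P)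
  tokens δ z k (◇ P)       = ◇ (const 1# ∥ tokens δ z (k ∘ (+ 1 ∷_)) P)
  tokens δ z k (P ∣ Q)     = (const 1# ∥ tokens δ z (k ∘ (+ 1 ∷_)) P) ∥ (const 1# ∥ tokens δ z (k ∘ (+ 2 ∷_)) Q)
  tokens δ z k (P ∥ Q)     = (const 1# ∥ tokens δ z (k ∘ (+ 1 ∷_)) P) ∥ (const 1# ∥ tokens δ z (k ∘ (+ 2 ∷_)) Q)
  tokens δ z k (hide P)    = tokens δ z k P

  -- An action without a channel never fires in the pattern and is replaced by `1#`, the state of an
  -- unfired prefix. `s` refers to the channels from below the binders passed so far.
  trR : (Position → Maybe ℕ) → (ℕ → Name) → Term → Term
  trR c s (const k)   = const k
  trR c s (act u ε P) = maybe′ (λ i → act (s i) ε (trR (c ∘ (+ 1 ∷_)) (suc ∘ s) P)) (const 1#) (c [])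
  trR c s (◇ P)       = ◇ trR (c ∘ (+ 1 ∷_)) s P
  trR c s (P ∣ Q)     = trR (c ∘ (+ 1 ∷_)) s P ∣ trR (c ∘ (+ 2 ∷_)) s Q
  trR c s (P ∥ Q)     = trR (c ∘ (+ 1 ∷_)) s P ∥ trR (c ∘ (+ 2 ∷_)) s Q
  trR c s (hide P)    = hide (trR c (suc ∘ s) P)

  trS : (Position → Kind) → (ℕ → Name) → (Name → Name) → Term → Term
  -- An action of kind `unfired` is kept with a `0#` behind it instead of being removed: without it,
  -- the test would accept as complete a path that could still go on in the original system by
  -- firing this action. An `inner` action keeps its own subject and, once fired, offers a claim on
  -- its token; an `outer` one reacts on the channel of its synchronisation only.
  trAct : Kind → (ℕ → Name) → Name → Sign → Term → Term

  trAct unfired   s u ε P = act u ε (const 0#)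
  trAct (inner i) s u ε P = act u ε (act (suc (s i)) neg (const 1#) ∥ P)
  trAct (outer i) s u ε P = act (s i) ε (const 1# ∥ P)

  trS k s q (const c)   = const c
  trS k s q (act u ε P) = trAct (k []) s (q u) ε (trS (k ∘ (+ 1 ∷_)) (suc ∘ s) (ext q) P)
  trS k s q (◇ P)       = ◇ (const 1# ∥ trS (k ∘ (+ 1 ∷_)) s q P)
  trS k s q (P ∣ Q)     = (const 1# ∥ trS (k ∘ (+ 1 ∷_)) s q P) ∣ (const 1# ∥ trS (k ∘ (+ 2 ∷_)) s q Q)
  trS k s q (P ∥ Q)     = (const 1# ∥ trS (k ∘ (+ 1 ∷_)) s q P) ∥ (const 1# ∥ trS (k ∘ (+ 2 ∷_)) s q Q)
  trS k s q (hide P)    = hide (trS k (suc ∘ s) (ext q) P)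

  -- Enabled actions and states of the translated terms.

  -- What is left of `Vis` when names are forgotten. It depends only on which actions have fired and
  -- so can be carried between histories that give different names.
  data Open {A : Set} : Term → (Position → Maybe A) → Position → Set c where
    here  : ∀ {u ε P μ} → Open (act u ε P) μ []
    fired : ∀ {u ε P μ ι} → Fired (μ []) → Open P (μ ∘ (+ 1 ∷_)) ι → Open (act u ε P) μ (+ 1 ∷ ι)
    ◇_    : ∀ {P μ ι} → Open P (μ ∘ (+ 1 ∷_)) ι → Open (◇ P) μ (+ 1 ∷ ι)
    ∣ˡ    : ∀ {P Q μ ι} → Open P (μ ∘ (+ 1 ∷_)) ι → Open (P ∣ Q) μ (+ 1 ∷ ι)
    ∣ʳ    : ∀ {P Q μ ι} → Open Q (μ ∘ (+ 2 ∷_)) ι → Open (P ∣ Q) μ (+ 2 ∷ ι)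
    ∥ˡ    : ∀ {P Q μ ι} → Open P (μ ∘ (+ 1 ∷_)) ι → Open (P ∥ Q) μ (+ 1 ∷ ι)
    ∥ʳ    : ∀ {P Q μ ι} → Open Q (μ ∘ (+ 2 ∷_)) ι → Open (P ∥ Q) μ (+ 2 ∷ ι)
    hide  : ∀ {P μ ι} → Open P μ ι → Open (hide P) μ ι

  module _ {A B : Set} where

    vis-open : ∀ {X e h ι g ε} {μ : Position → Maybe A} {ν : Position → Maybe B} →
               (∀ {α} → Fired (μ α) → Fired (ν α)) →
               Vis X e h μ ι g ε → Open X ν ι
    vis-open F (act _ _)   = here
    vis-open F (fired m v) = fired (F (_ , m)) (vis-open F v)
    vis-open F (◇ v)       = ◇ vis-open F v
    vis-open F (∣ˡ v)      = ∣ˡ (vis-open F v)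
    vis-open F (∣ʳ v)      = ∣ʳ (vis-open F v)
    vis-open F (∥ˡ v)      = ∥ˡ (vis-open F v)
    vis-open F (∥ʳ v)      = ∥ʳ (vis-open F v)
    vis-open F (hide v)    = hide (vis-open F v)

  module _ {A : Set} where

    open-act : ∀ {X ι} {μ : Position → Maybe A} → Open X μ ι → Act X ι
    open-act here        = here
    open-act (fired _ v) = act (open-act v)
    open-act (◇ v)       = ◇ open-act v
    open-act (∣ˡ v)      = ∣ˡ (open-act v)
    open-act (∣ʳ v)      = ∣ʳ (open-act v)
    open-act (∥ˡ v)      = ∥ˡ (open-act v)
    open-act (∥ʳ v)      = ∥ʳ (open-act v)
    open-act (hide v)    = hide (open-act v)

    open-vis : ∀ {X e h ι} {μ : Position → Maybe A} → μ ι ≡ nothing → Open X μ ι →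
               ∃[ g ] ∃[ ε ] Vis X e h μ ι g ε
    open-vis z here              = _ , _ , act z refl
    open-vis z (fired (_ , m) o) = let g , ε , v = open-vis z o in g , ε , fired m v
    open-vis z (◇ o)             = let g , ε , v = open-vis z o in g , ε , ◇ v
    open-vis z (∣ˡ o)            = let g , ε , v = open-vis z o in g , ε , ∣ˡ v
    open-vis z (∣ʳ o)            = let g , ε , v = open-vis z o in g , ε , ∣ʳ v
    open-vis z (∥ˡ o)            = let g , ε , v = open-vis z o in g , ε , ∥ˡ v
    open-vis z (∥ʳ o)            = let g , ε , v = open-vis z o in g , ε , ∥ʳ v
    open-vis z (hide o)          = let g , ε , v = open-vis z o in g , ε , hide v

  fired≢nothing : ∀ {A : Set} {m : Maybe A} → Fired m → m ≢ nothing
  fired≢nothing (_ , refl) ()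

  fired? : ∀ {A : Set} (m : Maybe A) → Fired m ⊎ m ≡ nothing
  fired? (just x) = inj₁ (x , refl)
  fired? nothing  = inj₂ refl

  act-R⁻ : ∀ R {c s ι} → Act (trR c s R) ι → Act R ι
  act-R⁻ (act u ε P) {c} o with c []
  act-R⁻ (act u ε P) here    | just _ = here
  act-R⁻ (act u ε P) (act o) | just _ = act (act-R⁻ P o)
  act-R⁻ (◇ P)       (◇ o)    = ◇ act-R⁻ P o
  act-R⁻ (P ∣ Q)     (∣ˡ o)   = ∣ˡ (act-R⁻ P o)
  act-R⁻ (P ∣ Q)     (∣ʳ o)   = ∣ʳ (act-R⁻ Q o)
  act-R⁻ (P ∥ Q)     (∥ˡ o)   = ∥ˡ (act-R⁻ P o)
  act-R⁻ (P ∥ Q)     (∥ʳ o)   = ∥ʳ (act-R⁻ Q o)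
  act-R⁻ (hide P)    (hide o) = hide (act-R⁻ P o)

  conn-R⁻ : ∀ R {c s l} → Conn (trR c s R) l → Conn R l
  conn-R⁻ (act u ε P) {c} o with c []
  conn-R⁻ (act u ε P) (act o) | just _ = act (conn-R⁻ P o)
  conn-R⁻ (◇ P)       (◇ o)    = ◇ conn-R⁻ P o
  conn-R⁻ (P ∣ Q)     (∣ˡ o)   = ∣ˡ (conn-R⁻ P o)
  conn-R⁻ (P ∣ Q)     (∣ʳ o)   = ∣ʳ (conn-R⁻ Q o)
  conn-R⁻ (P ∥ Q)     (∥ˡ o)   = ∥ˡ (conn-R⁻ P o)
  conn-R⁻ (P ∥ Q)     (∥ʳ o)   = ∥ʳ (conn-R⁻ Q o)
  conn-R⁻ (hide P)    (hide o) = hide (conn-R⁻ P o)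
  conn-R⁻ (P ∣ Q)     (sync x y) = sync (act-R⁻ P x) (act-R⁻ Q y)

  conn-R⁺ : ∀ R {c s ι κ} → Conn R (ι , κ) → Act (trR c s R) ι → Act (trR c s R) κ →
            Conn (trR c s R) (ι , κ)
  conn-R⁺ (act u ε P) {c} (act C) x y with c []
  conn-R⁺ (act u ε P) (act C) (act x) (act y) | just _ = act (conn-R⁺ P C x y)
  conn-R⁺ (◇ P)    (◇ C)      (◇ x)    (◇ y)    = ◇ conn-R⁺ P C x y
  conn-R⁺ (P ∣ Q)  (∣ˡ C)     (∣ˡ x)   (∣ˡ y)   = ∣ˡ (conn-R⁺ P C x y)
  conn-R⁺ (P ∣ Q)  (∣ʳ C)     (∣ʳ x)   (∣ʳ y)   = ∣ʳ (conn-R⁺ Q C x y)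
  conn-R⁺ (P ∣ Q)  (sync _ _) (∣ˡ x)   (∣ʳ y)   = sync x y
  conn-R⁺ (P ∥ Q)  (∥ˡ C)     (∥ˡ x)   (∥ˡ y)   = ∥ˡ (conn-R⁺ P C x y)
  conn-R⁺ (P ∥ Q)  (∥ʳ C)     (∥ʳ x)   (∥ʳ y)   = ∥ʳ (conn-R⁺ Q C x y)
  conn-R⁺ (hide P) (hide C)   (hide x) (hide y) = hide (conn-R⁺ P C x y)

  module _ {A : Set} where

    vis-R⁻ : ∀ R {c s e′ h′ e h ι} {μ : Position → Maybe A} {g ε} → Vis (trR c s R) e′ h′ μ ι g ε →
             ∃[ i ] c ι ≡ just i × g ≡ e′ (s i) × ∃[ g₀ ] Vis R e h μ ι g₀ ε
    vis-R⁻ (act u ε P) {c} v with c [] in eq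
    vis-R⁻ (act u ε P) (act m p)   | just i = i , eq , p , _ , act m refl
    vis-R⁻ (act u ε P) (fired m v) | just i =
      let j , x , y , g , w = vis-R⁻ P v in j , x , y , g , fired m w
    vis-R⁻ (◇ P)    (◇ v)    = let j , x , y , g , w = vis-R⁻ P v in j , x , y , g , ◇ w
    vis-R⁻ (P ∣ Q)  (∣ˡ v)   = let j , x , y , g , w = vis-R⁻ P v in j , x , y , g , ∣ˡ w
    vis-R⁻ (P ∣ Q)  (∣ʳ v)   = let j , x , y , g , w = vis-R⁻ Q v in j , x , y , g , ∣ʳ w
    vis-R⁻ (P ∥ Q)  (∥ˡ v)   = let j , x , y , g , w = vis-R⁻ P v in j , x , y , g , ∥ˡ w
    vis-R⁻ (P ∥ Q)  (∥ʳ v)   = let j , x , y , g , w = vis-R⁻ Q v in j , x , y , g , ∥ʳ w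
    vis-R⁻ (hide P) (hide v) = let j , x , y , g , w = vis-R⁻ P v in j , x , y , g , hide w

    vis-R⁺ : ∀ {R c s e′ h′ e h ι i} {μ : Position → Maybe A} {g ε} →
             (∀ {κ} → Fired (μ κ) → Fired (c κ)) → c ι ≡ just i → Vis R e h μ ι g ε →
             Vis (trR c s R) e′ h′ μ ι (e′ (s i)) ε
    vis-R⁺ F E (act m p) rewrite E = act m refl
    vis-R⁺ {c = c} F E (fired m v) with F (_ , m)
    ... | _ , E′ rewrite E′ = fired m (vis-R⁺ F E v)
    vis-R⁺ F E (◇ v)    = ◇ vis-R⁺ F E v
    vis-R⁺ F E (∣ˡ v)   = ∣ˡ (vis-R⁺ F E v)
    vis-R⁺ F E (∣ʳ v)   = ∣ʳ (vis-R⁺ F E v)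
    vis-R⁺ F E (∥ˡ v)   = ∥ˡ (vis-R⁺ F E v)
    vis-R⁺ F E (∥ʳ v)   = ∥ʳ (vis-R⁺ F E v)
    vis-R⁺ F E (hide v) = hide (vis-R⁺ F E v)

    st-R : ∀ R {c s} {μ : Position → Maybe A} → (∀ {κ} → Fired (μ κ) → Fired (c κ)) →
           st (trR c s R) μ ≡ st R μ
    st-R (const k)   F = refl
    st-R (act u ε P) {c} {μ = μ} F with c [] in p | μ [] in q
    ... | just _  | just _  rewrite q = st-R P F
    ... | just _  | nothing rewrite q = refl
    ... | nothing | just _  with F (_ , q)
    ...   | _ , E with trans (sym p) E
    ...     | ()
    st-R (act u ε P) F | nothing | nothing = refl
    st-R (◇ P)       F = st-R P F
    st-R (P ∣ Q)     F = cong₂ _*ᴷ_ (st-R P F) (st-R Q F)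
    st-R (P ∥ Q)     F = cong₂ _*ᴷ_ (st-R P F) (st-R Q F)
    st-R (hide P)    F = st-R P F

  act-tokens⁻ : ∀ S {δ z k α} → Act (tokens δ z k S) α → ∃[ κ ] ∃[ i ] α ≡ b κ × k κ ≡ inner i × Act S κ
  act-tokens⁻ (act u ε P) {k = k} (◇ (∥ˡ x)) with k [] in eq
  act-tokens⁻ (act u ε P) (◇ (∥ˡ here)) | inner i = [] , i , refl , eq , here
  act-tokens⁻ (act u ε P) (◇ (∥ˡ (act ()))) | inner i
  act-tokens⁻ (act u ε P) (◇ (∥ˡ ())) | unfired
  act-tokens⁻ (act u ε P) (◇ (∥ˡ ())) | outer i
  act-tokens⁻ (act u ε P) (◇ (∥ʳ x)) =
    let κ , i , p , q , y = act-tokens⁻ P x in + 1 ∷ κ , i , cong (λ α → + 1 ∷ + 2 ∷ α) p , q , act y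
  act-tokens⁻ (◇ P) (◇ (∥ʳ x)) =
    let κ , i , p , q , y = act-tokens⁻ P x in + 1 ∷ κ , i , cong (λ α → + 1 ∷ + 2 ∷ α) p , q , ◇ y
  act-tokens⁻ (P ∣ Q) (∥ˡ (∥ʳ x)) =
    let κ , i , p , q , y = act-tokens⁻ P x in + 1 ∷ κ , i , cong (λ α → + 1 ∷ + 2 ∷ α) p , q , ∣ˡ y
  act-tokens⁻ (P ∣ Q) (∥ʳ (∥ʳ x)) =
    let κ , i , p , q , y = act-tokens⁻ Q x in + 2 ∷ κ , i , cong (λ α → + 2 ∷ + 2 ∷ α) p , q , ∣ʳ y
  act-tokens⁻ (P ∥ Q) (∥ˡ (∥ʳ x)) =
    let κ , i , p , q , y = act-tokens⁻ P x in + 1 ∷ κ , i , cong (λ α → + 1 ∷ + 2 ∷ α) p , q , ∥ˡ y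
  act-tokens⁻ (P ∥ Q) (∥ʳ (∥ʳ x)) =
    let κ , i , p , q , y = act-tokens⁻ Q x in + 2 ∷ κ , i , cong (λ α → + 2 ∷ + 2 ∷ α) p , q , ∥ʳ y
  act-tokens⁻ (hide P) x =
    let κ , i , p , q , y = act-tokens⁻ P x in κ , i , p , q , hide y

  conn-tokens : ∀ S {δ z k l} → ¬ Conn (tokens δ z k S) l
  conn-tokens (act u ε P) {k = k} (◇ (∥ˡ C)) with k []
  conn-tokens (act u ε P) (◇ (∥ˡ (act ()))) | inner i
  conn-tokens (act u ε P) (◇ (∥ʳ C)) = conn-tokens P C
  conn-tokens (◇ P)   (◇ (∥ʳ C))  = conn-tokens P C
  conn-tokens (P ∣ Q) (∥ˡ (∥ʳ C)) = conn-tokens P C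
  conn-tokens (P ∣ Q) (∥ʳ (∥ʳ C)) = conn-tokens Q C
  conn-tokens (P ∥ Q) (∥ˡ (∥ʳ C)) = conn-tokens P C
  conn-tokens (P ∥ Q) (∥ʳ (∥ʳ C)) = conn-tokens Q C
  conn-tokens (hide P) C          = conn-tokens P C

  module _ {A : Set} where

    vis-tokens⁻ : ∀ S {δ z k e h α} {μ : Position → Maybe A} {g ε} → Vis (tokens δ z k S) e h μ α g ε →
                  ∃[ κ ] ∃[ i ] α ≡ b κ × k κ ≡ inner i × ε ≡ δ × g ≡ e i × Act S κ
    vis-tokens⁻ (act u ε P) {k = k} (◇ (∥ˡ v)) with k [] in eq
    vis-tokens⁻ (act u ε P) (◇ (∥ˡ (act m p))) | inner i = [] , i , refl , eq , refl , p , here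
    vis-tokens⁻ (act u ε P) (◇ (∥ˡ (fired m ()))) | inner i
    vis-tokens⁻ (act u ε P) (◇ (∥ˡ ())) | unfired
    vis-tokens⁻ (act u ε P) (◇ (∥ˡ ())) | outer i
    vis-tokens⁻ (act u ε P) (◇ (∥ʳ v)) = let κ , i , p , q , d , r , o = vis-tokens⁻ P v in
      + 1 ∷ κ , i , cong (λ α → + 1 ∷ + 2 ∷ α) p , q , d , r , act o
    vis-tokens⁻ (◇ P) (◇ (∥ʳ v)) = let κ , i , p , q , d , r , o = vis-tokens⁻ P v in
      + 1 ∷ κ , i , cong (λ α → + 1 ∷ + 2 ∷ α) p , q , d , r , ◇ o
    vis-tokens⁻ (P ∣ Q) (∥ˡ (∥ʳ v)) = let κ , i , p , q , d , r , o = vis-tokens⁻ P v in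
      + 1 ∷ κ , i , cong (λ α → + 1 ∷ + 2 ∷ α) p , q , d , r , ∣ˡ o
    vis-tokens⁻ (P ∣ Q) (∥ʳ (∥ʳ v)) = let κ , i , p , q , d , r , o = vis-tokens⁻ Q v in
      + 2 ∷ κ , i , cong (λ α → + 2 ∷ + 2 ∷ α) p , q , d , r , ∣ʳ o
    vis-tokens⁻ (P ∥ Q) (∥ˡ (∥ʳ v)) = let κ , i , p , q , d , r , o = vis-tokens⁻ P v in
      + 1 ∷ κ , i , cong (λ α → + 1 ∷ + 2 ∷ α) p , q , d , r , ∥ˡ o
    vis-tokens⁻ (P ∥ Q) (∥ʳ (∥ʳ v)) = let κ , i , p , q , d , r , o = vis-tokens⁻ Q v in
      + 2 ∷ κ , i , cong (λ α → + 2 ∷ + 2 ∷ α) p , q , d , r , ∥ʳ o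
    vis-tokens⁻ (hide P) v = let κ , i , p , q , d , r , o = vis-tokens⁻ P v in
      κ , i , p , q , d , r , hide o

    vis-tokens⁺ : ∀ {S δ z k e h κ i} {μ : Position → Maybe A} → Act S κ → k κ ≡ inner i →
                  μ (b κ) ≡ nothing → Vis (tokens δ z k S) e h μ (b κ) (e i) δ
    vis-tokens⁺ here E m rewrite E = ◇ (∥ˡ (act m refl))
    vis-tokens⁺ (act x)  E m = ◇ (∥ʳ (vis-tokens⁺ x E m))
    vis-tokens⁺ (◇ x)    E m = ◇ (∥ʳ (vis-tokens⁺ x E m))
    vis-tokens⁺ (∣ˡ x)   E m = ∥ˡ (∥ʳ (vis-tokens⁺ x E m))
    vis-tokens⁺ (∣ʳ x)   E m = ∥ʳ (∥ʳ (vis-tokens⁺ x E m))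
    vis-tokens⁺ (∥ˡ x)   E m = ∥ˡ (∥ʳ (vis-tokens⁺ x E m))
    vis-tokens⁺ (∥ʳ x)   E m = ∥ʳ (∥ʳ (vis-tokens⁺ x E m))
    vis-tokens⁺ (hide x) E m = vis-tokens⁺ x E m

    1*1 : ∀ {x y} → x ≈ 1# → y ≈ 1# → x *ᴷ y ≈ 1#
    1*1 p q = 𝕂.trans (𝕂.*-cong p q) (𝕂.*-identityˡ _)

    st-tokens : ∀ S {δ z k} {μ : Position → Maybe A} → (∀ κ → z ≈ 1# ⊎ μ (b κ) ≡ nothing) →
                st (tokens δ z k S) μ ≈ 1#
    st-tokens (const _)   F = 𝕂.refl
    st-tokens (act u ε P) {δ} {z} {k} {μ} F = 1*1 head (st-tokens P (λ κ → F (+ 1 ∷ κ)))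
      where
      head : st (cell δ z (k [])) (λ α → μ (+ 1 ∷ + 1 ∷ α)) ≈ 1#
      head with k []
      ... | unfired = 𝕂.refl
      ... | outer _ = 𝕂.refl
      ... | inner _ with μ (+ 1 ∷ + 1 ∷ []) | F []
      ...   | nothing | _        = 𝕂.refl
      ...   | just _  | inj₁ z≈1 = z≈1
    st-tokens (◇ P)    F = 1*1 𝕂.refl (st-tokens P (λ κ → F (+ 1 ∷ κ)))
    st-tokens (P ∣ Q)  F = 1*1 (1*1 𝕂.refl (st-tokens P (λ κ → F (+ 1 ∷ κ))))
                               (1*1 𝕂.refl (st-tokens Q (λ κ → F (+ 2 ∷ κ))))
    st-tokens (P ∥ Q)  F = 1*1 (1*1 𝕂.refl (st-tokens P (λ κ → F (+ 1 ∷ κ))))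
                               (1*1 𝕂.refl (st-tokens Q (λ κ → F (+ 2 ∷ κ))))
    st-tokens (hide P) F = st-tokens P F

    0*ˡ : ∀ {x y} → x ≈ 0# → x *ᴷ y ≈ 0#
    0*ˡ p = 𝕂.trans (𝕂.*-congʳ p) (𝕂.zeroˡ _)

    0*ʳ : ∀ {x y} → y ≈ 0# → x *ᴷ y ≈ 0#
    0*ʳ p = 𝕂.trans (𝕂.*-congˡ p) (𝕂.zeroʳ _)

    st-token-fired : ∀ {S δ k κ i} {μ : Position → Maybe A} → Act S κ → k κ ≡ inner i →
                     Fired (μ (b κ)) → st (tokens δ 0# k S) μ ≈ 0#
    st-token-fired {μ = μ} here E (x , F) rewrite E with μ (+ 1 ∷ + 1 ∷ []) | F
    ... | just _ | refl = 0*ˡ 𝕂.refl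
    st-token-fired (act x)  E F = 0*ʳ (st-token-fired x E F)
    st-token-fired (◇ x)    E F = 0*ʳ (st-token-fired x E F)
    st-token-fired (∣ˡ x)   E F = 0*ˡ (0*ʳ (st-token-fired x E F))
    st-token-fired (∣ʳ x)   E F = 0*ʳ (0*ʳ (st-token-fired x E F))
    st-token-fired (∥ˡ x)   E F = 0*ˡ (0*ʳ (st-token-fired x E F))
    st-token-fired (∥ʳ x)   E F = 0*ʳ (0*ʳ (st-token-fired x E F))
    st-token-fired (hide x) E F = st-token-fired x E F

  Subject : {A : Set} → Kind → (ℕ → A) → A → A → Set
  Subject unfired   ch g g′ = g′ ≡ g
  Subject (inner i) ch g g′ = g′ ≡ g
  Subject (outer i) ch g g′ = g′ ≡ ch i

  data SVis {A : Set} (S : Term) (k : Position → Kind) (ch : ℕ → A) (e : Name → A)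
            (h : List ℕ → A) (μ : Position → Maybe A) (α : Position) (g : A) (ε : Sign) : Set c where
    main    : ∀ κ {g₀} → α ≡ a κ → Vis S e h μ κ g₀ ε → Subject (k κ) ch g₀ g → SVis S k ch e h μ α g ε
    confirm : ∀ κ i → α ≡ b κ → k κ ≡ inner i → Fired (μ κ) → Act S κ → ε ≡ neg → g ≡ ch i →
              SVis S k ch e h μ α g ε

  conn-S⁻ : ∀ S {k s q κ κ′} → Act S κ → Act S κ′ → Conn (trS k s q S) (a κ , a κ′) → Conn S (κ , κ′)
  conn-S⁻ (act u ε P) {k} x y C with k []
  conn-S⁻ (act u ε P) here y () | unfired
  conn-S⁻ (act u ε P) (act x) here () | unfired
  conn-S⁻ (act u ε P) (act x) (act y) (act ()) | unfired
  conn-S⁻ (act u ε P) (act x) (act y) (act (∥ʳ C)) | inner i = act (conn-S⁻ P x y C)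
  conn-S⁻ (act u ε P) (act x) (act y) (act (∥ʳ C)) | outer i = act (conn-S⁻ P x y C)
  conn-S⁻ (◇ P)    (◇ x)    (◇ y)    (◇ (∥ʳ C))  = ◇ conn-S⁻ P x y C
  conn-S⁻ (P ∣ Q)  (∣ˡ x)   (∣ˡ y)   (∣ˡ (∥ʳ C)) = ∣ˡ (conn-S⁻ P x y C)
  conn-S⁻ (P ∣ Q)  (∣ʳ x)   (∣ʳ y)   (∣ʳ (∥ʳ C)) = ∣ʳ (conn-S⁻ Q x y C)
  conn-S⁻ (P ∣ Q)  (∣ˡ x)   (∣ʳ y)   C           = sync x y
  conn-S⁻ (P ∣ Q)  (∣ʳ x)   (∣ˡ y)   ()
  conn-S⁻ (P ∥ Q)  (∥ˡ x)   (∥ˡ y)   (∥ˡ (∥ʳ C)) = ∥ˡ (conn-S⁻ P x y C)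
  conn-S⁻ (P ∥ Q)  (∥ʳ x)   (∥ʳ y)   (∥ʳ (∥ʳ C)) = ∥ʳ (conn-S⁻ Q x y C)
  conn-S⁻ (P ∥ Q)  (∥ˡ x)   (∥ʳ y)   ()
  conn-S⁻ (P ∥ Q)  (∥ʳ x)   (∥ˡ y)   ()
  conn-S⁻ (hide P) (hide x) (hide y) (hide C)    = hide (conn-S⁻ P x y C)

  conn-S⁺ : ∀ S {k s q κ κ′} → Conn S (κ , κ′) →
            Act (trS k s q S) (a κ) → Act (trS k s q S) (a κ′) → Conn (trS k s q S) (a κ , a κ′)
  conn-S⁺ (act u ε P) {k} (act C) x y with k []
  conn-S⁺ (act u ε P) (act C) (act ()) y | unfired
  conn-S⁺ (act u ε P) (act C) (act (∥ʳ x)) (act (∥ʳ y)) | inner i = act (∥ʳ (conn-S⁺ P C x y))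
  conn-S⁺ (act u ε P) (act C) (act (∥ʳ x)) (act (∥ʳ y)) | outer i = act (∥ʳ (conn-S⁺ P C x y))
  conn-S⁺ (◇ P)    (◇ C)      (◇ (∥ʳ x))  (◇ (∥ʳ y))  = ◇ ∥ʳ (conn-S⁺ P C x y)
  conn-S⁺ (P ∣ Q)  (∣ˡ C)     (∣ˡ (∥ʳ x)) (∣ˡ (∥ʳ y)) = ∣ˡ (∥ʳ (conn-S⁺ P C x y))
  conn-S⁺ (P ∣ Q)  (∣ʳ C)     (∣ʳ (∥ʳ x)) (∣ʳ (∥ʳ y)) = ∣ʳ (∥ʳ (conn-S⁺ Q C x y))
  conn-S⁺ (P ∣ Q)  (sync _ _) (∣ˡ x)      (∣ʳ y)      = sync x y
  conn-S⁺ (P ∥ Q)  (∥ˡ C)     (∥ˡ (∥ʳ x)) (∥ˡ (∥ʳ y)) = ∥ˡ (∥ʳ (conn-S⁺ P C x y))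
  conn-S⁺ (P ∥ Q)  (∥ʳ C)     (∥ʳ (∥ʳ x)) (∥ʳ (∥ʳ y)) = ∥ʳ (∥ʳ (conn-S⁺ Q C x y))
  conn-S⁺ (hide P) (hide C)   (hide x)    (hide y)    = hide (conn-S⁺ P C x y)

  module _ {A : Set} where

    private
      in-act : ∀ {u ε₀ P k ch e h x α g ε} {μ : Position → Maybe A} → μ [] ≡ just x →
               SVis P (k ∘ (+ 1 ∷_)) ch (x ▸ e) (h ∘ (1 ∷_)) (μ ∘ (+ 1 ∷_)) α g ε →
               SVis (act u ε₀ P) k ch e h μ (+ 1 ∷ + 2 ∷ α) g ε
      in-act m (main κ refl v s)            = main (+ 1 ∷ κ) refl (fired m v) s
      in-act m (confirm κ i refl p F o d q) = confirm (+ 1 ∷ κ) i refl p F (act o) d q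

    vis-S⁻ : ∀ S {k s q e′ h′ e α} {μ : Position → Maybe A} {g ε} → (∀ y → e′ (q y) ≡ e y) →
             Vis (trS k s q S) e′ h′ μ α g ε → SVis S k (e′ ∘ s) e (h′ ∘ aʰ) (μ ∘ a) α g ε
    vis-S⁻ (act u ε P) {k} E v with k [] in eq
    vis-S⁻ (act u ε P) {k} E (act m p) | unfired =
      main [] refl (act m refl) (subst (λ κ → Subject κ _ _ _) (sym eq) (trans p (E u)))
    vis-S⁻ (act u ε P) E (fired m ()) | unfired
    vis-S⁻ (act u ε P) E (act m p) | inner i =
      main [] refl (act m refl) (subst (λ κ → Subject κ _ _ _) (sym eq) (trans p (E u)))
    vis-S⁻ (act u ε P) E (fired m (∥ˡ (act m′ p))) | inner i =
      confirm [] i refl eq (_ , m) here refl p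
    vis-S⁻ (act u ε P) E (fired m (∥ˡ (fired m′ ()))) | inner i
    vis-S⁻ (act u ε P) E (fired m (∥ʳ v)) | inner i = in-act m (vis-S⁻ P (▸-ext E) v)
    vis-S⁻ (act u ε P) E (act m p) | outer i =
      main [] refl (act m refl) (subst (λ κ → Subject κ _ _ _) (sym eq) p)
    vis-S⁻ (act u ε P) E (fired m (∥ʳ v)) | outer i = in-act m (vis-S⁻ P (▸-ext E) v)
    vis-S⁻ (◇ P) E (◇ (∥ʳ v)) with vis-S⁻ P E v
    ... | main κ refl w s            = main (+ 1 ∷ κ) refl (◇ w) s
    ... | confirm κ i refl p F o d q = confirm (+ 1 ∷ κ) i refl p F (◇ o) d q
    vis-S⁻ (P ∣ Q) E (∣ˡ (∥ʳ v)) with vis-S⁻ P E v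
    ... | main κ refl w s            = main (+ 1 ∷ κ) refl (∣ˡ w) s
    ... | confirm κ i refl p F o d q = confirm (+ 1 ∷ κ) i refl p F (∣ˡ o) d q
    vis-S⁻ (P ∣ Q) E (∣ʳ (∥ʳ v)) with vis-S⁻ Q E v
    ... | main κ refl w s            = main (+ 2 ∷ κ) refl (∣ʳ w) s
    ... | confirm κ i refl p F o d q = confirm (+ 2 ∷ κ) i refl p F (∣ʳ o) d q
    vis-S⁻ (P ∥ Q) E (∥ˡ (∥ʳ v)) with vis-S⁻ P E v
    ... | main κ refl w s            = main (+ 1 ∷ κ) refl (∥ˡ w) s
    ... | confirm κ i refl p F o d q = confirm (+ 1 ∷ κ) i refl p F (∥ˡ o) d q
    vis-S⁻ (P ∥ Q) E (∥ʳ (∥ʳ v)) with vis-S⁻ Q E v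
    ... | main κ refl w s            = main (+ 2 ∷ κ) refl (∥ʳ w) s
    ... | confirm κ i refl p F o d q = confirm (+ 2 ∷ κ) i refl p F (∥ʳ o) d q
    vis-S⁻ (hide P) E (hide v) with vis-S⁻ P (▸-ext E) v
    ... | main κ refl w s            = main κ refl (hide w) s
    ... | confirm κ i refl p F o d q = confirm κ i refl p F (hide o) d q

    Allowed : (Position → Kind) → (Position → Maybe A) → Set
    Allowed k μ = ∀ {κ} → Fired (μ κ) → k κ ≢ unfired

    vis-S⁺ : ∀ {S k s q e′ h′ e κ} {μ : Position → Maybe A} {g g′ ε} → (∀ y → e′ (q y) ≡ e y) →
             Allowed k (μ ∘ a) → Vis S e (h′ ∘ aʰ) (μ ∘ a) κ g ε → Subject (k κ) (e′ ∘ s) g g′ →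
             Vis (trS k s q S) e′ h′ μ (a κ) g′ ε
    vis-S⁺ {k = k} E F (act m p) t with k []
    ... | unfired = act m (trans t (trans p (sym (E _))))
    ... | inner i = act m (trans t (trans p (sym (E _))))
    ... | outer i = act m t
    vis-S⁺ {k = k} E F (fired m v) t with k [] in eq
    ... | unfired = ⊥-elim (F (_ , m) eq)
    ... | inner i = fired m (∥ʳ (vis-S⁺ (▸-ext E) F v t))
    ... | outer i = fired m (∥ʳ (vis-S⁺ (▸-ext E) F v t))
    vis-S⁺ E F (◇ v)    t = ◇ ∥ʳ (vis-S⁺ E F v t)
    vis-S⁺ E F (∣ˡ v)   t = ∣ˡ (∥ʳ (vis-S⁺ E F v t))
    vis-S⁺ E F (∣ʳ v)   t = ∣ʳ (∥ʳ (vis-S⁺ E F v t))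
    vis-S⁺ E F (∥ˡ v)   t = ∥ˡ (∥ʳ (vis-S⁺ E F v t))
    vis-S⁺ E F (∥ʳ v)   t = ∥ʳ (∥ʳ (vis-S⁺ E F v t))
    vis-S⁺ E F (hide v) t = hide (vis-S⁺ (▸-ext E) F v t)

    vis-confirm : ∀ {S k s q e′ h′ κ i} {μ : Position → Maybe A} → Allowed k (μ ∘ a) →
                  Open S (μ ∘ a) κ → Fired (μ (a κ)) → k κ ≡ inner i → μ (b κ) ≡ nothing →
                  Vis (trS k s q S) e′ h′ μ (b κ) (e′ (s i)) neg
    vis-confirm F here (x , m) E z rewrite E = fired m (∥ˡ (act z refl))
    vis-confirm {k = k} F (fired (x , m) o) G E z with k [] in eq
    ... | unfired = ⊥-elim (F (_ , m) eq)
    ... | inner i = fired m (∥ʳ (vis-confirm F o G E z))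
    ... | outer i = fired m (∥ʳ (vis-confirm F o G E z))
    vis-confirm F (◇ o)    G E z = ◇ ∥ʳ (vis-confirm F o G E z)
    vis-confirm F (∣ˡ o)   G E z = ∣ˡ (∥ʳ (vis-confirm F o G E z))
    vis-confirm F (∣ʳ o)   G E z = ∣ʳ (∥ʳ (vis-confirm F o G E z))
    vis-confirm F (∥ˡ o)   G E z = ∥ˡ (∥ʳ (vis-confirm F o G E z))
    vis-confirm F (∥ʳ o)   G E z = ∥ʳ (∥ʳ (vis-confirm F o G E z))
    vis-confirm F (hide o) G E z = hide (vis-confirm F o G E z)

    -- `ν` describes the moment at which the action was reached and `μ` any later one: the zero
    -- exposed by the wrong firing is a factor of the state from then on.
    st-unfired : ∀ {B : Set} {S k s q κ} {ν : Position → Maybe B} {μ : Position → Maybe A} →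
                 Open S ν κ → k κ ≡ unfired → (∀ {κ} → Fired (ν κ) → k κ ≢ unfired) →
                 (∀ {κ} → Fired (ν κ) → Fired (μ (a κ))) → Fired (μ (a κ)) →
                 st (trS k s q S) μ ≈ 0#
    st-unfired {μ = μ} here E F G (x , m) rewrite E with μ [] | m
    ... | just _ | refl = 𝕂.refl
    st-unfired {k = k} {μ = μ} (fired m o) E F G H with k [] in eq | G m
    ... | unfired | _ = ⊥-elim (F m eq)
    ... | inner i | _ , m′ with μ [] | m′
    ...   | just _ | refl = 0*ʳ {A = A} (st-unfired o E F G H)
    st-unfired {k = k} {μ = μ} (fired m o) E F G H | outer i | _ , m′ with μ [] | m′
    ...   | just _ | refl = 0*ʳ {A = A} (st-unfired o E F G H)
    st-unfired (◇ o)    E F G H = 0*ʳ {A = A} (st-unfired o E F G H)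
    st-unfired (∣ˡ o)   E F G H = 0*ˡ {A = A} (0*ʳ {A = A} (st-unfired o E F G H))
    st-unfired (∣ʳ o)   E F G H = 0*ʳ {A = A} (0*ʳ {A = A} (st-unfired o E F G H))
    st-unfired (∥ˡ o)   E F G H = 0*ˡ {A = A} (0*ʳ {A = A} (st-unfired o E F G H))
    st-unfired (∥ʳ o)   E F G H = 0*ʳ {A = A} (0*ʳ {A = A} (st-unfired o E F G H))
    st-unfired (hide o) E F G H = st-unfired o E F G H

    st-S : ∀ S {k s q} {μ : Position → Maybe A} → Allowed k (μ ∘ a) → st (trS k s q S) μ ≈ st S (μ ∘ a)
    st-S (const k)   F = 𝕂.refl
    st-S (act u ε P) {k} {μ = μ} F with k [] in p | μ [] in q
    ... | unfired | just x  = ⊥-elim (F (x , q) p)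
    ... | unfired | nothing rewrite q = 𝕂.refl
    ... | inner i | nothing rewrite q = 𝕂.refl
    ... | outer i | nothing rewrite q = 𝕂.refl
    ... | outer i | just x  rewrite q = 𝕂.trans (𝕂.*-identityˡ _) (st-S P F)
    ... | inner i | just x  rewrite q = 𝕂.trans (𝕂.*-cong confirmed (st-S P F)) (𝕂.*-identityˡ _)
      where
      confirmed : maybe′ (λ _ → 1#) 1# (μ (+ 1 ∷ + 1 ∷ [])) ≈ 1#
      confirmed with μ (+ 1 ∷ + 1 ∷ [])
      ... | just _  = 𝕂.refl
      ... | nothing = 𝕂.refl
    st-S (◇ P)    F = 𝕂.trans (𝕂.*-identityˡ _) (st-S P F)
    st-S (P ∣ Q)  F = 𝕂.*-cong (𝕂.trans (𝕂.*-identityˡ _) (st-S P F)) (𝕂.trans (𝕂.*-identityˡ _) (st-S Q F))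
    st-S (P ∥ Q)  F = 𝕂.*-cong (𝕂.trans (𝕂.*-identityˡ _) (st-S P F)) (𝕂.trans (𝕂.*-identityˡ _) (st-S Q F))
    st-S (hide P) F = st-S P F

  -- Injectivity of the address translations, and valid histories.

  a⁻ : Position → Position
  a⁻ (i ∷ _ ∷ α) = i ∷ a⁻ α
  a⁻ _           = []

  a-left : ∀ κ → a⁻ (a κ) ≡ κ
  a-left []      = refl
  a-left (i ∷ κ) = cong (i ∷_) (a-left κ)

  a-inj : ∀ {κ κ′} → a κ ≡ a κ′ → κ ≡ κ′
  a-inj {κ} {κ′} e = trans (sym (a-left κ)) (trans (cong a⁻ e) (a-left κ′))

  b-inj : ∀ {κ κ′} → b κ ≡ b κ′ → κ ≡ κ′
  b-inj e = a-inj (List.++-cancelʳ _ _ _ e)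

  a≢b : ∀ κ κ′ → a κ ≢ b κ′
  a≢b (_ ∷ [])    []       ()
  a≢b (_ ∷ _ ∷ _) []       ()
  a≢b (_ ∷ κ)     (_ ∷ κ′) e = a≢b κ κ′ (List.∷-injectiveʳ (List.∷-injectiveʳ e))

  aʰ⁻ : List ℕ → List ℕ
  aʰ⁻ (zero ∷ r)      = 0 ∷ aʰ⁻ r
  aʰ⁻ (suc i ∷ _ ∷ r) = suc i ∷ aʰ⁻ r
  aʰ⁻ _               = []

  aʰ-left : ∀ r → aʰ⁻ (aʰ r) ≡ r
  aʰ-left []          = refl
  aʰ-left (zero ∷ r)  = cong (0 ∷_) (aʰ-left r)
  aʰ-left (suc i ∷ r) = cong (suc i ∷_) (aʰ-left r)

  ix : List Position → Position → ℕ
  ix []       α = 0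
  ix (β ∷ βs) α with α ≟ᵖ β
  ... | yes _ = 0
  ... | no _  = suc (ix βs α)

  ix-inj : ∀ βs {α α′} → α ∈ βs → α′ ∈ βs → ix βs α ≡ ix βs α′ → α ≡ α′
  ix-inj (β ∷ βs) {α} {α′} i j e with α ≟ᵖ β | α′ ≟ᵖ β
  ... | yes p | yes q = trans p (sym q)
  ix-inj (β ∷ βs) (here p)  j         e | no ¬p | no ¬q = ⊥-elim (¬p p)
  ix-inj (β ∷ βs) (there i) (here q)  e | no ¬p | no ¬q = ⊥-elim (¬q q)
  ix-inj (β ∷ βs) (there i) (there j) e | no ¬p | no ¬q = ix-inj βs i j (ℕ.suc-injective e)

  ix-< : ∀ βs {α} → α ∈ βs → ix βs α < length βs
  ix-< (β ∷ βs) {α} i with α ≟ᵖ β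
  ... | yes _ = s≤s z≤n
  ix-< (β ∷ βs) (here p)  | no ¬p = ⊥-elim (¬p p)
  ix-< (β ∷ βs) (there i) | no ¬p = s≤s (ix-< βs i)

  addresses : Path → List Position
  addresses = concatMap (λ (ι , κ) → ι ∷ κ ∷ [])

  ∈-addresses : ∀ {h l α} → l ∈ h → Touches α l → α ∈ addresses h
  ∈-addresses {α = α} i t = ∈-concatMap⁺ (λ (ι , κ) → ι ∷ κ ∷ []) (lose i (touched t))
    where
    touched : ∀ {l} → Touches α l → α ∈ proj₁ l ∷ proj₂ l ∷ []
    touched (inj₁ e) = here e
    touched (inj₂ e) = there (here e)

  fired-there : ∀ {A B : Set} {n : Label → A} {n′ : Label → B} h l {α} →
                Fired (mu n h α) → Fired (mu n′ (l ∷ h) α)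
  fired-there {n = n} h l {α} (x , m) with mu-label {n = n} h m
  ... | l′ , i , t , _ = mu-fired (l ∷ h) t (there i)

  open-mono : ∀ {A B : Set} {X ι} {μ : Position → Maybe A} {ν : Position → Maybe B} →
              (∀ {α} → Fired (μ α) → Fired (ν α)) → Open X μ ι → Open X ν ι
  open-mono F here        = here
  open-mono F (fired m o) = fired (F m) (open-mono F o)
  open-mono F (◇ o)       = ◇ open-mono F o
  open-mono F (∣ˡ o)      = ∣ˡ (open-mono F o)
  open-mono F (∣ʳ o)      = ∣ʳ (open-mono F o)
  open-mono F (∥ˡ o)      = ∥ˡ (open-mono F o)
  open-mono F (∥ʳ o)      = ∥ʳ (open-mono F o)
  open-mono F (hide o)    = hide (open-mono F o)

  open-acts′ : ∀ {A B : Set} {X ι} {μ : Position → Maybe A} {ν : Position → Maybe B} →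
               (∀ {α} → Act X α → Fired (μ α) → Fired (ν α)) → Open X μ ι → Open X ν ι
  open-acts′ F here        = here
  open-acts′ F (fired m o) = fired (F here m) (open-acts′ (λ x → F (act x)) o)
  open-acts′ F (◇ o)       = ◇ open-acts′ (λ x → F (◇ x)) o
  open-acts′ F (∣ˡ o)      = ∣ˡ (open-acts′ (λ x → F (∣ˡ x)) o)
  open-acts′ F (∣ʳ o)      = ∣ʳ (open-acts′ (λ x → F (∣ʳ x)) o)
  open-acts′ F (∥ˡ o)      = ∥ˡ (open-acts′ (λ x → F (∥ˡ x)) o)
  open-acts′ F (∥ʳ o)      = ∥ʳ (open-acts′ (λ x → F (∥ʳ x)) o)
  open-acts′ F (hide o)    = hide (open-acts′ (λ x → F (hide x)) o)

  -- Validity as in `SV N []`, but read backwards, for inductions on the latest label of a history.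
  data VH {A : Set} {X : Term} (N : Naming A X) : Path → Set c where
    []  : VH N []
    _∷_ : ∀ {l h} → Enabled N h l → VH N h → VH N (l ∷ h)

  module _ {A X} {N : Naming A X} where

    open Naming N using (n)

    sv⇒vh : ∀ {h p} → SV N h p → VH N h → VH N (p ʳ++ h)
    sv⇒vh []      W = W
    sv⇒vh (x ∷ V) W = sv⇒vh V (x ∷ W)

    vh⇒sv : ∀ {h} → VH N h → ∃[ p ] past p ≡ h × SV N [] p
    vh⇒sv [] = [] , refl , []
    vh⇒sv (_∷_ {l} {h} x W) with vh⇒sv W
    ... | p , e , V = p ++ [ l ] , trans (List.++-ʳ++ p) (cong (l ∷_) e)
                    , sv-++⁺ N V (subst (λ h → SV N h [ l ]) (sym e) (x ∷ []))

    vh-conn : ∀ {h} → VH N h → All (Conn X) h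
    vh-conn []                    = []
    vh-conn (enabled (C , _) ∷ W) = C ∷ vh-conn W

    vh-fresh : ∀ {h l α} → Enabled N h l → Touches α l → ∀ {m} → m ∈ h → ¬ Touches α m
    vh-fresh x t i t′ = enabled-fresh N i t′ x t

    vh-unique : ∀ {h l m α} → VH N h → l ∈ h → m ∈ h → Touches α l → Touches α m → l ≡ m
    vh-unique (x ∷ W) (here refl) (here refl) s t = refl
    vh-unique (x ∷ W) (here refl) (there j)   s t = ⊥-elim (vh-fresh x s j t)
    vh-unique (x ∷ W) (there i)   (here refl) s t = ⊥-elim (vh-fresh x t i s)
    vh-unique (x ∷ W) (there i)   (there j)   s t = vh-unique W i j s t

    vh-open : ∀ {h l α} → VH N h → l ∈ h → Touches α l → Open X (mu n h) α
    vh-open {l ∷ h} (enabled (_ , _ , _ , v , _) ∷ W) (here refl) (inj₁ refl) = vis-open (fired-there h l) v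
    vh-open {l ∷ h} (enabled (_ , _ , _ , _ , w) ∷ W) (here refl) (inj₂ refl) = vis-open (fired-there h l) w
    vh-open {l ∷ h} (x ∷ W) (there i) t = open-mono (fired-there h l) (vh-open W i t)

  module _ {t} {A : Set} (T : A → A → Set t) where

    -- A parametricity principle: the address alone decides which of the supplied names is the
    -- subject, so subjects are related as soon as the supplied names are.
    vis-two : ∀ {X e e₁ h h₁ ι} {μ μ₁ : Position → Maybe A} {g g₁ ε ε₁} →
              (∀ y → T (e y) (e₁ y)) → (∀ {r} → Hid X r → T (h r) (h₁ r)) →
              (∀ {κ x x₁} → μ κ ≡ just x → μ₁ κ ≡ just x₁ → T x x₁) →
              Vis X e h μ ι g ε → Vis X e₁ h₁ μ₁ ι g₁ ε₁ → T g g₁ × ε ≡ ε₁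
    vis-two E H G (act _ refl) (act _ refl) = E _ , refl
    vis-two E H G (fired m v)  (fired m₁ w) =
      vis-two (λ { zero → G m m₁ ; (suc y) → E y }) (λ r → H (act r)) G v w
    vis-two E H G (◇ v)    (◇ w)    = vis-two E (λ r → H (◇ r)) G v w
    vis-two E H G (∣ˡ v)   (∣ˡ w)   = vis-two E (λ r → H (∣ˡ r)) G v w
    vis-two E H G (∣ʳ v)   (∣ʳ w)   = vis-two E (λ r → H (∣ʳ r)) G v w
    vis-two E H G (∥ˡ v)   (∥ˡ w)   = vis-two E (λ r → H (∥ˡ r)) G v w
    vis-two E H G (∥ʳ v)   (∥ʳ w)   = vis-two E (λ r → H (∥ʳ r)) G v w
    vis-two E H G (hide v) (hide w) =
      vis-two (λ { zero → H here ; (suc y) → E y }) (λ r → H (hide r)) G v w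

  vis-subject : ∀ {t} {A : Set} (T : A → Set t) {X e h ι} {μ : Position → Maybe A} {g ε} →
                (∀ y → T (e y)) → (∀ {r} → Hid X r → T (h r)) → (∀ {κ x} → μ κ ≡ just x → T x) →
                Vis X e h μ ι g ε → T g
  vis-subject T E H G v = proj₁ (vis-two (λ x _ → T x) E H (λ m _ → G m) v v)

  conn-irrefl : ∀ {X α} → ¬ Conn X (α , α)
  conn-irrefl (act C)  = conn-irrefl C
  conn-irrefl (◇ C)    = conn-irrefl C
  conn-irrefl (∣ˡ C)   = conn-irrefl C
  conn-irrefl (∣ʳ C)   = conn-irrefl C
  conn-irrefl (∥ˡ C)   = conn-irrefl C
  conn-irrefl (∥ʳ C)   = conn-irrefl C
  conn-irrefl (hide C) = conn-irrefl C

  conn-asym : ∀ {X α β} → Conn X (α , β) → ¬ Conn X (β , α)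
  conn-asym (act C)    (act D)  = conn-asym C D
  conn-asym (◇ C)      (◇ D)    = conn-asym C D
  conn-asym (∣ˡ C)     (∣ˡ D)   = conn-asym C D
  conn-asym (∣ʳ C)     (∣ʳ D)   = conn-asym C D
  conn-asym (∥ˡ C)     (∥ˡ D)   = conn-asym C D
  conn-asym (∥ʳ C)     (∥ʳ D)   = conn-asym C D
  conn-asym (hide C)   (hide D) = conn-asym C D
  conn-asym (sync _ _) ()

  -- The test attached to a prescribed history.

  shift : ℕ → Name → Name
  shift N y = N + y

  RAddr SAddr : Position → Set
  RAddr α = ∃[ ι ] α ≡ + 1 ∷ + 2 ∷ ι
  SAddr α = ∃[ κ ] α ≡ + 2 ∷ κ

  -- The first component tells whether R takes part: R lies to the left of S, and `∥` keeps it from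
  -- reacting with P.
  RLabel : Label → Set
  RLabel l = RAddr (proj₁ l)

  rlabel? : ∀ l → Dec (RLabel l)
  rlabel? ([] , _)    = no λ ()
  rlabel? (_ ∷ [] , _) = no λ ()
  rlabel? (i ∷ j ∷ ι , _) with i ℤ.≟ + 1 | j ℤ.≟ + 2
  ... | yes refl | yes refl = yes (ι , refl)
  ... | no ¬p    | _        = no λ { (_ , refl) → ¬p refl }
  ... | yes _    | no ¬q    = no λ { (_ , refl) → ¬q refl }

  -- The actions of (P ∥ R) ∣ S are named after those of rename (shift N) P ∣ T,
  -- so that names in the two systems can be compared by equality.

  module Naming∥ (N : ℕ) where

    place : Position → Position
    place (+ 1 ∷ + 1 ∷ ι) = + 1 ∷ ι
    place (+ 1 ∷ + 2 ∷ ι) = + 2 ∷ + 1 ∷ + 1 ∷ ι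
    place (+ 2 ∷ κ)       = + 2 ∷ + 1 ∷ + 2 ∷ a κ
    place α               = α

    unplace : Position → Position
    unplace (+ 1 ∷ ι)             = + 1 ∷ + 1 ∷ ι
    unplace (+ 2 ∷ + 1 ∷ + 1 ∷ ι) = + 1 ∷ + 2 ∷ ι
    unplace (+ 2 ∷ + 1 ∷ + 2 ∷ α) = + 2 ∷ a⁻ α
    unplace α                     = α

    φ : Label → Label
    φ (ι , κ) = place ι , place κ

    -- The first `N` free names are the channels, so the names of the original system start at `N`.
    eX : Name → Src
    eX y = free (shift N y)

    ρh : List ℕ → List ℕ
    ρh (1 ∷ 1 ∷ r) = 1 ∷ r
    ρh (1 ∷ 2 ∷ r) = 2 ∷ 1 ∷ 1 ∷ r
    ρh (2 ∷ r)     = 2 ∷ 1 ∷ 2 ∷ aʰ r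
    ρh r           = r

    ρh⁻ : List ℕ → List ℕ
    ρh⁻ (1 ∷ r)         = 1 ∷ 1 ∷ r
    ρh⁻ (2 ∷ 1 ∷ 1 ∷ r) = 1 ∷ 2 ∷ r
    ρh⁻ (2 ∷ 1 ∷ 2 ∷ r) = 2 ∷ aʰ⁻ r
    ρh⁻ r               = r

    hX : List ℕ → Src
    hX r = hid (ρh r)

    nX : Label → Src
    nX l = ev (φ l)

    module _ {P R S : Term} where

      unplace-place : ∀ {α} → Act ((P ∥ R) ∣ S) α → unplace (place α) ≡ α
      unplace-place (∣ˡ (∥ˡ _)) = refl
      unplace-place (∣ˡ (∥ʳ _)) = refl
      unplace-place (∣ʳ {ι = κ} _) = cong (+ 2 ∷_) (a-left κ)

      place-inj : ∀ {α β} → Act ((P ∥ R) ∣ S) α → Act ((P ∥ R) ∣ S) β → place α ≡ place β → α ≡ β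
      place-inj x y e = trans (sym (unplace-place x)) (trans (cong unplace e) (unplace-place y))

      φ-inj : ∀ {l m} → Conn ((P ∥ R) ∣ S) l → Conn ((P ∥ R) ∣ S) m → φ l ≡ φ m → l ≡ m
      φ-inj C D e = cong₂ _,_
        (place-inj (proj₁ (conn-acts C)) (proj₁ (conn-acts D)) (cong proj₁ e))
        (place-inj (proj₂ (conn-acts C)) (proj₂ (conn-acts D)) (cong proj₂ e))

      ρh-left : ∀ {r} → Hid ((P ∥ R) ∣ S) r → ρh⁻ (ρh r) ≡ r
      ρh-left (∣ˡ (∥ˡ _)) = refl
      ρh-left (∣ˡ (∥ʳ _)) = refl
      ρh-left (∣ʳ {r = r} _) = cong (2 ∷_) (aʰ-left r)

      touch-φ : ∀ {α l} → Conn ((P ∥ R) ∣ S) l → Act ((P ∥ R) ∣ S) α → Touches (place α) (φ l) → Touches α l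
      touch-φ C x (inj₁ e) = inj₁ (place-inj x (proj₁ (conn-acts C)) e)
      touch-φ C x (inj₂ e) = inj₂ (place-inj x (proj₂ (conn-acts C)) e)

      conn-R : ∀ {l ι} → Conn ((P ∥ R) ∣ S) l → Touches (+ 1 ∷ + 2 ∷ ι) l → RLabel l
      conn-R (∣ˡ (∥ʳ _))     _ = _ , refl
      conn-R (sync (∥ʳ _) _) _ = _ , refl
      conn-R (∣ˡ (∥ˡ _)) (inj₁ ())
      conn-R (∣ˡ (∥ˡ _)) (inj₂ ())
      conn-R (∣ʳ _)      (inj₁ ())
      conn-R (∣ʳ _)      (inj₂ ())
      conn-R (sync (∥ˡ _) _) (inj₁ ())
      conn-R (sync (∥ˡ _) _) (inj₂ ())

      hid-inj : ∀ {r s} → hid r ≡ hid s → r ≡ s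
      hid-inj refl = refl

    naming∥ : ∀ P R S → Naming Src ((P ∥ R) ∣ S)
    naming∥ P R S = record
      { e = eX ; h = hX ; n = nX
      ; names = record
        { h-inj = λ p q e → trans (sym (ρh-left {P} {R} {S} p))
                              (trans (cong ρh⁻ (hid-inj {P} {R} {S} e)) (ρh-left q))
        ; n-inj = λ C D e → φ-inj C D (ev-inj e)
        ; h≢n   = λ _ _ () }
      ; out = record { f-inj = λ e → ℕ.+-cancelˡ-≡ N _ _ (free-inj e) ; f≢h = λ _ () ; f≢n = λ _ _ () } }
      where
      ev-inj : ∀ {l m} → ev l ≡ ev m → l ≡ m
      ev-inj refl = refl
      free-inj : ∀ {u v} → free u ≡ free v → u ≡ v
      free-inj refl = refl

  module Partners (R S P₀ : Term) (h₀ : Path) where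

    sites : List Position
    sites = addresses h₀

    N : ℕ
    N = length sites

    open Naming∥ N public

    label : Position → Maybe Label
    label = mu (λ l → l) h₀

    channel : Position → Maybe ℕ
    channel ι = maybe′ (λ l → just (ix sites (proj₁ l))) nothing (label (+ 1 ∷ + 2 ∷ ι))

    -- A synchronisation with R is numbered by its first address, a token by the address of its own
    -- action. The former address lies in R and the latter in S, so no number serves both purposes
    -- (`left≢token`).
    kind : Position → Kind
    kind κ with label (+ 2 ∷ κ)
    ... | nothing = unfired
    ... | just l with rlabel? l
    ...   | yes _ = outer (ix sites (proj₁ l))
    ...   | no _  = inner (ix sites (+ 2 ∷ κ))

    data KindView (κ : Position) : Kind → Set where
      unfired : mu (λ l → l) h₀ (+ 2 ∷ κ) ≡ nothing → KindView κ unfired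
      outer   : ∀ {l} → l ∈ h₀ → Touches (+ 2 ∷ κ) l → RLabel l → KindView κ (outer (ix sites (proj₁ l)))
      inner   : ∀ {l} → l ∈ h₀ → Touches (+ 2 ∷ κ) l → ¬ RLabel l → KindView κ (inner (ix sites (+ 2 ∷ κ)))

    label-just : ∀ {α l} → label α ≡ just l → l ∈ h₀ × Touches α l
    label-just e with mu-label h₀ e
    ... | l , i , t , refl = i , t

    kind-view : ∀ κ → KindView κ (kind κ)
    kind-view κ with label (+ 2 ∷ κ) in e
    ... | nothing = unfired e
    ... | just l with rlabel? l
    ...   | yes r = let i , t = label-just e in outer i t r
    ...   | no ¬r = let i , t = label-just e in inner i t ¬r

    channel-view : ∀ {ι i} → channel ι ≡ just i →
                   ∃[ l ] l ∈ h₀ × Touches (+ 1 ∷ + 2 ∷ ι) l × i ≡ ix sites (proj₁ l)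
    channel-view {ι} e with label (+ 1 ∷ + 2 ∷ ι) in eq
    channel-view refl | just l = let i , t = label-just eq in l , i , t , refl

    -- Built from `R`, `S` and the prescribed history, so one and the same test can be used against
    -- both `P` and `Q`.
    T : Term
    T = (trR channel id R ∣ trS kind id (shift N) S) ∣ (tokens pos 1# kind S ∣ tokens neg 0# kind S)

    Y : Term → Term
    Y P = rename (shift N) P ∣ T

    X : Term → Term
    X P = (P ∥ R) ∣ S

    NX : ∀ P → Naming Src (X P)
    NX P = naming∥ P R S

    module WithHistory (W₀ : VH (NX P₀) h₀) where

      unique₀ : ∀ {l m α} → l ∈ h₀ → m ∈ h₀ → Touches α l → Touches α m → l ≡ m
      unique₀ = vh-unique W₀

      conn₀ : ∀ {l} → l ∈ h₀ → Conn (X P₀) l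
      conn₀ = All.lookup (vh-conn W₀)

      kind-outer : ∀ {l κ} → l ∈ h₀ → Touches (+ 2 ∷ κ) l → RLabel l → kind κ ≡ outer (ix sites (proj₁ l))
      kind-outer {l} {κ} i t r with kind κ | kind-view κ
      ... | _ | unfired e = ⊥-elim (mu-nothing h₀ e i t)
      ... | _ | outer j s _ rewrite unique₀ j i s t = refl
      ... | _ | inner j s ¬r rewrite unique₀ j i s t = ⊥-elim (¬r r)

      kind-inner : ∀ {l κ} → l ∈ h₀ → Touches (+ 2 ∷ κ) l → ¬ RLabel l → kind κ ≡ inner (ix sites (+ 2 ∷ κ))
      kind-inner {l} {κ} i t ¬r with kind κ | kind-view κ
      ... | _ | unfired e = ⊥-elim (mu-nothing h₀ e i t)
      ... | _ | outer j s r rewrite unique₀ j i s t = ⊥-elim (¬r r)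
      ... | _ | inner j s _ = refl

      channel-of : ∀ {l ι} → l ∈ h₀ → Touches (+ 1 ∷ + 2 ∷ ι) l → channel ι ≡ just (ix sites (proj₁ l))
      channel-of {l} {ι} i t with label (+ 1 ∷ + 2 ∷ ι) in e
      ... | nothing = ⊥-elim (mu-nothing h₀ e i t)
      ... | just m  = let j , s = label-just e in cong (λ l → just (ix sites (proj₁ l))) (unique₀ j i s t)

      same-left : ∀ {l m} → l ∈ h₀ → m ∈ h₀ → ix sites (proj₁ l) ≡ ix sites (proj₁ m) → l ≡ m
      same-left {l} {m} i j e = unique₀ i j (inj₁ refl)
        (inj₁ (ix-inj sites (∈-addresses i (inj₁ refl)) (∈-addresses j (inj₁ refl)) e))

      left≢token : ∀ {l m κ} → l ∈ h₀ → RLabel l → m ∈ h₀ → Touches (+ 2 ∷ κ) m →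
                   ix sites (proj₁ l) ≢ ix sites (+ 2 ∷ κ)
      left≢token i (_ , refl) j t e with ix-inj sites (∈-addresses i (inj₁ refl)) (∈-addresses j t) e
      ... | ()

      channel-< : ∀ {ι i} → channel ι ≡ just i → i < N
      channel-< e with channel-view e
      ... | l , i , t , refl = ix-< sites (∈-addresses i (inj₁ refl))

      outer-< : ∀ {κ i} → kind κ ≡ outer i → i < N
      outer-< {κ} e with kind κ | kind-view κ
      outer-< refl | _ | outer i t r = ix-< sites (∈-addresses i (inj₁ refl))

      inner-< : ∀ {κ i} → kind κ ≡ inner i → i < N
      inner-< {κ} e with kind κ | kind-view κ
      inner-< refl | _ | inner i t r = ix-< sites (∈-addresses i t)

      inner-fired : ∀ {κ i} → kind κ ≡ inner i →
                    ∃[ l ] l ∈ h₀ × Touches (+ 2 ∷ κ) l × ¬ RLabel l × i ≡ ix sites (+ 2 ∷ κ)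
      inner-fired {κ} e with kind κ | kind-view κ
      inner-fired refl | _ | inner i t r = _ , i , t , r , refl

      outer-fired : ∀ {κ i} → kind κ ≡ outer i →
                    ∃[ l ] l ∈ h₀ × Touches (+ 2 ∷ κ) l × RLabel l × i ≡ ix sites (proj₁ l)
      outer-fired {κ} e with kind κ | kind-view κ
      outer-fired refl | _ | outer i t r = _ , i , t , r , refl

      inner-injective : ∀ {κ κ′ i} → kind κ ≡ inner i → kind κ′ ≡ inner i → κ ≡ κ′
      inner-injective e e′ with inner-fired e | inner-fired e′
      ... | _ , i , s , _ , p | _ , j , t , _ , q =
        List.∷-injectiveʳ (ix-inj sites (∈-addresses i s) (∈-addresses j t) (trans (sym p) q))

      r-label-right : ∀ {P l κ} → Conn (X P) l → RLabel l → Touches (+ 2 ∷ κ) l → proj₂ l ≡ + 2 ∷ κ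
      r-label-right C (_ , refl) (inj₁ ())
      r-label-right C r          (inj₂ e) = sym e

      outer-injective : ∀ {κ κ′ i} → kind κ ≡ outer i → kind κ′ ≡ outer i → κ ≡ κ′
      outer-injective e e′ with outer-fired e | outer-fired e′
      ... | l , i , s , r , p | m , j , t , r′ , q with same-left i j (trans (sym p) q)
      ...   | refl = List.∷-injectiveʳ (trans (sym (r-label-right (conn₀ i) r s)) (r-label-right (conn₀ i) r t))

  -- From the parallel composition to the test.

  module Simulation (R S P₀ : Term) (h₀ : Path) (W₀ : VH (Partners.NX R S P₀ h₀ P₀) h₀) where

    open Partners R S P₀ h₀
    open WithHistory W₀

    -- Agreement is required only on what R can notice: how its own actions have fired, and which
    -- actions of S have reacted with it.
    record Compatible (h h₁ : Path) : Set where
      field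
        on-R : ∀ {l m ι} → l ∈ h → m ∈ h₁ → Touches (+ 1 ∷ + 2 ∷ ι) l → Touches (+ 1 ∷ + 2 ∷ ι) m → l ≡ m
        on-S : ∀ {l m κ} → l ∈ h → m ∈ h₁ → Touches (+ 2 ∷ κ) l → Touches (+ 2 ∷ κ) m → RLabel m → l ≡ m

    open Compatible

    module _ {P P₁ : Term} {h h₁ : Path} (W : VH (NX P) h) (W₁ : VH (NX P₁) h₁) (K : Compatible h h₁) where

      private
        μ μ₁ : Position → Maybe Src
        μ  = mu nX h
        μ₁ = mu nX h₁

      -- Being separated from P by `∥`, R learns names only through its own synchronisations. Names
      -- that S shares only with P are thus never subjects of a reaction with R, and what P does
      -- cannot affect such a reaction except by using up actions of S.
      KnownToR : Src → Set c
      KnownToR g = (∃[ y ] g ≡ eX y) ⊎ (∃[ r ] Hid R r × g ≡ hX (1 ∷ 2 ∷ r)) ⊎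
                   (∃[ m ] m ∈ h₁ × RLabel m × g ≡ nX m)

      same-R : ∀ {ι g g₁ ε ε₁} →
               Vis R eX (λ r → hX (1 ∷ 2 ∷ r)) (λ κ → μ (+ 1 ∷ + 2 ∷ κ)) ι g ε →
               Vis R eX (λ r → hX (1 ∷ 2 ∷ r)) (λ κ → μ₁ (+ 1 ∷ + 2 ∷ κ)) ι g₁ ε₁ →
               g ≡ g₁ × ε ≡ ε₁
      same-R = vis-two _≡_ (λ _ → refl) (λ _ → refl) guard
        where
        guard : ∀ {κ x x₁} → μ (+ 1 ∷ + 2 ∷ κ) ≡ just x → μ₁ (+ 1 ∷ + 2 ∷ κ) ≡ just x₁ → x ≡ x₁
        guard e e₁ with mu-label {n = nX} h e | mu-label {n = nX} h₁ e₁
        ... | l , i , t , refl | m , j , s , refl = cong nX (on-R K i j t s)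

      known : ∀ {ι g ε} → Vis R eX (λ r → hX (1 ∷ 2 ∷ r)) (λ κ → μ₁ (+ 1 ∷ + 2 ∷ κ)) ι g ε → KnownToR g
      known = vis-subject KnownToR (λ y → inj₁ (y , refl)) (λ r → inj₂ (inj₁ (_ , r , refl))) guard
        where
        guard : ∀ {κ x} → μ₁ (+ 1 ∷ + 2 ∷ κ) ≡ just x → KnownToR x
        guard e with mu-label {n = nX} h₁ e
        ... | m , i , t , refl =
          inj₂ (inj₂ (m , i , conn-R {P₁} {R} {S} (All.lookup (vh-conn W₁) i) t , refl))

      same-S : ∀ {κ g g₁ ε ε₁} →
               Vis S eX (λ r → hX (2 ∷ r)) (λ κ → μ (+ 2 ∷ κ)) κ g ε →
               Vis S eX (λ r → hX (2 ∷ r)) (λ κ → μ₁ (+ 2 ∷ κ)) κ g₁ ε₁ →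
               KnownToR g₁ → g ≡ g₁ × ε ≡ ε₁
      same-S v w k with vis-two (λ g g₁ → KnownToR g₁ → g ≡ g₁) (λ _ _ → refl) (λ _ _ → refl) guard v w
        where
        guard : ∀ {κ x x₁} → μ (+ 2 ∷ κ) ≡ just x → μ₁ (+ 2 ∷ κ) ≡ just x₁ → KnownToR x₁ → x ≡ x₁
        guard e e₁ k with mu-label {n = nX} h e | mu-label {n = nX} h₁ e₁
        guard e e₁ (inj₁ (_ , ())) | l , i , t , refl | m , j , s , refl
        guard e e₁ (inj₂ (inj₁ (_ , _ , ()))) | l , i , t , refl | m , j , s , refl
        guard e e₁ (inj₂ (inj₂ (m′ , k , r , q))) | l , i , t , refl | m , j , s , refl
          with Names.n-inj (Naming.names (NX P₁)) (All.lookup (vh-conn W₁) j) (All.lookup (vh-conn W₁) k) q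
        ... | refl = cong nX (on-S K i j t s r)
      ... | f , e = f k , e

      VisR VisS : Position → Set c
      VisR ι = ∃[ g ] ∃[ ε ] Vis R eX (λ r → hX (1 ∷ 2 ∷ r)) (λ κ → μ (+ 1 ∷ + 2 ∷ κ)) ι g ε
      VisS κ = ∃[ g ] ∃[ ε ] Vis S eX (λ r → hX (2 ∷ r)) (λ κ → μ (+ 2 ∷ κ)) κ g ε

      -- The subjects agree in `h` because they agree in `h₁` and each has the same name in both
      -- histories: by `same-R` for an action of R, and by `same-S` for its partner in S, whose
      -- subject is known to R.
      transfer : ∀ {l} → Enabled (NX P₁) h₁ l → RLabel l →
                 (∀ {ι} → Touches (+ 1 ∷ + 2 ∷ ι) l → VisR ι) →
                 (∀ {κ} → Touches (+ 2 ∷ κ) l → VisS κ) → Enabled (NX P) h l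
      transfer (enabled (∣ˡ (∥ʳ C) , g , ε , ∣ˡ (∥ʳ v) , ∣ˡ (∥ʳ w))) r F G
        with F (inj₁ refl) | F (inj₂ refl)
      ... | _ , _ , v′ | _ , _ , w′ with same-R v′ v | same-R w′ w
      ...   | refl , refl | refl , refl = enabled (∣ˡ (∥ʳ C) , g , ε , ∣ˡ (∥ʳ v′) , ∣ˡ (∥ʳ w′))
      transfer (enabled (sync (∥ʳ x) y , g , ε , ∣ˡ (∥ʳ v) , ∣ʳ w)) r F G
        with F (inj₁ refl) | G (inj₂ refl)
      ... | _ , _ , v′ | _ , _ , w′ with same-R v′ v | same-S w′ w (known v)
      ...   | refl , refl | refl , refl = enabled (sync (∥ʳ x) y , g , ε , ∣ˡ (∥ʳ v′) , ∣ʳ w′)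
      transfer (enabled (∣ˡ (∥ˡ _) , _)) (_ , ())
      transfer (enabled (∣ʳ _ , _)) (_ , ())
      transfer (enabled (sync (∥ˡ _) _ , _)) (_ , ())

      transfer-open : ∀ {l} → Enabled (NX P₁) h₁ l → RLabel l →
                      (∀ {γ} → RAddr γ ⊎ SAddr γ → Fired (μ₁ γ) → Fired (μ γ)) →
                      (∀ {γ} → Touches γ l → μ γ ≡ nothing) → Enabled (NX P) h l
      transfer-open {l} x@(enabled (_ , g , ε , v , w)) r F U = transfer x r atR atS
        where
        on : ∀ {γ} → Touches γ l → ∃[ δ ] Vis (X P₁) eX hX μ₁ γ g δ
        on (inj₁ refl) = ε , v
        on (inj₂ refl) = opposite ε , w
        atR : ∀ {ι} → Touches (+ 1 ∷ + 2 ∷ ι) l → VisR ι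
        atR t with on t
        ... | _ , ∣ˡ (∥ʳ u) = open-vis (U t) (vis-open (F (inj₁ (_ , refl))) u)
        atS : ∀ {κ} → Touches (+ 2 ∷ κ) l → VisS κ
        atS t with on t
        ... | _ , ∣ʳ u = open-vis (U t) (vis-open (F (inj₂ (_ , refl))) u)

    -- An execution of Y P is an execution of X P interleaved with confirmations
    -- of the actions of kind inner.

    data Step : Set where
      main : Label → Step
      good : Position → Step

    emit : Step → Label
    emit (main l) = φ l
    emit (good κ) = + 2 ∷ + 1 ∷ + 2 ∷ b κ , + 2 ∷ + 2 ∷ + 1 ∷ b κ

    mains : List Step → Path
    mains []            = []
    mains (main l ∷ ts) = l ∷ mains ts
    mains (good _ ∷ ts) = mains ts

    Ok : Label → Set
    Ok l = (RLabel l → l ∈ h₀) × (¬ RLabel l → ∀ {κ} → Touches (+ 2 ∷ κ) l → ∃[ i ] kind κ ≡ inner i)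

    data TS (P : Term) : List Step → Set c where
      []   : TS P []
      main : ∀ {l ts} → Enabled (NX P) (mains ts) l → Ok l → TS P ts → TS P (main l ∷ ts)
      good : ∀ {κ i ts} → kind κ ≡ inner i → Fired (mu nX (mains ts) (+ 2 ∷ κ)) → good κ ∉ ts →
             TS P ts → TS P (good κ ∷ ts)

    place≢ : ∀ {P α κ} → Act (X P) α → + 2 ∷ + 1 ∷ + 2 ∷ b κ ≢ place α
    place≢ (∣ˡ (∥ˡ _)) ()
    place≢ (∣ˡ (∥ʳ _)) ()
    place≢ {κ = κ} (∣ʳ {ι = κ′} _) e =
      a≢b κ′ κ (sym (List.∷-injectiveʳ (List.∷-injectiveʳ (List.∷-injectiveʳ e))))

    place≢₂ : ∀ {P α β} → Act (X P) α → + 2 ∷ + 2 ∷ β ≢ place α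
    place≢₂ (∣ˡ (∥ˡ _)) ()
    place≢₂ (∣ˡ (∥ʳ _)) ()
    place≢₂ (∣ʳ _)      ()

    module _ {P : Term} where

      ts-vh : ∀ {ts} → TS P ts → VH (NX P) (mains ts)
      ts-vh []             = []
      ts-vh (main x _ V)   = x ∷ ts-vh V
      ts-vh (good _ _ _ V) = ts-vh V

      ts-ok : ∀ {ts l} → TS P ts → l ∈ mains ts → Ok l
      ts-ok (main _ o V)   (here refl) = o
      ts-ok (main _ o V)   (there i)   = ts-ok V i
      ts-ok (good _ _ _ V) i           = ts-ok V i

      ts-place : ∀ {ts α} → TS P ts → Act (X P) α →
                 mu ev (map emit ts) (place α) ≡ mu nX (mains ts) α
      ts-place []                               x = refl
      ts-place {main l ∷ ts} {α} (main (enabled (C , _)) _ V) x with touches? α l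
      ... | yes t = mu-hit {n = ev} {l = φ l} (map emit ts) (touched t)
        where
        touched : Touches α l → Touches (place α) (φ l)
        touched (inj₁ refl) = inj₁ refl
        touched (inj₂ refl) = inj₂ refl
      ... | no ¬t = trans (mu-miss {n = ev} {l = φ l} (map emit ts) (λ t → ¬t (touch-φ {P} {R} {S} C x t)))
                          (ts-place V x)
      ts-place {good κ ∷ ts} {α} (good _ _ _ V) x =
        trans (mu-miss {n = ev} {l = emit (good κ)} (map emit ts)
                [ (λ e → place≢ {P} {κ = κ} x (sym e)) , (λ e → place≢₂ {P} x (sym e)) ]′)
              (ts-place V x)

      ts-confirm : ∀ {ts κ} → TS P ts → good κ ∉ ts →
                   mu ev (map emit ts) (+ 2 ∷ + 1 ∷ + 2 ∷ b κ) ≡ nothing ×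
                   mu ev (map emit ts) (+ 2 ∷ + 2 ∷ + 1 ∷ b κ) ≡ nothing
      ts-confirm []       i = refl , refl
      ts-confirm {main l ∷ ts} {κ} (main (enabled (C , _)) _ V) i with ts-confirm V (i ∘ there) | conn-acts C
      ... | p , q | x , y =
          trans (mu-miss {n = ev} {l = φ l} (map emit ts) [ place≢ {P} {κ = κ} x , place≢ {P} {κ = κ} y ]′) p
        , trans (mu-miss {n = ev} {l = φ l} (map emit ts) [ place≢₂ {P} x , place≢₂ {P} y ]′) q
      ts-confirm {good κ′ ∷ ts} {κ} (good _ _ _ V) i with ts-confirm V (i ∘ there)
      ... | p , q =
          trans (mu-miss {n = ev} {l = emit (good κ′)} (map emit ts)
                  [ (λ e → other (List.∷-injectiveʳ (List.∷-injectiveʳ (List.∷-injectiveʳ e)))) , (λ ()) ]′) p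
        , trans (mu-miss {n = ev} {l = emit (good κ′)} (map emit ts)
                  [ (λ ()) , (λ e → other (List.∷-injectiveʳ (List.∷-injectiveʳ (List.∷-injectiveʳ e)))) ]′) q
        where
        other : b κ ≢ b κ′
        other e = i (here (cong good (b-inj {κ} {κ′} e)))

      ts-bad : ∀ {ts α} → TS P ts → mu ev (map emit ts) (+ 2 ∷ + 2 ∷ + 2 ∷ α) ≡ nothing
      ts-bad [] = refl
      ts-bad {main l ∷ ts} (main (enabled (C , _)) _ V) with conn-acts C
      ... | x , y = trans (mu-miss {n = ev} {l = φ l} (map emit ts) [ place≢₂ {P} x , place≢₂ {P} y ]′) (ts-bad V)
      ts-bad {good κ ∷ ts} (good _ _ _ V) =
        trans (mu-miss {n = ev} {l = emit (good κ)} (map emit ts) [ (λ ()) , (λ ()) ]′) (ts-bad V)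

      ts-good-fired : ∀ {ts κ} → TS P ts → good κ ∈ ts → Fired (mu nX (mains ts) (+ 2 ∷ κ))
      ts-good-fired (main {l} {ts} _ _ V) (there i) = fired-there (mains ts) l (ts-good-fired V i)
      ts-good-fired (good _ F _ V) (here refl) = F
      ts-good-fired (good _ _ _ V) (there i)   = ts-good-fired V i

      ts-conn : ∀ {ts l} → TS P ts → l ∈ mains ts → Conn (X P) l
      ts-conn V = All.lookup (vh-conn (ts-vh V))

      fired-R : ∀ {ts ι} → TS P ts → Fired (mu nX (mains ts) (+ 1 ∷ + 2 ∷ ι)) → Fired (channel ι)
      fired-R {ts} V (_ , e) with mu-label {n = nX} (mains ts) e
      ... | l , i , t , _ = _ , channel-of (proj₁ (ts-ok V i) (conn-R {P} {R} {S} (ts-conn V i) t)) t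

      fired-S : ∀ {ts κ} → TS P ts → Fired (mu nX (mains ts) (+ 2 ∷ κ)) → kind κ ≢ unfired
      fired-S {ts} V (_ , e) k with mu-label {n = nX} (mains ts) e
      ... | l , i , t , _ with rlabel? l
      ...   | yes r with trans (sym k) (kind-outer (proj₁ (ts-ok V i) r) t r)
      ...     | ()
      fired-S V (_ , e) k | l , i , t , _ | no ¬r with proj₂ (ts-ok V i) ¬r t
      ...   | _ , k′ with trans (sym k) k′
      ...     | ()

    module _ {P : Term} {ts : List Step} (V : TS P ts) where

      private
        μX μY : Position → Maybe Src
        μX = mu nX (mains ts)
        μY = mu ev (map emit ts)

      -- The hypotheses are about positions instead of actions because `allowed` and `channelled`
      -- quantify over all positions.
      fired-place : ∀ {α} → unplace (place α) ≡ α → (∀ {κ} → + 2 ∷ + 1 ∷ + 2 ∷ b κ ≢ place α) →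
                    (∀ {β} → + 2 ∷ + 2 ∷ β ≢ place α) → Fired (μY (place α)) → Fired (μX α)
      fired-place {α} u p q (_ , e) with mu-label {n = ev} (map emit ts) e
      ... | _ , i , t , _ with ∈-map⁻ emit i
      fired-place {α} u p q (_ , e) | _ , i , inj₁ t , _ | good κ , j , refl = ⊥-elim (p {κ} (sym t))
      fired-place {α} u p q (_ , e) | _ , i , inj₂ t , _ | good κ , j , refl = ⊥-elim (q (sym t))
      fired-place {α} u p q (_ , e) | _ , i , t , _ | main l , j , refl =
        mu-fired (mains ts) (touched t) (in-mains j)
        where
        in-mains : ∀ {ts l} → main l ∈ ts → l ∈ mains ts
        in-mains {main _ ∷ ts} (here refl) = here refl
        in-mains {main _ ∷ ts} (there j)   = there (in-mains j)
        in-mains {good _ ∷ ts} (there j)   = in-mains j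
        acts : Act (X P) (proj₁ l) × Act (X P) (proj₂ l)
        acts = conn-acts (ts-conn V (in-mains j))
        touched : Touches (place α) (φ l) → Touches α l
        touched (inj₁ t) = inj₁ (trans (sym u) (trans (cong unplace t) (unplace-place {P} {R} {S} (proj₁ acts))))
        touched (inj₂ t) = inj₂ (trans (sym u) (trans (cong unplace t) (unplace-place {P} {R} {S} (proj₂ acts))))

      allowed : Allowed kind (λ κ → μY (+ 2 ∷ + 1 ∷ + 2 ∷ a κ))
      allowed {κ} F = fired-S V (fired-place {+ 2 ∷ κ} (cong (+ 2 ∷_) (a-left κ))
        (λ {κ′} e → a≢b κ κ′ (sym (List.∷-injectiveʳ (List.∷-injectiveʳ (List.∷-injectiveʳ e))))) (λ ()) F)

      channelled : ∀ {ι} → Fired (μY (+ 2 ∷ + 1 ∷ + 1 ∷ ι)) → Fired (channel ι)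
      channelled {ι} F = fired-R V (fired-place {+ 1 ∷ + 2 ∷ ι} refl (λ ()) (λ ()) F)

      VisP⁺ : ∀ {ι g ε} → Vis P eX (λ r → hX (1 ∷ 1 ∷ r)) (λ α → μX (+ 1 ∷ + 1 ∷ α)) ι g ε →
              Vis (rename (shift N) P) free (λ r → hid (1 ∷ r)) (λ α → μY (+ 1 ∷ α)) ι g ε
      VisP⁺ v = vis-rename⁺ (shift N) (λ _ → refl) (vis-acts (λ x → ts-place V (∣ˡ (∥ˡ x))) v)

      VisP⁻ : ∀ {ι g ε} → Vis (rename (shift N) P) free (λ r → hid (1 ∷ r)) (λ α → μY (+ 1 ∷ α)) ι g ε →
              Vis P eX (λ r → hX (1 ∷ 1 ∷ r)) (λ α → μX (+ 1 ∷ + 1 ∷ α)) ι g ε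
      VisP⁻ v = vis-acts (λ x → sym (ts-place V (∣ˡ (∥ˡ x)))) (vis-rename⁻ P (shift N) (λ _ → refl) v)

      VisR⁺ : ∀ {ι g ε i} → channel ι ≡ just i →
              Vis R eX (λ r → hX (1 ∷ 2 ∷ r)) (λ α → μX (+ 1 ∷ + 2 ∷ α)) ι g ε →
              Vis (trR channel id R) free (λ r → hid (2 ∷ 1 ∷ 1 ∷ r)) (λ α → μY (+ 2 ∷ + 1 ∷ + 1 ∷ α)) ι (free i) ε
      VisR⁺ E v = vis-R⁺ channelled E (vis-acts (λ x → ts-place V (∣ˡ (∥ʳ x))) v)

      VisR⁻ : ∀ {ι g ε} →
              Vis (trR channel id R) free (λ r → hid (2 ∷ 1 ∷ 1 ∷ r)) (λ α → μY (+ 2 ∷ + 1 ∷ + 1 ∷ α)) ι g ε →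
              ∃[ i ] channel ι ≡ just i × g ≡ free i ×
              ∃[ g₀ ] Vis R eX (λ r → hX (1 ∷ 2 ∷ r)) (λ α → μX (+ 1 ∷ + 2 ∷ α)) ι g₀ ε
      VisR⁻ v with vis-R⁻ R {e = eX} {h = λ r → hX (1 ∷ 2 ∷ r)} v
      ... | i , E , p , g₀ , w = i , E , p , g₀ , vis-acts (λ x → sym (ts-place V (∣ˡ (∥ʳ x)))) w

      VisS⁺ : ∀ {κ g g′ ε} → Subject (kind κ) free g g′ →
              Vis S eX (λ r → hX (2 ∷ r)) (λ α → μX (+ 2 ∷ α)) κ g ε →
              Vis (trS kind id (shift N) S) free (λ r → hid (2 ∷ 1 ∷ 2 ∷ r)) (λ α → μY (+ 2 ∷ + 1 ∷ + 2 ∷ α)) (a κ) g′ ε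
      VisS⁺ t v = vis-S⁺ (λ _ → refl) allowed (vis-acts (λ x → ts-place V (∣ʳ x)) v) t

      VisS⁻ : ∀ {α g ε} →
              Vis (trS kind id (shift N) S) free (λ r → hid (2 ∷ 1 ∷ 2 ∷ r)) (λ α → μY (+ 2 ∷ + 1 ∷ + 2 ∷ α)) α g ε →
              SVis S kind free eX (λ r → hX (2 ∷ r)) (λ α → μX (+ 2 ∷ α)) α g ε
      VisS⁻ v with vis-S⁻ S {e = eX} (λ _ → refl) v
      ... | main κ e w s            = main κ e (vis-acts (λ x → sym (ts-place V (∣ʳ x))) w) s
      ... | confirm κ i e p (x , F) o d q = confirm κ i e p (x , trans (sym (ts-place V (∣ʳ o))) F) o d q

      NotOuter : Position → Set
      NotOuter κ = ∀ i → kind κ ≢ outer i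

      not-outer : ∀ {κ g} → NotOuter κ → Subject (kind κ) free g g
      not-outer {κ} n with kind κ
      ... | unfired = refl
      ... | inner _ = refl
      ... | outer i = ⊥-elim (n i refl)

      -- `NotOuter` is weaker than the second clause of `Ok`: it also admits actions of kind
      -- `unfired`, whose firing the test must be able to imitate for stuckness to carry over
      -- (`stuckX`).
      step-forward : ∀ {l} → Enabled (NX P) (mains ts) l → (RLabel l → l ∈ h₀) →
                     (¬ RLabel l → ∀ {κ} → Touches (+ 2 ∷ κ) l → NotOuter κ) →
                     Enabled (canonical (Y P)) (map emit ts) (φ l)
      step-forward (enabled (∣ˡ (∥ˡ C) , g , ε , ∣ˡ (∥ˡ v) , ∣ˡ (∥ˡ w))) r o =
        enabled (∣ˡ (conn-rename⁺ C) , g , ε , ∣ˡ (VisP⁺ v) , ∣ˡ (VisP⁺ w))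
      step-forward (enabled (∣ˡ (∥ʳ C) , g , ε , ∣ˡ (∥ʳ v) , ∣ˡ (∥ʳ w))) r o =
        enabled (∣ʳ (∣ˡ (∣ˡ (conn-R⁺ R C (vis-act v′) (vis-act w′)))) , _ , ε
                , ∣ʳ (∣ˡ (∣ˡ v′)) , ∣ʳ (∣ˡ (∣ˡ w′)))
        where
        v′ = VisR⁺ (channel-of (r (_ , refl)) (inj₁ refl)) v
        w′ = VisR⁺ (channel-of (r (_ , refl)) (inj₂ refl)) w
      step-forward (enabled (∣ʳ C , g , ε , ∣ʳ v , ∣ʳ w)) r o =
        enabled (∣ʳ (∣ˡ (∣ʳ (conn-S⁺ S C (vis-act v′) (vis-act w′)))) , g , ε
                , ∣ʳ (∣ˡ (∣ʳ v′)) , ∣ʳ (∣ˡ (∣ʳ w′)))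
        where
        v′ = VisS⁺ (not-outer (o (λ ()) (inj₁ refl))) v
        w′ = VisS⁺ (not-outer (o (λ ()) (inj₂ refl))) w
      step-forward (enabled (sync (∥ˡ x) y , g , ε , ∣ˡ (∥ˡ v) , ∣ʳ w)) r o =
        enabled (sync (act-rename⁺ x) (∣ˡ (∣ʳ (vis-act w′))) , g , ε , ∣ˡ (VisP⁺ v) , ∣ʳ (∣ˡ (∣ʳ w′)))
        where
        w′ = VisS⁺ (not-outer (o (λ ()) (inj₂ refl))) w
      step-forward (enabled (sync (∥ʳ x) y , g , ε , ∣ˡ (∥ʳ v) , ∣ʳ {ι = κ} w)) r o =
        enabled (∣ʳ (∣ˡ (sync (vis-act v′) (vis-act w′))) , _ , ε
                , ∣ʳ (∣ˡ (∣ˡ v′)) , ∣ʳ (∣ˡ (∣ʳ w′)))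
        where
        v′ = VisR⁺ (channel-of (r (_ , refl)) (inj₁ refl)) v
        w′ = VisS⁺ (subst (λ k → Subject k free _ _) (sym (kind-outer (r (_ , refl)) (inj₂ refl) (_ , refl))) refl) w

      good-forward : ∀ {κ i} → kind κ ≡ inner i → Fired (μX (+ 2 ∷ κ)) → good κ ∉ ts →
                     Enabled (canonical (Y P)) (map emit ts) (emit (good κ))
      good-forward {κ} {i} E (x , F) n with mu-label {n = nX} (mains ts) F
      ... | l , j , t , _ with vh-open (ts-vh V) j t
      ...   | ∣ʳ o =
        enabled (∣ʳ (sync (∣ʳ (vis-act v)) (∣ˡ (vis-act w))) , free i , neg , ∣ʳ (∣ˡ (∣ʳ v)) , ∣ʳ (∣ʳ (∣ˡ w)))
        where
        firedY : ∀ {κ} → Act S κ → Fired (μX (+ 2 ∷ κ)) → Fired (μY (+ 2 ∷ + 1 ∷ + 2 ∷ a κ))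
        firedY x (y , e) = y , trans (ts-place V (∣ʳ x)) e
        v = vis-confirm {h′ = λ r → hid (2 ∷ 1 ∷ 2 ∷ r)} {μ = λ α → μY (+ 2 ∷ + 1 ∷ + 2 ∷ α)} allowed
              (open-acts o) (firedY (open-act o) (x , F)) E (proj₁ (ts-confirm V n))
          where
          open-acts : ∀ {κ} → Open S (λ α → μX (+ 2 ∷ α)) κ → Open S (λ α → μY (+ 2 ∷ + 1 ∷ + 2 ∷ a α)) κ
          open-acts = open-acts′ (λ y → firedY y)
        w = vis-tokens⁺ {h = λ r → hid (2 ∷ 2 ∷ 1 ∷ r)} {μ = λ α → μY (+ 2 ∷ + 2 ∷ + 1 ∷ α)}
              (open-act o) E (proj₂ (ts-confirm V n))

      bad-forward : ∀ {κ i} → kind κ ≡ inner i → Act S κ → good κ ∉ ts →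
                    Enabled (canonical (Y P)) (map emit ts) (+ 2 ∷ + 2 ∷ + 1 ∷ b κ , + 2 ∷ + 2 ∷ + 2 ∷ b κ)
      bad-forward {κ} {i} E x n =
        enabled (∣ʳ (∣ʳ (sync (vis-act v) (vis-act w))) , free i , pos , ∣ʳ (∣ʳ (∣ˡ v)) , ∣ʳ (∣ʳ (∣ʳ w)))
        where
        v = vis-tokens⁺ {h = λ r → hid (2 ∷ 2 ∷ 1 ∷ r)} {μ = λ α → μY (+ 2 ∷ + 2 ∷ + 1 ∷ α)}
              x E (proj₂ (ts-confirm V n))
        w = vis-tokens⁺ {h = λ r → hid (2 ∷ 2 ∷ 2 ∷ r)} {μ = λ α → μY (+ 2 ∷ + 2 ∷ + 2 ∷ α)}
              x E (ts-bad V)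

  -- From the test back to the parallel composition.

  vh-at : ∀ {A X} {N : Naming A X} {h l} → VH N h → l ∈ h →
          ∃[ h₁ ] VH N h₁ × Enabled N h₁ l × (∀ {m} → m ∈ h₁ → m ∈ h)
  vh-at (x ∷ W) (here refl) = _ , W , x , there
  vh-at (x ∷ W) (there i) with vh-at W i
  ... | h₁ , W₁ , y , f = h₁ , W₁ , y , there ∘ f

  neg≢opposite-neg : ∀ {ε} → ε ≡ neg → opposite ε ≢ neg
  neg≢opposite-neg refl ()

  module Backward (R S P₀ : Term) (h₀ : Path) (W₀ : VH (Partners.NX R S P₀ h₀ P₀) h₀) where

    open Partners R S P₀ h₀
    open WithHistory W₀
    open Simulation R S P₀ h₀ W₀

    module _ {P : Term} {ts : List Step} (V : TS P ts) where

      private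
        μX μY : Position → Maybe Src
        μX = mu nX (mains ts)
        μY = mu ev (map emit ts)

      -- The pattern can be left only by `bad` or `wrong`, and either of them fixes the weight at 0
      -- for good (`Dead`).
      data Class (l : Label) : Set c where
        step  : ∀ t → emit t ≡ l → TS P (t ∷ ts) → Class l
        bad   : ∀ κ i → kind κ ≡ inner i → good κ ∉ ts → Act S κ →
                l ≡ (+ 2 ∷ + 2 ∷ + 1 ∷ b κ , + 2 ∷ + 2 ∷ + 2 ∷ b κ) → Class l
        wrong : ∀ l′ → φ l′ ≡ l → Enabled (NX P) (mains ts) l′ →
                ∀ κ → Touches (+ 2 ∷ κ) l′ → kind κ ≡ unfired →
                Open S (λ α → μX (+ 2 ∷ α)) κ → Class l

      -- Subjects that stem from P, or from actions of S that keep their own subject, are never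
      -- channels; hence an action on a channel can react only with another one on a channel.
      OffChannel : Src → Set
      OffChannel g = ∀ {i} → i < N → g ≢ free i

      offX : ∀ y → OffChannel (eX y)
      offX y i<N refl = ℕ.m+n≮m N y i<N

      offP : ∀ {ι g ε} → Vis P eX (λ r → hX (1 ∷ 1 ∷ r)) (λ α → μX (+ 1 ∷ + 1 ∷ α)) ι g ε → OffChannel g
      offP = vis-subject OffChannel offX (λ _ _ ()) event
        where
        event : ∀ {κ x} → μX (+ 1 ∷ + 1 ∷ κ) ≡ just x → OffChannel x
        event e _ q with mu-label {n = nX} (mains ts) e
        event e _ () | _ , _ , _ , refl

      offS : ∀ {κ g ε} → Vis S eX (λ r → hX (2 ∷ r)) (λ α → μX (+ 2 ∷ α)) κ g ε → OffChannel g
      offS = vis-subject OffChannel offX (λ _ _ ()) event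
        where
        event : ∀ {κ x} → μX (+ 2 ∷ κ) ≡ just x → OffChannel x
        event e _ q with mu-label {n = nX} (mains ts) e
        event e _ () | _ , _ , _ , refl

      data SView (α : Position) (g : Src) (ε : Sign) : Set c where
        inner   : ∀ κ i → α ≡ a κ → kind κ ≡ inner i →
                  Vis S eX (λ r → hX (2 ∷ r)) (λ β → μX (+ 2 ∷ β)) κ g ε → SView α g ε
        unfired : ∀ κ → α ≡ a κ → kind κ ≡ unfired →
                  Vis S eX (λ r → hX (2 ∷ r)) (λ β → μX (+ 2 ∷ β)) κ g ε → SView α g ε
        outer   : ∀ κ i {g₀} → α ≡ a κ → kind κ ≡ outer i → g ≡ free i →
                  Vis S eX (λ r → hX (2 ∷ r)) (λ β → μX (+ 2 ∷ β)) κ g₀ ε → SView α g ε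
        confirm : ∀ κ i → α ≡ b κ → kind κ ≡ inner i → Fired (μX (+ 2 ∷ κ)) → ε ≡ neg → g ≡ free i →
                  SView α g ε

      sview : ∀ {α g ε} →
              Vis (trS kind id (shift N) S) free (λ r → hid (2 ∷ 1 ∷ 2 ∷ r)) (λ β → μY (+ 2 ∷ + 1 ∷ + 2 ∷ β)) α g ε →
              SView α g ε
      sview {α} {g} {ε} v with VisS⁻ V v
      ... | confirm κ i e k F _ d q = confirm κ i e k F d q
      ... | main κ {g₀} e w s = by (kind κ) refl s
        where
        by : ∀ k → kind κ ≡ k → Subject k free g₀ g → SView α g ε
        by unfired   q refl = unfired κ e q w
        by (inner i) q refl = inner κ i e q w
        by (outer i) q p    = outer κ i e q p w

      no-inner : ∀ {k : Kind} {i j : ℕ} → k ≡ inner i → k ≡ outer j → ⊥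
      no-inner refl ()

      ok-P : ∀ {ι κ} → Ok (+ 1 ∷ + 1 ∷ ι , + 1 ∷ + 1 ∷ κ)
      ok-P = (λ ()) , (λ { _ (inj₁ ()) ; _ (inj₂ ()) })

      ok-R : ∀ {l} → l ∈ h₀ → RLabel l → Ok l
      ok-R i r = (λ _ → i) , (λ ¬r → ⊥-elim (¬r r))

      h₀-compatible : ∀ {h₁} → (∀ {m} → m ∈ h₁ → m ∈ h₀) → Compatible (mains ts) h₁
      h₀-compatible {h₁} f = record
        { on-R = λ i j s t → unique₀ (proj₁ (ts-ok V i) (conn-R {P} {R} {S} (ts-conn V i) s)) (f j) s t
        ; on-S = on-S′ }
        where
        on-S′ : ∀ {l m κ} → l ∈ mains ts → m ∈ h₁ → Touches (+ 2 ∷ κ) l → Touches (+ 2 ∷ κ) m → RLabel m → l ≡ m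
        on-S′ {l} i j s t r with rlabel? l
        ... | yes r′ = unique₀ (proj₁ (ts-ok V i) r′) (f j) s t
        ... | no ¬r′ = ⊥-elim (no-inner (proj₂ (proj₂ (ts-ok V i) ¬r′ s)) (kind-outer (f j) t r))

      -- The label was enabled at some moment of the prescribed history, and the current one agrees
      -- with that moment on everything R can notice, so `transfer` applies.
      prescribed : ∀ {l} → l ∈ h₀ → RLabel l →
                   (∀ {ι} → Touches (+ 1 ∷ + 2 ∷ ι) l →
                      ∃[ g ] ∃[ ε ] Vis R eX (λ r → hX (1 ∷ 2 ∷ r)) (λ κ → μX (+ 1 ∷ + 2 ∷ κ)) ι g ε) →
                   (∀ {κ} → Touches (+ 2 ∷ κ) l →
                      ∃[ g ] ∃[ ε ] Vis S eX (λ r → hX (2 ∷ r)) (λ β → μX (+ 2 ∷ β)) κ g ε) →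
                   TS P (main l ∷ ts)
      prescribed i r F G with vh-at W₀ i
      ... | h₁ , W₁ , x , f = main (transfer (ts-vh V) W₁ (h₀-compatible f) x r F G) (ok-R i r) V

      token-fresh : ∀ {κ} → μY (+ 2 ∷ + 2 ∷ + 1 ∷ b κ) ≡ nothing → good κ ∉ ts
      token-fresh e i = mu-nothing {n = ev} (map emit ts) e (∈-map⁺ emit i) (inj₂ refl)

      free-inj : ∀ {i j} → free i ≡ free j → i ≡ j
      free-inj refl = refl

      -- The cases are the places in `Y P` of the two reacting actions. On a channel the number
      -- identifies the users: `same-left` for the two ends of a synchronisation with R,
      -- `inner-injective` for a claim and its tokens, and `left≢token` rules out mixtures.
      backward : ∀ {l} → Enabled (canonical (Y P)) (map emit ts) l → Class l
      backward (enabled (∣ˡ C , g , ε , ∣ˡ v , ∣ˡ w)) =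
        step (main (+ 1 ∷ + 1 ∷ _ , + 1 ∷ + 1 ∷ _)) refl
          (main (enabled (∣ˡ (∥ˡ (conn-rename⁻ P C)) , g , ε , ∣ˡ (∥ˡ (VisP⁻ V v)) , ∣ˡ (∥ˡ (VisP⁻ V w)))) ok-P V)
      backward (enabled (sync x y , g , ε , ∣ˡ v , ∣ʳ (∣ˡ (∣ˡ w)))) with VisR⁻ V w
      ... | i , E , p , _ = ⊥-elim (offP (VisP⁻ V v) (channel-< E) p)
      backward (enabled (sync x y , g , ε , ∣ˡ v , ∣ʳ (∣ˡ (∣ʳ w)))) with sview w
      ... | outer κ i e k p _ = ⊥-elim (offP (VisP⁻ V v) (outer-< k) p)
      ... | confirm κ i e k _ _ p = ⊥-elim (offP (VisP⁻ V v) (inner-< k) p)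
      ... | unfired κ refl k u =
        wrong (+ 1 ∷ + 1 ∷ _ , + 2 ∷ κ) refl
          (enabled (sync (∥ˡ (act-rename⁻ P x)) (vis-act u) , g , ε , ∣ˡ (∥ˡ (VisP⁻ V v)) , ∣ʳ u))
          κ (inj₂ refl) k (vis-open id u)
      ... | inner κ i refl k u =
        step (main (+ 1 ∷ + 1 ∷ _ , + 2 ∷ κ)) refl
          (main (enabled (sync (∥ˡ (act-rename⁻ P x)) (vis-act u) , g , ε , ∣ˡ (∥ˡ (VisP⁻ V v)) , ∣ʳ u))
            ((λ ()) , (λ { _ (inj₁ ()) ; _ (inj₂ refl) → i , k })) V)
      backward (enabled (sync x y , g , ε , ∣ˡ v , ∣ʳ (∣ʳ (∣ˡ w)))) with vis-tokens⁻ S w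
      ... | κ , i , _ , k , _ , p , _ = ⊥-elim (offP (VisP⁻ V v) (inner-< k) p)
      backward (enabled (sync x y , g , ε , ∣ˡ v , ∣ʳ (∣ʳ (∣ʳ w)))) with vis-tokens⁻ S w
      ... | κ , i , _ , k , _ , p , _ = ⊥-elim (offP (VisP⁻ V v) (inner-< k) p)
      backward (enabled (∣ʳ (∣ˡ (∣ˡ {ι = ι} {κ = κ} C)) , g , ε , ∣ʳ (∣ˡ (∣ˡ v)) , ∣ʳ (∣ˡ (∣ˡ w))))
        with VisR⁻ V v | VisR⁻ V w
      ... | i , E , p , g₁ , v′ | j , F , q , g₂ , w′ with channel-view {ι} E | channel-view {κ} F
      ...   | l , k , t , refl | m , n , s , refl with same-left k n (free-inj (trans (sym p) q))
      ...     | refl = found t s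
        where
        found : Touches (+ 1 ∷ + 2 ∷ ι) l → Touches (+ 1 ∷ + 2 ∷ κ) l → Class _
        found (inj₁ refl) (inj₁ refl) = ⊥-elim (conn-irrefl C)
        found (inj₂ refl) (inj₂ refl) = ⊥-elim (conn-irrefl C)
        -- Here the label would be the prescribed one reversed, but a pair of actions synchronises
        -- in one orientation only.
        found (inj₂ refl) (inj₁ refl) = ⊥-elim (conn-asym (conn₀ k) (∣ˡ (∥ʳ (conn-R⁻ R C))))
        found (inj₁ refl) (inj₂ refl) = step (main l) refl
          (prescribed k (_ , refl) (λ { (inj₁ refl) → _ , _ , v′ ; (inj₂ refl) → _ , _ , w′ })
                                   (λ { (inj₁ ()) ; (inj₂ ()) }))
      backward (enabled (∣ʳ (∣ˡ (∣ʳ C)) , g , ε , ∣ʳ (∣ˡ (∣ʳ v)) , ∣ʳ (∣ˡ (∣ʳ w)))) with sview v | sview w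
      -- All claims are negative, so two of them never react.
      ... | confirm _ _ _ _ _ d _    | confirm _ _ _ _ _ d′ _  = ⊥-elim (neg≢opposite-neg d d′)
      ... | confirm κ i _ k _ _ p    | inner κ′ _ _ _ u        = ⊥-elim (offS u (inner-< k) p)
      ... | confirm κ i _ k _ _ p    | unfired κ′ _ _ u        = ⊥-elim (offS u (inner-< k) p)
      ... | inner _ _ _ _ u          | confirm κ i _ k _ _ p   = ⊥-elim (offS u (inner-< k) p)
      ... | unfired _ _ _ u          | confirm κ i _ k _ _ p   = ⊥-elim (offS u (inner-< k) p)
      ... | outer κ i _ k p _        | inner _ _ _ _ u         = ⊥-elim (offS u (outer-< k) p)
      ... | outer κ i _ k p _        | unfired _ _ _ u         = ⊥-elim (offS u (outer-< k) p)
      ... | inner _ _ _ _ u          | outer κ i _ k p _       = ⊥-elim (offS u (outer-< k) p)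
      ... | unfired _ _ _ u          | outer κ i _ k p _       = ⊥-elim (offS u (outer-< k) p)
      ... | outer κ i _ k p _        | confirm κ′ j _ k′ _ _ q = ⊥-elim (crossed k k′ (trans (sym p) q))
        where
        crossed : ∀ {κ κ′ i j} → kind κ ≡ outer i → kind κ′ ≡ inner j → free i ≢ free j
        crossed k k′ refl with outer-fired k | inner-fired k′
        ... | _ , x , _ , r , e | _ , y , t , _ , e′ = left≢token x r y t (trans (sym e) e′)
      ... | confirm κ′ j _ k′ _ _ q  | outer κ i _ k p _ with outer-fired k | inner-fired k′
      ...   | _ , x , _ , r , e | _ , y , t , _ , e′ =
        ⊥-elim (left≢token x r y t (trans (sym e) (trans (free-inj (trans (sym p) q)) e′)))
      -- A channel of a synchronisation with R has a single user in S, and this action cannot react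
      -- with itself.
      backward (enabled (∣ʳ (∣ˡ (∣ʳ C)) , g , ε , ∣ʳ (∣ˡ (∣ʳ v)) , ∣ʳ (∣ˡ (∣ʳ w))))
          | outer κ i refl k p _ | outer κ′ j refl k′ q _
        with outer-injective k (subst (λ i → kind κ′ ≡ outer i) (free-inj (trans (sym q) p)) k′)
      ...   | refl = ⊥-elim (conn-irrefl C)
      backward (enabled (∣ʳ (∣ˡ (∣ʳ C)) , g , ε , ∣ʳ (∣ˡ (∣ʳ v)) , ∣ʳ (∣ˡ (∣ʳ w))))
          | unfired κ refl k u | unfired κ′ refl k′ u′ =
        wrong (+ 2 ∷ κ , + 2 ∷ κ′) refl
          (enabled (∣ʳ (conn-S⁻ S (vis-act u) (vis-act u′) C) , g , ε , ∣ʳ u , ∣ʳ u′)) κ (inj₁ refl) k (vis-open id u)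
      backward (enabled (∣ʳ (∣ˡ (∣ʳ C)) , g , ε , ∣ʳ (∣ˡ (∣ʳ v)) , ∣ʳ (∣ˡ (∣ʳ w))))
          | unfired κ refl k u | inner κ′ _ refl k′ u′ =
        wrong (+ 2 ∷ κ , + 2 ∷ κ′) refl
          (enabled (∣ʳ (conn-S⁻ S (vis-act u) (vis-act u′) C) , g , ε , ∣ʳ u , ∣ʳ u′)) κ (inj₁ refl) k (vis-open id u)
      backward (enabled (∣ʳ (∣ˡ (∣ʳ C)) , g , ε , ∣ʳ (∣ˡ (∣ʳ v)) , ∣ʳ (∣ˡ (∣ʳ w))))
          | inner κ _ refl k u | unfired κ′ refl k′ u′ =
        wrong (+ 2 ∷ κ , + 2 ∷ κ′) refl
          (enabled (∣ʳ (conn-S⁻ S (vis-act u) (vis-act u′) C) , g , ε , ∣ʳ u , ∣ʳ u′)) κ′ (inj₂ refl) k′ (vis-open id u′)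
      backward (enabled (∣ʳ (∣ˡ (∣ʳ C)) , g , ε , ∣ʳ (∣ˡ (∣ʳ v)) , ∣ʳ (∣ˡ (∣ʳ w))))
          | inner κ i refl k u | inner κ′ j refl k′ u′ =
        step (main (+ 2 ∷ κ , + 2 ∷ κ′)) refl
          (main (enabled (∣ʳ (conn-S⁻ S (vis-act u) (vis-act u′) C) , g , ε , ∣ʳ u , ∣ʳ u′))
            ((λ ()) , (λ { _ (inj₁ refl) → i , k ; _ (inj₂ refl) → j , k′ })) V)
      backward (enabled (∣ʳ (∣ˡ (sync {ι = ι} x y)) , g , ε , ∣ʳ (∣ˡ (∣ˡ v)) , ∣ʳ (∣ˡ (∣ʳ w))))
        with VisR⁻ V v | sview w
      ... | i , E , p , _ | inner κ _ _ _ u   = ⊥-elim (offS u (channel-< E) p)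
      ... | i , E , p , _ | unfired κ _ _ u   = ⊥-elim (offS u (channel-< E) p)
      ... | i , E , p , _ | confirm κ j _ k _ _ q with channel-view {ι} E | inner-fired k
      ...   | l , m , t , refl | _ , n , s , _ , e =
        ⊥-elim (left≢token m (conn-R {P₀} {R} {S} (conn₀ m) t) n s (trans (free-inj (trans (sym p) q)) e))
      backward (enabled (∣ʳ (∣ˡ (sync {ι = ι} x y)) , g , ε , ∣ʳ (∣ˡ (∣ˡ v)) , ∣ʳ (∣ˡ (∣ʳ w))))
          | i , E , p , g₁ , v′ | outer κ j refl k q u with channel-view {ι} E | outer-fired k
      ...   | l , m , t , refl | l′ , n , s , r , e with same-left m n (trans (free-inj (trans (sym p) q)) e)
      ...     | refl = found t (r-label-right (conn₀ m) r s)
        where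
        found : Touches (+ 1 ∷ + 2 ∷ ι) l → proj₂ l ≡ + 2 ∷ κ → Class _
        found (inj₂ refl) ()
        found (inj₁ refl) refl = step (main l) refl
          (prescribed m r (λ { (inj₁ refl) → _ , _ , v′ ; (inj₂ ()) })
                          (λ { (inj₁ ()) ; (inj₂ refl) → _ , _ , u }))
      backward (enabled (∣ʳ (∣ʳ (∣ˡ C)) , _)) = ⊥-elim (conn-tokens S C)
      backward (enabled (∣ʳ (∣ʳ (∣ʳ C)) , _)) = ⊥-elim (conn-tokens S C)
      backward (enabled (∣ʳ (∣ʳ (sync x y)) , g , ε , ∣ʳ (∣ʳ (∣ˡ v)) , ∣ʳ (∣ʳ (∣ʳ w))))
        with vis-tokens⁻ S v | vis-tokens⁻ S w
      ... | κ , i , refl , k , _ , p , o | κ′ , j , refl , k′ , _ , q , _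
        with inner-injective k (subst (λ i → kind κ′ ≡ inner i) (free-inj (trans (sym q) p)) k′)
      ...   | refl = bad κ i k (token-fresh (vis-unfired v)) o refl
      backward (enabled (∣ʳ (sync x y) , g , ε , ∣ʳ (∣ˡ (∣ˡ {ι = ι} v)) , ∣ʳ (∣ʳ (∣ˡ w))))
        with VisR⁻ V v | vis-tokens⁻ S w
      ... | i , E , p , _ | κ , j , _ , k , _ , q , _ with channel-view {ι} E | inner-fired k
      ...   | l , m , t , refl | _ , n , s , _ , e =
        ⊥-elim (left≢token m (conn-R {P₀} {R} {S} (conn₀ m) t) n s (trans (free-inj (trans (sym p) q)) e))
      backward (enabled (∣ʳ (sync x y) , g , ε , ∣ʳ (∣ˡ (∣ˡ {ι = ι} v)) , ∣ʳ (∣ʳ (∣ʳ w))))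
        with VisR⁻ V v | vis-tokens⁻ S w
      ... | i , E , p , _ | κ , j , _ , k , _ , q , _ with channel-view {ι} E | inner-fired k
      ...   | l , m , t , refl | _ , n , s , _ , e =
        ⊥-elim (left≢token m (conn-R {P₀} {R} {S} (conn₀ m) t) n s (trans (free-inj (trans (sym p) q)) e))
      backward (enabled (∣ʳ (sync x y) , g , ε , ∣ʳ (∣ˡ (∣ʳ v)) , ∣ʳ (∣ʳ (∣ˡ w))))
        with sview v | vis-tokens⁻ S w
      ... | inner _ _ _ _ u   | κ , j , _ , k , _ , q , _ = ⊥-elim (offS u (inner-< k) q)
      ... | unfired _ _ _ u   | κ , j , _ , k , _ , q , _ = ⊥-elim (offS u (inner-< k) q)
      ... | outer κ′ i _ k′ p _ | κ , j , _ , k , _ , q , _ with outer-fired k′ | inner-fired k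
      ...   | _ , m , _ , r , e | _ , n , s , _ , e′ =
        ⊥-elim (left≢token m r n s (trans (sym e) (trans (free-inj (trans (sym p) q)) e′)))
      backward (enabled (∣ʳ (sync x y) , g , ε , ∣ʳ (∣ˡ (∣ʳ v)) , ∣ʳ (∣ʳ (∣ˡ w))))
          | confirm κ′ i refl k′ F _ p | κ , j , refl , k , _ , q , _
        with inner-injective k′ (subst (λ i → kind κ ≡ inner i) (free-inj (trans (sym q) p)) k)
      ...   | refl = step (good κ) refl (good k F (token-fresh (vis-unfired w)) V)
      backward (enabled (∣ʳ (sync x y) , g , ε , ∣ʳ (∣ˡ (∣ʳ v)) , ∣ʳ (∣ʳ (∣ʳ w))))
        with sview v | vis-tokens⁻ S w
      ... | inner _ _ _ _ u   | κ , j , _ , k , _ , q , _ = ⊥-elim (offS u (inner-< k) q)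
      ... | unfired _ _ _ u   | κ , j , _ , k , _ , q , _ = ⊥-elim (offS u (inner-< k) q)
      ... | confirm _ _ _ _ _ d _ | κ , j , _ , k , d′ , q , _ = ⊥-elim (neg≢opposite-neg d d′)
      ... | outer κ′ i _ k′ p _ | κ , j , _ , k , _ , q , _ with outer-fired k′ | inner-fired k
      ...   | _ , m , _ , r , e | _ , n , s , _ , e′ =
        ⊥-elim (left≢token m r n s (trans (sym e) (trans (free-inj (trans (sym p) q)) e′)))

  -- Patterns of runs.

  saddr? : ∀ α → Dec (SAddr α)
  saddr? []      = no λ ()
  saddr? (i ∷ κ) with i ℤ.≟ + 2
  ... | yes refl = yes (κ , refl)
  ... | no ¬p    = no λ { (_ , refl) → ¬p refl }

  Shared : Position → Set
  Shared γ = RAddr γ ⊎ SAddr γ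

  r-label-shared : ∀ {P R S l γ} → Conn ((P ∥ R) ∣ S) l → RLabel l → Touches γ l → Shared γ
  r-label-shared (∣ˡ (∥ʳ C))     r (inj₁ refl) = inj₁ (_ , refl)
  r-label-shared (∣ˡ (∥ʳ C))     r (inj₂ refl) = inj₁ (_ , refl)
  r-label-shared (sync (∥ʳ x) y) r (inj₁ refl) = inj₁ (_ , refl)
  r-label-shared (sync (∥ʳ x) y) r (inj₂ refl) = inj₂ (_ , refl)
  r-label-shared (∣ˡ (∥ˡ C))     (_ , ())
  r-label-shared (∣ʳ C)          (_ , ())
  r-label-shared (sync (∥ˡ x) y) (_ , ())

  act-right : ∀ {P Q κ} → Act (P ∣ Q) (+ 2 ∷ κ) → Act Q κ
  act-right (∣ʳ x) = x

  -- The part of a run of (P ∥ R) ∣ S that determines the test for P.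

  marks : Label → List (Label ⊎ Position)
  marks l with rlabel? l
  ... | yes _ = [ inj₁ l ]
  ... | no _  = map inj₂ (filter saddr? (proj₁ l ∷ proj₂ l ∷ []))

  marks-R : ∀ {l} → RLabel l → inj₁ l ∈ marks l
  marks-R {l} r with rlabel? l
  ... | yes _ = here refl
  ... | no ¬r = ⊥-elim (¬r r)

  marks-R⁻ : ∀ {l m} → inj₁ m ∈ marks l → m ≡ l × RLabel l
  marks-R⁻ {l} i with rlabel? l
  marks-R⁻ (here refl) | yes r = refl , r
  marks-R⁻ {l} i | no _ with ∈-map⁻ inj₂ i
  ... | _ , _ , ()

  marks-S : ∀ {l α} → ¬ RLabel l → SAddr α → Touches α l → inj₂ α ∈ marks l
  marks-S {l} ¬r s t with rlabel? l
  ... | yes r = ⊥-elim (¬r r)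
  ... | no _  = ∈-map⁺ inj₂ (∈-filter⁺ saddr? (listed t) s)
    where
    listed : ∀ {α} → Touches α l → α ∈ proj₁ l ∷ proj₂ l ∷ []
    listed (inj₁ e) = here e
    listed (inj₂ e) = there (here e)

  marks-S⁻ : ∀ {l α} → inj₂ α ∈ marks l → ¬ RLabel l × SAddr α × Touches α l
  marks-S⁻ {l} i with rlabel? l
  marks-S⁻ (here ()) | yes _
  marks-S⁻ {l} i | no ¬r with ∈-map⁻ inj₂ i
  ... | _ , j , refl with ∈-filter⁻ saddr? {xs = proj₁ l ∷ proj₂ l ∷ []} j
  ...   | here e , s         = ¬r , s , inj₁ e
  ...   | there (here e) , s = ¬r , s , inj₂ e

  projection : Path → List (Label ⊎ Position)
  projection = concatMap marks

  projection⁺ : ∀ {p l m} → l ∈ p → m ∈ marks l → m ∈ projection p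
  projection⁺ i j = ∈-concatMap⁺ marks (lose i j)

  projection⁻ : ∀ {p m} → m ∈ projection p → ∃[ l ] l ∈ p × m ∈ marks l
  projection⁻ {p} i = find (∈-concatMap⁻ marks {xs = p} i)

  infix 4 _≈ᵖ_

  record _≈ᵖ_ (p q : Path) : Set where
    constructor same
    field
      ⊆ᵖ : All (_∈ projection q) (projection p)
      ⊇ᵖ : All (_∈ projection p) (projection q)

  _≈ᵖ?_ : Decidable _≈ᵖ_
  p ≈ᵖ? q = map′ (λ (i , j) → same i j) (λ (same i j) → i , j)
    (All.all? (_∈? projection q) (projection p) ×-dec All.all? (_∈? projection p) (projection q))
    where open DecMembership (Sum.≡-dec Cancellation._≟_ _≟ᵖ_) using (_∈?_)

  ≈ᵖ-equivalence : IsEquivalence _≈ᵖ_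
  ≈ᵖ-equivalence = record
    { refl  = same (All.tabulate id) (All.tabulate id)
    ; sym   = λ (same i j) → same j i
    ; trans = λ (same i j) (same k l) → same (All.map (All.lookup k) i) (All.map (All.lookup j) l)
    }

  ∼⇒≈ᵖ : ∀ {p q} → p ∼ q → p ≈ᵖ q
  ∼⇒≈ᵖ e with ∼⇒≐ e
  ... | i , j = same (All.tabulate (go i)) (All.tabulate (go j))
    where
    go : ∀ {p q} → (∀ {l} → l ∈ p → l ∈ q) → ∀ {m} → m ∈ projection p → m ∈ projection q
    go i k with projection⁻ k
    ... | l , x , y = projection⁺ (i x) y

  past⁺ : ∀ {p} {l : Label} → l ∈ p → l ∈ past p
  past⁺ = Any.reverse⁺

  past⁻ : ∀ {p} {l : Label} → l ∈ past p → l ∈ p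
  past⁻ = Any.reverse⁻

  -- Executions of the test and the consequences of maximality.

  module Sum∥ (R S P₀ : Term) (w₀ : Path) (W₀ : VH (Partners.NX R S P₀ (past w₀) P₀) (past w₀))
              (stuck₀ : ∀ l → ¬ Enabled (Partners.NX R S P₀ (past w₀) P₀) (past w₀) l) where

    private
      h₀ : Path
      h₀ = past w₀

    open Partners R S P₀ h₀
    open WithHistory W₀
    open Simulation R S P₀ h₀ W₀
    open Backward R S P₀ h₀ W₀

    mains-∈ : ∀ {ts l} → main l ∈ ts → l ∈ mains ts
    mains-∈ {main _ ∷ ts} (here refl) = here refl
    mains-∈ {main _ ∷ ts} (there j)   = there (mains-∈ j)
    mains-∈ {good _ ∷ ts} (there j)   = mains-∈ j

    ∈-mains : ∀ {ts l} → l ∈ mains ts → main l ∈ ts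
    ∈-mains {main _ ∷ ts} (here refl) = here refl
    ∈-mains {main _ ∷ ts} (there j)   = there (∈-mains j)
    ∈-mains {good _ ∷ ts} j           = there (∈-mains j)

    good∈? : ∀ κ (ts : List Step) → Dec (good κ ∈ ts)
    good∈? κ []            = no λ ()
    good∈? κ (main l ∷ ts) with good∈? κ ts
    ... | yes i = yes (there i)
    ... | no ¬i = no λ { (there i) → ¬i i }
    good∈? κ (good κ′ ∷ ts) with κ ≟ᵖ κ′ | good∈? κ ts
    ... | yes refl | _     = yes (here refl)
    ... | no _     | yes i = yes (there i)
    ... | no ¬e    | no ¬i = no λ { (here refl) → ¬e refl ; (there i) → ¬i i }

    module _ {P : Term} where

      NY : Naming Src (Y P)
      NY = canonical (Y P)

      good-kind : ∀ {ts κ} → TS P ts → good κ ∈ ts → ∃[ i ] kind κ ≡ inner i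
      good-kind (main _ _ V)   (there i)   = good-kind V i
      good-kind (good k _ _ V) (here refl) = _ , k
      good-kind (good _ _ _ V) (there i)   = good-kind V i

      forward : ∀ {ts} → TS P ts → VH NY (map emit ts)
      forward []             = []
      forward (main x o V)   = step-forward V x (proj₁ o)
        (λ ¬r t i k → no-inner V (proj₂ (proj₂ o ¬r t)) k) ∷ forward V
      forward (good k F n V) = good-forward V k F n ∷ forward V

      ts-weight : ∀ {ts} → TS P ts → st (X P) (mu nX (mains ts)) ≈ st (Y P) (mu ev (map emit ts))
      ts-weight V =
        𝕂.trans (𝕂.*-assoc _ _ _)
        (𝕂.*-cong (𝕂.reflexive (trans (st-acts P (λ x → ts-place V (∣ˡ (∥ˡ x)))) (sym (st-rename P))))
        (𝕂.trans (𝕂.*-cong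
            (𝕂.reflexive (trans (st-acts R (λ x → ts-place V (∣ˡ (∥ʳ x)))) (sym (st-R R (λ {κ} → channelled V {κ})))))
            (𝕂.trans (𝕂.reflexive (st-acts S (λ x → ts-place V (∣ʳ x)))) (𝕂.sym (st-S S (λ {κ} → allowed V {κ})))))
          -- The tokens contribute `1#`: positive ones have `1#` behind them, and negative ones
          -- never fire in an execution (`ts-bad`).
          (𝕂.sym (𝕂.trans (𝕂.*-congˡ (1*1 {A = Src} (st-tokens {A = Src} S (λ _ → inj₁ 𝕂.refl)) (st-tokens {A = Src} S (λ _ → inj₂ (ts-bad V)))))
                          (𝕂.*-identityʳ _)))))

      -- Quantifying over all later histories makes the property persist when the history is
      -- prolonged.
      Dead : Path → Set ℓ
      Dead h = ∀ h′ → (∀ {α} → Fired (mu ev h α) → Fired (mu ev h′ α)) → st (Y P) (mu ev h′) ≈ 0#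

      executions : ∀ {h} → VH NY h → (∃[ ts ] h ≡ map emit ts × TS P ts) ⊎ Dead h
      executions [] = inj₁ ([] , refl , [])
      executions (_∷_ {l} {h} x W) with executions W
      ... | inj₂ dead = inj₂ (λ h′ F → dead h′ (F ∘ fired-there h l))
      ... | inj₁ (ts , refl , V) with backward V x
      ...   | step t refl V′ = inj₁ (t ∷ ts , refl , V′)
      ...   | bad κ i k n o refl = inj₂ λ h′ F →
        0*ʳ {A = Src} (0*ʳ {A = Src} (0*ʳ {A = Src} (st-token-fired o k (F (mu-fired {n = ev} (l ∷ h) (inj₂ refl) (here refl))))))
      ...   | wrong l′ refl y κ t k o = inj₂ λ h′ F →
        0*ʳ {A = Src} (0*ˡ {A = Src} (0*ʳ {A = Src} (st-unfired o k (fired-S V)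
          (λ {κ′} → later h′ F {κ′}) (F (mu-fired {n = ev} (l ∷ h) (placed t) (here refl))))))
        where
        placed : Touches (+ 2 ∷ κ) l′ → Touches (+ 2 ∷ + 1 ∷ + 2 ∷ a κ) (φ l′)
        placed (inj₁ refl) = inj₁ refl
        placed (inj₂ refl) = inj₂ refl
        later : ∀ h′ → (∀ {α} → Fired (mu ev (φ l′ ∷ map emit ts) α) → Fired (mu ev h′ α)) →
                ∀ {κ′} → Fired (mu nX (mains ts) (+ 2 ∷ κ′)) → Fired (mu ev h′ (+ 2 ∷ + 1 ∷ + 2 ∷ a κ′))
        later h′ F {κ′} (_ , e) with mu-label {n = nX} (mains ts) e
        ... | m , i , s , _ = F (fired-there (map emit ts) (φ l′)
                (mu-fired {n = ev} {l = φ m} (map emit ts) (touched s) (∈-map⁺ emit (∈-mains i))))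
          where
          touched : Touches (+ 2 ∷ κ′) m → Touches (+ 2 ∷ + 1 ∷ + 2 ∷ a κ′) (φ m)
          touched (inj₁ refl) = inj₁ refl
          touched (inj₂ refl) = inj₂ refl

      module _ {ts : List Step} (V : TS P ts) (stuck : ∀ l → ¬ Enabled NY (map emit ts) l) where

        private
          μX : Position → Maybe Src
          μX = mu nX (mains ts)

        touch-label : ∀ {γ} → Fired (μX γ) → ∃[ m ] m ∈ mains ts × Touches γ m
        touch-label (_ , e) with mu-label {n = nX} (mains ts) e
        ... | m , i , t , _ = m , i , t

        fires-R : ∀ {l γ} → l ∈ h₀ → RLabel l → Touches γ l → Shared γ → Fired (μX γ) → l ∈ mains ts
        fires-R i r t s F with touch-label F
        ... | m , j , u with rlabel? m
        ...   | yes r′ with unique₀ i (proj₁ (ts-ok V j) r′) t u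
        ...     | refl = j
        fires-R i r t (inj₁ (_ , refl)) F | m , j , u | no ¬r = ⊥-elim (¬r (conn-R {P} {R} {S} (ts-conn V j) u))
        fires-R i r t (inj₂ (_ , refl)) F | m , j , u | no ¬r =
          ⊥-elim (no-inner V (proj₂ (proj₂ (ts-ok V j) ¬r u)) (kind-outer i t r))

        -- Induction along the prescribed history. If both ends of a synchronisation with R were
        -- unfired, everything it depends on would have fired by induction, so `transfer-open` would
        -- enable it, against maximality. If an `inner` action were unfired, its two tokens could
        -- still react with each other, again against maximality.
        all-fired′ : ∀ {h} → VH (NX P₀) h → (∀ {l} → l ∈ h → l ∈ h₀) →
                     ∀ {l γ} → l ∈ h → Touches γ l → Shared γ → Fired (μX γ)
        all-fired′ (x ∷ W) f (there i) t s = all-fired′ W (f ∘ there) i t s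
        all-fired′ (_∷_ {l} {h} x@(enabled (C , g , ε , v , w)) W) f {γ = γ} (here refl) t s with rlabel? l
        ... | yes r = fired-by (fired? (μX (proj₁ l))) (fired? (μX (proj₂ l)))
          where
          μ-∈ : l ∈ mains ts → Fired (μX γ)
          μ-∈ i = mu-fired (mains ts) t i
          earlier : ∀ {γ} → Shared γ → Fired (mu nX h γ) → Fired (μX γ)
          earlier s (_ , e) with mu-label {n = nX} h e
          ... | m , i , u , _ = all-fired′ W (f ∘ there) i u s
          fired-by : Fired (μX (proj₁ l)) ⊎ μX (proj₁ l) ≡ nothing →
                     Fired (μX (proj₂ l)) ⊎ μX (proj₂ l) ≡ nothing → Fired (μX γ)
          fired-by (inj₁ F) _ = μ-∈ (fires-R (f (here refl)) r (inj₁ refl) (inj₁ r) F)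
          fired-by (inj₂ _) (inj₁ F) =
            μ-∈ (fires-R (f (here refl)) r (inj₂ refl) (r-label-shared C r (inj₂ refl)) F)
          fired-by (inj₂ p) (inj₂ q) = ⊥-elim (stuck _ (step-forward V
            (transfer-open (ts-vh V) W (h₀-compatible V (f ∘ there)) x r earlier
              (λ { (inj₁ refl) → p ; (inj₂ refl) → q }))
            (λ _ → f (here refl)) (λ ¬r → ⊥-elim (¬r r))))
        all-fired′ (_∷_ {l} {h} x@(enabled (C , g , ε , v , w)) W) f (here refl) t (inj₁ (_ , refl)) | no ¬r =
          ⊥-elim (¬r (conn-R {P₀} {R} {S} C t))
        all-fired′ (_∷_ {l} {h} x@(enabled (C , g , ε , v , w)) W) f (here refl) t (inj₂ (κ , refl)) | no ¬r
          with fired? (μX (+ 2 ∷ κ))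
        ... | inj₁ F = F
        ... | inj₂ z = ⊥-elim (stuck _ (bad-forward V (kind-inner (f (here refl)) t ¬r) (act-S t)
                         (λ i → fired≢nothing (ts-good-fired V i) z)))
          where
          act-S : Touches (+ 2 ∷ κ) l → Act S κ
          act-S (inj₁ refl) = act-right (proj₁ (conn-acts C))
          act-S (inj₂ refl) = act-right (proj₂ (conn-acts C))

        all-fired : ∀ {l γ} → l ∈ h₀ → Touches γ l → Shared γ → Fired (μX γ)
        all-fired = all-fired′ W₀ id

        all-good : ∀ {κ i} → kind κ ≡ inner i → good κ ∈ ts
        all-good {κ} k with good∈? κ ts
        ... | yes i = i
        ... | no ¬i with inner-fired k
        ...   | l , j , t , _ = ⊥-elim (stuck _ (good-forward V k (all-fired j t (inj₂ (_ , refl))) ¬i))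

        fired₀ : ∀ {γ} → Shared γ → Fired (μX γ) → Fired (mu nX h₀ γ)
        fired₀ (inj₁ (ι , refl)) F with touch-label F
        ... | m , i , t = mu-fired h₀ t (proj₁ (ts-ok V i) (conn-R {P} {R} {S} (ts-conn V i) t))
        fired₀ (inj₂ (κ , refl)) F with kind κ | kind-view κ | fired-S V F
        ... | _ | unfired _   | n = ⊥-elim (n refl)
        ... | _ | outer i t _ | _ = mu-fired h₀ t i
        ... | _ | inner i t _ | _ = mu-fired h₀ t i

        unfired₀ : ∀ {γ} → Shared γ → μX γ ≡ nothing → mu nX h₀ γ ≡ nothing
        unfired₀ {γ} s z with fired? (mu nX h₀ γ)
        ... | inj₂ z′ = z′
        ... | inj₁ (_ , e) with mu-label {n = nX} h₀ e
        ...   | m , i , t , _ = ⊥-elim (fired≢nothing (all-fired i t s) z)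

        compatible₀ : Compatible h₀ (mains ts)
        compatible₀ = record
          { on-R = λ i j t u → unique₀ i (proj₁ (ts-ok V j) (conn-R {P} {R} {S} (ts-conn V j) u)) t u
          ; on-S = λ i j t u r → unique₀ i (proj₁ (ts-ok V j) r) t u }

        enabled-unfired : ∀ {l γ} → Enabled (NX P) (mains ts) l → Touches γ l → μX γ ≡ nothing
        enabled-unfired (enabled (_ , _ , _ , v , _)) (inj₁ refl) = vis-unfired v
        enabled-unfired (enabled (_ , _ , _ , _ , w)) (inj₂ refl) = vis-unfired w

        -- A further synchronisation with R could be carried back to the end of the prescribed run,
        -- which is stuck; any other label could be imitated by the test, which is stuck too.
        stuckX : ∀ l → ¬ Enabled (NX P) (mains ts) l
        stuckX l x@(enabled (C , _)) with rlabel? l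
        ... | yes r = stuck₀ l (transfer-open W₀ (ts-vh V) compatible₀ x r fired₀
                        (λ t → unfired₀ (r-label-shared C r t) (enabled-unfired x t)))
        ... | no ¬r = stuck _ (step-forward V x (λ r → ⊥-elim (¬r r)) not-outer′)
          where
          not-outer′ : ¬ RLabel l → ∀ {κ} → Touches (+ 2 ∷ κ) l → NotOuter V κ
          not-outer′ _ t i k with outer-fired k
          ... | m , j , u , _ = fired≢nothing (all-fired j u (inj₂ (_ , refl))) (enabled-unfired x t)

        projected : ∀ {p} → past p ≡ mains ts → p ≈ᵖ w₀
        projected {p} e = same (All.tabulate to) (All.tabulate from)
          where
          in-mains : ∀ {l} → l ∈ p → l ∈ mains ts
          in-mains i = subst (_ ∈_) e (past⁺ i)
          from-mains : ∀ {l} → l ∈ mains ts → l ∈ p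
          from-mains i = past⁻ (subst (_ ∈_) (sym e) i)
          to : ∀ {m} → m ∈ projection p → m ∈ projection w₀
          to {inj₁ m} i with projection⁻ {p} i
          ... | l , j , k with marks-R⁻ {l} k
          ...   | refl , r = projection⁺ (past⁻ {w₀} (proj₁ (ts-ok V (in-mains j)) r)) (marks-R r)
          to {inj₂ α} i with projection⁻ {p} i
          ... | l , j , k with marks-S⁻ {l} k
          ...   | ¬r , (κ , refl) , t with inner-fired (proj₂ (proj₂ (ts-ok V (in-mains j)) ¬r t))
          ...     | l′ , j′ , t′ , ¬r′ , _ = projection⁺ (past⁻ {w₀} j′) (marks-S ¬r′ (κ , refl) t′)
          from : ∀ {m} → m ∈ projection w₀ → m ∈ projection p
          from {inj₁ m} i with projection⁻ {w₀} i
          ... | l , j , k with marks-R⁻ {l} k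
          ...   | refl , r = projection⁺ (from-mains (fires-R (past⁺ j) r (inj₁ refl) (inj₁ r)
                               (all-fired (past⁺ j) (inj₁ refl) (inj₁ r)))) (marks-R r)
          from {inj₂ α} i with projection⁻ {w₀} i
          ... | l , j , k with marks-S⁻ {l} k
          ...   | ¬r , (κ , refl) , t with touch-label (all-fired (past⁺ j) t (inj₂ (κ , refl)))
          ...     | m , n , u with rlabel? m
          ...       | no ¬r′ = projection⁺ (from-mains n) (marks-S ¬r′ (κ , refl) u)
          ...       | yes r′ with unique₀ (past⁺ j) (proj₁ (ts-ok V n) r′) t u
          ...         | refl = ⊥-elim (¬r r′)

  -- The weighted correspondence between the runs of one pattern and those of the test.

  module Match∥ (R S P₀ : Term) (w₀ : Path) (W₀ : VH (Partners.NX R S P₀ (past w₀) P₀) (past w₀))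
                (stuck₀ : ∀ l → ¬ Enabled (Partners.NX R S P₀ (past w₀) P₀) (past w₀) l) where

    private
      h₀ : Path
      h₀ = past w₀

    open Partners R S P₀ h₀
    open WithHistory W₀
    open Simulation R S P₀ h₀ W₀
    open Backward R S P₀ h₀ W₀
    open Sum∥ R S P₀ w₀ W₀ stuck₀

    module _ {P : Term} where

      -- Stated by membership alone, hence stable under homotopy; by `≐⇒∼` either path determines
      -- the other as a run.
      record Match (p q : Path) : Set where
        field
          agree : p ≈ᵖ w₀
          to    : ∀ {l} → l ∈ p → φ l ∈ q
          from  : ∀ {l} → l ∈ q → (∃[ m ] m ∈ p × l ≡ φ m) ⊎
                                  (∃[ κ ] ∃[ i ] kind κ ≡ inner i × l ≡ emit (good κ))
          goods : ∀ {κ i} → kind κ ≡ inner i → emit (good κ) ∈ q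

      match-left : ∀ {p p′ q} → Max (NX P) p → Max (NX P) p′ → Match p q → Match p′ q → p ∼ p′
      match-left {q = q} m m′ x x′ = ≐⇒∼ (NX P) (proj₁ m) (proj₁ m′) (go m m′ x x′ , go m′ m x′ x)
        where
        go : ∀ {p p′} → Max (NX P) p → Max (NX P) p′ → Match p q → Match p′ q → ∀ {l} → l ∈ p → l ∈ p′
        go m m′ x x′ {l} i with Match.from x′ (Match.to x i) | All.lookup (sv-all-conn (proj₁ m)) i
        ... | inj₁ (l′ , j , e) | C
          rewrite φ-inj {P} {R} {S} C (All.lookup (sv-all-conn (proj₁ m′)) j) e = j
        ... | inj₂ (κ , _ , _ , e) | C =
          ⊥-elim (place≢ {P} {κ = κ} (proj₁ (conn-acts C)) (sym (cong proj₁ e)))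

      match-right : ∀ {p q q′} → Max (NY {P}) q → Max (NY {P}) q′ → Match p q → Match p q′ → q ∼ q′
      match-right {p} m m′ x x′ = ≐⇒∼ (NY {P}) (proj₁ m) (proj₁ m′) (go x x′ , go x′ x)
        where
        go : ∀ {q q′} → Match p q → Match p q′ → ∀ {l} → l ∈ q → l ∈ q′
        go x x′ i with Match.from x i
        ... | inj₁ (m , j , refl)     = Match.to x′ j
        ... | inj₂ (κ , _ , k , refl) = Match.goods x′ k

      match-∼ : ∀ {p p′ q q′} → p ∼ p′ → q ∼ q′ → Match p q → Match p′ q′
      match-∼ e f x with ∼⇒≐ e | ∼⇒≐ f
      ... | i , j | k , l = record
        { agree = IsEquivalence.trans ≈ᵖ-equivalence (∼⇒≈ᵖ (∼-sym e)) (Match.agree x)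
        ; to    = λ y → k (Match.to x (j y))
        ; from  = λ y → [ (λ (m , z , p) → inj₁ (m , i z , p)) , inj₂ ]′ (Match.from x (l y))
        ; goods = λ y → k (Match.goods x y) }

      -- From a run of X P to a run of Y P: all confirmations come last.

      mains-only : ∀ {h} → VH (NX P) h → (∀ {l} → l ∈ h → Ok l) →
                   mains (map main h) ≡ h × TS P (map main h)
      mains-only []                ok = refl , []
      mains-only (_∷_ {l} {h} x W) ok with mains-only W (ok ∘ there)
      ... | e , V = cong (l ∷_) e
                  , main (subst (λ h → Enabled (NX P) h l) (sym e) x) (ok (here refl)) V

      -- The actions to be confirmed are found along a list of candidates; `sites` contains every
      -- address of kind `inner`.
      confirm-all : ∀ L {ts} → TS P ts →
                    (∀ {κ i} → kind κ ≡ inner i → Fired (mu nX (mains ts) (+ 2 ∷ κ))) →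
                    ∃[ ts′ ] TS P ts′ × mains ts′ ≡ mains ts ×
                    (∀ {κ} → good κ ∈ ts → good κ ∈ ts′) ×
                    (∀ {κ i} → kind κ ≡ inner i → + 2 ∷ κ ∈ L → good κ ∈ ts′)
      confirm-all []      {ts} V F = ts , V , refl , id , λ _ ()
      confirm-all (α ∷ L) {ts} V F with saddr? α
      ... | no ¬s with confirm-all L V F
      ...   | ts′ , V′ , e , old , new =
        ts′ , V′ , e , old , λ { k (here refl) → ⊥-elim (¬s (_ , refl)) ; k (there i) → new k i }
      confirm-all (α ∷ L) {ts} V F | yes (κ , refl) with good∈? κ ts
      ... | yes j with confirm-all L V F
      ...   | ts′ , V′ , e , old , new =
        ts′ , V′ , e , old , λ { k (here refl) → old j ; k (there i) → new k i }
      confirm-all (α ∷ L) {ts} V F | yes (κ , refl) | no ¬j with kind κ in k₀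
      ... | inner i with confirm-all L (good k₀ (F k₀) ¬j V) F
      ...   | ts′ , V′ , e , old , new =
        ts′ , V′ , e , (λ j → old (there j)) , λ { k (here refl) → old (here refl) ; k (there i) → new k i }
      confirm-all (α ∷ L) {ts} V F | yes (κ , refl) | no ¬j | unfired with confirm-all L V F
      ... | ts′ , V′ , e , old , new = ts′ , V′ , e , old , λ { k (here refl) → ⊥-elim (clash k₀ k) ; k (there i) → new k i }
        where
        clash : ∀ {k : Kind} {i} → k ≡ unfired → k ≢ inner i
        clash refl ()
      confirm-all (α ∷ L) {ts} V F | yes (κ , refl) | no ¬j | outer _ with confirm-all L V F
      ... | ts′ , V′ , e , old , new = ts′ , V′ , e , old , λ { k (here refl) → ⊥-elim (no-inner V k k₀) ; k (there i) → new k i }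

      ok-of : ∀ {p l} → p ≈ᵖ w₀ → l ∈ p → Ok l
      ok-of {p} {l} (same p⊆ _) i = forR , forS
        where
        forR : RLabel l → l ∈ h₀
        forR r with projection⁻ {w₀} (All.lookup p⊆ (projection⁺ {p} i (marks-R r)))
        ... | l′ , j , k with marks-R⁻ {l′} k
        ...   | refl , _ = past⁺ {w₀} j
        forS : ¬ RLabel l → ∀ {κ} → Touches (+ 2 ∷ κ) l → ∃[ i ] kind κ ≡ inner i
        forS ¬r t with projection⁻ {w₀} (All.lookup p⊆ (projection⁺ {p} i (marks-S ¬r (_ , refl) t)))
        ... | l′ , j , k with marks-S⁻ {l′} k
        ...   | ¬r′ , _ , t′ = _ , kind-inner (past⁺ {w₀} j) t′ ¬r′

      inner-done : ∀ {p κ i} → p ≈ᵖ w₀ → kind κ ≡ inner i → Fired (mu nX (past p) (+ 2 ∷ κ))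
      inner-done {p} {κ} (same _ w₀⊆) k with inner-fired k
      ... | l , j , t , ¬r , _
        with projection⁻ {p} (All.lookup w₀⊆ (projection⁺ {w₀} (past⁻ {w₀} j) (marks-S ¬r (κ , refl) t)))
      ...   | l′ , j′ , k′ with marks-S⁻ {l′} k′
      ...     | _ , _ , t′ = mu-fired {n = nX} (past p) t′ (past⁺ {p} j′)

      record Complete (p : Path) : Set c where
        field
          {ts}      : List Step
          execution : TS P ts
          ms        : mains ts ≡ past p
          confirmed : ∀ {κ i} → kind κ ≡ inner i → good κ ∈ ts

      complete : ∀ {p} → SV (NX P) [] p → p ≈ᵖ w₀ → Complete p
      complete {p} V s = record
        { execution = proj₁ (proj₂ finished)
        ; ms        = trans (proj₁ (proj₂ (proj₂ finished))) (proj₁ started)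
        ; confirmed = confirmed }
        where
        started : mains (map main (past p)) ≡ past p × TS P (map main (past p))
        started = mains-only (sv⇒vh V []) (λ i → ok-of s (past⁻ i))
        finished : ∃[ ts′ ] TS P ts′ × mains ts′ ≡ mains (map main (past p)) ×
                   (∀ {κ} → good κ ∈ map main (past p) → good κ ∈ ts′) ×
                   (∀ {κ i} → kind κ ≡ inner i → + 2 ∷ κ ∈ sites → good κ ∈ ts′)
        finished = confirm-all sites (proj₂ started)
          (λ {κ} k → subst (λ h → Fired (mu nX h (+ 2 ∷ κ))) (sym (proj₁ started)) (inner-done s k))
        confirmed : ∀ {κ i} → kind κ ≡ inner i → good κ ∈ proj₁ finished
        confirmed k = let l , j , t , _ = inner-fired k in
          proj₂ (proj₂ (proj₂ (proj₂ finished))) k (∈-addresses j t)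

      execution-match : ∀ {p q ts} → TS P ts → p ≈ᵖ w₀ → mains ts ≡ past p → past q ≡ map emit ts →
                        (∀ {κ i} → kind κ ≡ inner i → good κ ∈ ts) → Match p q
      execution-match {p} {q} {ts} V s ms e confirmed = record
        { agree = s
        ; to    = λ i → ∈q (∈-map⁺ emit (∈-mains {ts} (subst (_ ∈_) (sym ms) (past⁺ i))))
        ; from  = from
        ; goods = λ k → ∈q (∈-map⁺ emit (confirmed k)) }
        where
        ∈q : ∀ {l} → l ∈ map emit ts → l ∈ q
        ∈q i = past⁻ (subst (_ ∈_) (sym e) i)
        from : ∀ {l} → l ∈ q → (∃[ m ] m ∈ p × l ≡ φ m) ⊎
                               (∃[ κ ] ∃[ i ] kind κ ≡ inner i × l ≡ emit (good κ))
        from i with ∈-map⁻ emit (subst (_ ∈_) e (past⁺ i))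
        ... | main m , j , refl = inj₁ (m , past⁻ (subst (m ∈_) ms (mains-∈ j)) , refl)
        ... | good κ , j , refl with good-kind V j
        ...   | i , k = inj₂ (κ , i , k , refl)

      run-to : ∀ {p} → Max (NX P) p → p ≈ᵖ w₀ →
               ∃[ q ] Max (NY {P}) q × Match p q × weight (NX P) p ≈ weight (NY {P}) q
      run-to {p} (VX , stuckX) s =
        q , (VY , stuckY) , execution-match V s ms e confirmed , weights
        where
        open Complete (complete VX s) renaming (execution to V)
        emitted : ∃[ q ] past q ≡ map emit ts × SV (NY {P}) [] q
        emitted = vh⇒sv (forward V)
        q : Path
        q = proj₁ emitted
        e : past q ≡ map emit ts
        e = proj₁ (proj₂ emitted)
        VY : SV (NY {P}) [] q
        VY = proj₂ (proj₂ emitted)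
        no-main : ∀ {l} → ¬ Enabled (NX P) (mains ts) l
        no-main {l} y = stuckX l (subst (λ h → Enabled (NX P) h l) ms y)
        -- A main step or a wrong firing would prolong the run of `X P`, and a token can react only
        -- for an action not yet confirmed.
        refute : ∀ {l} → ¬ Class V l
        refute (step (main l) _ (main y _ _))  = no-main y
        refute (step (good κ) _ (good k _ n _)) = n (confirmed k)
        refute (bad κ i k n _ _)                = n (confirmed k)
        refute (wrong l _ y _ _ _ _)            = no-main y
        stuckY : ∀ l → ¬ Enabled (NY {P}) (past q) l
        stuckY l x = refute (backward V (subst (λ h → Enabled (NY {P}) h l) e x))
        weights : weight (NX P) p ≈ weight (NY {P}) q
        weights = subst₂ (λ h h′ → st (X P) (mu nX h) ≈ st (Y P) (mu ev h′)) ms (sym e) (ts-weight V)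

      run-of : ∀ {q ts} → past q ≡ map emit ts → TS P ts → Max (NY {P}) q →
               ∃[ p ] Max (NX P) p × p ≈ᵖ w₀ × Match p q
      run-of {q} {ts} e V (_ , stuckY) = p , (VX , stuck′) , s , execution-match V s (sym e′) e (all-good V stuck)
        where
        projected-run : ∃[ p ] past p ≡ mains ts × SV (NX P) [] p
        projected-run = vh⇒sv (ts-vh V)
        p : Path
        p = proj₁ projected-run
        e′ : past p ≡ mains ts
        e′ = proj₁ (proj₂ projected-run)
        VX : SV (NX P) [] p
        VX = proj₂ (proj₂ projected-run)
        stuck : ∀ l → ¬ Enabled (NY {P}) (map emit ts) l
        stuck l x = stuckY l (subst (λ h → Enabled (NY {P}) h l) (sym e) x)
        stuck′ : ∀ l → ¬ Enabled (NX P) (past p) l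
        stuck′ l x = stuckX V stuck l (subst (λ h → Enabled (NX P) h l) e′ x)
        s : p ≈ᵖ w₀
        s = projected V stuck e′

      run-from : ∀ {q} → Max (NY {P}) q →
                 weight (NY {P}) q ≈ 0# ⊎ ∃[ p ] Max (NX P) p × p ≈ᵖ w₀ × Match p q
      run-from {q} m = [ (λ (ts , e , V) → inj₂ (run-of e V m)) , (λ dead → inj₁ (dead (past q) id)) ]′
        (executions (sv⇒vh (proj₁ m) []))

      fibre-∥ : Σw Weight (fibre ≈ᵖ-equivalence _≈ᵖ?_ Weight path w₀ (runs (X P))) ≈ outcome (Y P)
      fibre-∥ = sum-match (NX P) (NY {P}) Match match-∼ weights
        match-left match-right to (λ m _ → run-from m)
        (lists-fibre (NX P) ≈ᵖ-equivalence _≈ᵖ?_ id ∼⇒≈ᵖ w₀) (runs-list (NY {P}))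
        where
        -- Weights were compared only for the run built by `run-to`; any other match of `p` is
        -- homotopic to it.
        weights : ∀ {p q} → Max (NX P) p → Max (NY {P}) q → Match p q → weight (NX P) p ≈ weight (NY {P}) q
        weights m m′ x = let q′ , m″ , x′ , e = run-to m (Match.agree x) in
          𝕂.trans e (𝕂.reflexive (weight-∼ (NY {P}) (match-right m″ m′ x′ x)))
        to : ∀ {p} → Max (NX P) p → p ≈ᵖ w₀ → weight (NX P) p ≈ 0# ⊎ ∃[ q ] Max (NY {P}) q × ⊤ × Match p q
        to m s = let q , m′ , x , _ = run-to m s in inj₂ (q , m′ , tt , x)

  -- Congruence for `∥`, and the theorem.

  hides : ℕ → Term → Term
  hides zero    T = T
  hides (suc n) T = hide (hides n T)

  -- `P` may use any free name, so the channels have to be hidden in the test; extruding these hides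
  -- shifts the names of `P` out of the way.
  extrude-hides : ∀ n P T → outcome (P ∣ hides n T) ≈ outcome (rename (shift n) P ∣ T)
  extrude-hides zero    P T = 𝕂.reflexive (cong (λ P → outcome (P ∣ T)) (sym (rename-id (λ _ → refl) P)))
  extrude-hides (suc n) P T =
    𝕂.trans (extrudeʳ P (hides n T)) (𝕂.trans (extrude-hides n (↑ P) T)
      (𝕂.reflexive (cong (λ P → outcome (P ∣ T)) (trans (rename-∘ P) (rename-cong (ℕ.+-suc n) P)))))

  module _ {P Q : Term} (E : P ≃ Q) (R S : Term) where

    -- `P₀` is whichever of `P` and `Q` supplied the run. Both fibres over its pattern are outcomes
    -- against the test built from it, so the hypothesis equates them, even where one fibre is
    -- empty.
    equal-fibres : ∀ P₀ (ρ : MaximalPath ((P₀ ∥ R) ∣ S)) →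
      Σw Weight (fibre ≈ᵖ-equivalence _≈ᵖ?_ Weight path (path ρ) (runs ((P ∥ R) ∣ S))) ≈
      Σw Weight (fibre ≈ᵖ-equivalence _≈ᵖ?_ Weight path (path ρ) (runs ((Q ∥ R) ∣ S)))
    equal-fibres P₀ ρ = 𝕂.trans (fibre-∥ {P}) (𝕂.trans test (𝕂.sym (fibre-∥ {Q})))
      where
      open Partners R S P₀ (past (path ρ)) using (N; T; Y; NX)
      run : Max (NX P₀) (path ρ)
      run = max⇒ (NX P₀) ρ
      open Match∥ R S P₀ (path ρ) (sv⇒vh (proj₁ run) []) (proj₂ run)
      test : outcome (Y P) ≈ outcome (Y Q)
      test = 𝕂.trans (𝕂.sym (extrude-hides N P T)) (𝕂.trans (E (hides N T)) (extrude-hides N Q T))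

    outcome-∥ : outcome ((P ∥ R) ∣ S) ≈ outcome ((Q ∥ R) ∣ S)
    outcome-∥ = Σw-fibres ≈ᵖ-equivalence _≈ᵖ?_ Weight Weight path path
      (runs ((P ∥ R) ∣ S)) (runs ((Q ∥ R) ∣ S))
      (λ {ρ} _ → equal-fibres P ρ) (λ {ρ} _ → equal-fibres Q ρ)

  ≃-∥ˡ : ∀ {P Q} → P ≃ Q → ∀ R → P ∥ R ≃ Q ∥ R
  ≃-∥ˡ {P} {Q} E R S = outcome-∥ {P} {Q} E R S

  ≃-∥ʳ : ∀ {P Q} → P ≃ Q → ∀ R → R ∥ P ≃ R ∥ Q
  ≃-∥ʳ {P} {Q} E R S = 𝕂.trans (outcome-iso (iso-∥-swap R P S))
    (𝕂.trans (≃-∥ˡ {P} {Q} E R S) (𝕂.sym (outcome-iso (iso-∥-swap R Q S))))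

theorem3p2 : ∀ {c ℓ} (𝕂 : CommutativeSemiring c ℓ) → let open Calculus 𝕂 in
    IsEquivalence _≃_
    × (∀ {P Q} → P ≋ Q → P ≃ Q)
    × (∀ {P Q} → P ≃ Q →
    (∀ (α : Action) → α ∙ P ≃ α ∙ Q)
    × (∀ R → P ∣ R ≃ Q ∣ R)
    × (∀ R → R ∣ P ≃ R ∣ Q)
    × (∀ R → P ∥ R ≃ Q ∥ R)
    × (∀ R → R ∥ P ≃ R ∥ Q)
    × ◇ P ≃ ◇ Q
    × (∀ (x : Name) → ν x P ≃ ν x Q))
theorem3p2 𝕂 =
    record
      { refl  = λ R → K.refl
      ; sym   = λ E R → K.sym (E R)
      ; trans = λ E F R → K.trans (E R) (F R)
      }
  , ≋⇒≃
  , λ {P} {Q} E → ≃-act {P} {Q} E , ≃-∣ˡ {P} {Q} E , ≃-∣ʳ {P} {Q} E , ≃-∥ˡ {P} {Q} E , ≃-∥ʳ {P} {Q} E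
              , ≃-◇ {P} {Q} E , λ x → ≃-ν {P} {Q} x E
  where
  module K = CommutativeSemiring 𝕂
  open Congruence 𝕂
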